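{- For every integer $n\geqslant 10$, the tree $H_n$ is determined by its adjacency spectrum if and only if $n\notin\{10,13,15\}$. Equivalently, the only graphs in the family $\{H_n \mid n\geqslant 10\}$ which are not determined by their spectrum are $H_{10}$, $H_{13}$ and $H_{15}$.
   Context: All graphs are finite, simple and undirected. The spectrum of a graph is the multiset of eigenvalues of its adjacency matrix $A(G)$. A graph $G$ is determined by its spectrum (DS) if every graph with the same spectrum as $G$ is isomorphic to $G$. For $r\geqslant 2$, $P_r$ denotes the path with vertices $0,1,\dots,r-1$, consecutive integers being adjacent. For $0<m_1<m_2<r-1$ and positive integers $n_1,n_2$, $P_{n_1,n_2;r}^{m_1,m_2}$ denotes the tree obtained from $P_r$ by attaching at vertex $m_i$ a pendant path with $n_i$ edges, for $i=1,2$. For $n\geqslant 10$, $H_n:=P_{2,2;n-4}^{2,n-7}$ (a tree with $n$ vertices). -}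

module Defs where

open import Data.Nat as ℕ using (ℕ; zero; suc; _∸_; _≡ᵇ_)
open import Data.Integer as ℤ using (ℤ; +_; -_)
open import Data.Fin using (Fin; toℕ; punchIn) renaming (zero to fz; suc to fs)
open import Data.Bool using (Bool; true; false; not; _∧_; _∨_; if_then_else_)
open import Data.Bool.Properties using (∨-comm)
open import Data.List using (List; []; _∷_; _++_; map; upTo)
open import Data.Bool.ListAction using (any)
open import Data.Product using (Σ; _×_; _,_)
open import Function.Bundles using (_↔_; Inverse)
open import Relation.Binary.PropositionalEquality using (_≡_; refl; cong; cong₂; trans)

record Graph (n : ℕ) : Set where
  field
    adj     : Fin n → Fin n → Bool
    adj-sym : ∀ i j → adj i j ≡ adj j i
    irrefl  : ∀ i → adj i i ≡ false
open Graph public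

-- Graph isomorphism (between graphs with possibly different vertex counts;
-- a bijection Fin n ↔ Fin m forces n ≡ m)
Isomorphic : ∀ {n m} → Graph n → Graph m → Set
Isomorphic {n} {m} G H =
  Σ (Fin n ↔ Fin m) λ σ →
    ∀ i j → adj G i j ≡ adj H (Inverse.to σ i) (Inverse.to σ j)

-- Polynomials over ℤ as coefficient lists (lowest degree first)

Poly : Set
Poly = List ℤ

coeff : Poly → ℕ → ℤ
coeff []       _       = + 0
coeff (a ∷ p)  zero    = a
coeff (a ∷ p)  (suc k) = coeff p k

infixl 6 _+ₚ_
infixl 7 _*ₚ_ _·ₚ_

_+ₚ_ : Poly → Poly → Poly
[]      +ₚ q       = q
(a ∷ p) +ₚ []      = a ∷ p
(a ∷ p) +ₚ (b ∷ q) = (a ℤ.+ b) ∷ (p +ₚ q)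

_·ₚ_ : ℤ → Poly → Poly
c ·ₚ p = map (c ℤ.*_) p

_*ₚ_ : Poly → Poly → Poly
[]      *ₚ q = []
(a ∷ p) *ₚ q = (a ·ₚ q) +ₚ (+ 0 ∷ (p *ₚ q))

negₚ : Poly → Poly
negₚ p = (- (+ 1)) ·ₚ p

_≈ₚ_ : Poly → Poly → Set
p ≈ₚ q = ∀ k → coeff p k ≡ coeff q k

sumFin : ∀ n → (Fin n → Poly) → Poly
sumFin zero    f = []
sumFin (suc n) f = f fz +ₚ sumFin n (λ i → f (fs i))

signed : ℕ → Poly → Poly
signed k p with k ℕ.% 2
... | zero = p
... | _    = negₚ p

det : ∀ n → (Fin n → Fin n → Poly) → Poly
det zero    M = + 1 ∷ []
det (suc n) M = sumFin (suc n) λ j →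
  signed (toℕ j) (M fz j *ₚ det n (λ i k → M (fs i) (punchIn j k)))

charPoly : ∀ {n} → Graph n → Poly
charPoly {n} G = det n λ i j →
  if toℕ i ≡ᵇ toℕ j then (+ 0 ∷ + 1 ∷ [])
  else (if adj G i j then (- (+ 1)) ∷ [] else [])

-- Two graphs have the same spectrum (the multiset of eigenvalues of the
-- real symmetric adjacency matrix) iff their characteristic polynomials agree.
Cospectral : ∀ {n m} → Graph n → Graph m → Set
Cospectral G H = charPoly G ≈ₚ charPoly H

DS : ∀ {n} → Graph n → Set
DS {n} G = ∀ m (H : Graph m) → Cospectral G H → Isomorphic G H

hasEdge : List (ℕ × ℕ) → ℕ → ℕ → Bool
hasEdge es u v = any (λ { (a , b) → (a ≡ᵇ u) ∧ (b ≡ᵇ v) }) es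

edgeAdj : List (ℕ × ℕ) → ℕ → ℕ → Bool
edgeAdj es u v = not (u ≡ᵇ v) ∧ (hasEdge es u v ∨ hasEdge es v u)

private
  n≡ᵇn : ∀ n → (n ≡ᵇ n) ≡ true
  n≡ᵇn zero    = refl
  n≡ᵇn (suc n) = n≡ᵇn n

  ≡ᵇ-sym : ∀ m n → (m ≡ᵇ n) ≡ (n ≡ᵇ m)
  ≡ᵇ-sym zero    zero    = refl
  ≡ᵇ-sym zero    (suc n) = refl
  ≡ᵇ-sym (suc m) zero    = refl
  ≡ᵇ-sym (suc m) (suc n) = ≡ᵇ-sym m n

fromEdges : ∀ n → List (ℕ × ℕ) → Graph n
fromEdges n es = record
  { adj     = λ i j → edgeAdj es (toℕ i) (toℕ j)
  ; adj-sym = λ i j → cong₂ _∧_ (cong not (≡ᵇ-sym (toℕ i) (toℕ j)))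
                                (∨-comm (hasEdge es (toℕ i) (toℕ j)) (hasEdge es (toℕ j) (toℕ i)))
  ; irrefl  = λ i → cong (λ b → not b ∧ (hasEdge es (toℕ i) (toℕ i) ∨ hasEdge es (toℕ i) (toℕ i))) (n≡ᵇn (toℕ i))
  }

pathEdges : ℕ → List (ℕ × ℕ)
pathEdges r = map (λ i → i , suc i) (upTo (r ∸ 1))

pendantEdges : ℕ → ℕ → ℕ → List (ℕ × ℕ)
pendantEdges at start zero      = []
pendantEdges at start (suc len) =
  (at , start) ∷ map (λ k → start ℕ.+ k , start ℕ.+ suc k) (upTo len)

-- P^{m1,m2}_{n1,n2;r}: vertices 0..r-1 form the path, vertices
-- r..r+n1-1 the pendant path at m1, vertices r+n1..r+n1+n2-1 the pendant path at m2.
P : (n₁ n₂ r m₁ m₂ : ℕ) → Graph (r ℕ.+ n₁ ℕ.+ n₂)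
P n₁ n₂ r m₁ m₂ = fromEdges (r ℕ.+ n₁ ℕ.+ n₂)
  (pathEdges r ++ pendantEdges m₁ r n₁ ++ pendantEdges m₂ (r ℕ.+ n₁) n₂)

-- H_n = P^{2,n-7}_{2,2;n-4}  (for n ≥ 10 it has (n-4)+2+2 = n vertices)
H : ℕ → Σ ℕ Graph
H n = (n ∸ 4) ℕ.+ 2 ℕ.+ 2 , P 2 2 (n ∸ 4) 2 (n ∸ 7)

DSΣ : Σ ℕ Graph → Set
DSΣ (_ , G) = DS G

-- With K(t) = (1 + t²) I − t A, the determinant Φ(t) = det K(t) is the characteristic polynomial at
-- (1 + t²)/t, cleared of denominators, so cospectral graphs have the same Φ. Modulo t⁵, Φ determines
-- the numbers of vertices and edges and bounds Σ (d − 1)(d − 2) over the degrees d by 4 for a mate of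
-- Hₙ: all degrees are at most 2 except at two hubs. A cycle component would give Φ(1) = 0, which
-- happens for Hₙ only if n = 15. So the hubs leave a disjoint union of paths, and a Schur complement
-- expresses Φ by the lengths of these paths, which enter as exponents of t. Comparing the expressions
-- for the mate and for Hₙ at t = 16 modulo successive powers of t is a finite search, and for
-- n ≠ 10, 13 it leaves only trees with two pendant paths of length 2 at each hub. The number of
-- vertices then determines the mate. For n = 10, 13, 15 a cospectral mate is given explicitly.

module Submission where

open import Defs
open import Data.Nat as ℕ using (ℕ; zero; suc; _≤_; _<_; z≤n; s≤s; _≡ᵇ_; _≤ᵇ_)
import Data.Nat.Properties as ℕP
open import Data.Integer as ℤ using (ℤ; +_; -_; _+_; _*_; _-_; _^_; 0ℤ; 1ℤ)
import Data.Integer.Properties as ℤP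
open import Data.Integer.Tactic.RingSolver using (solve-∀)
open import Data.Fin using (Fin; toℕ; punchIn) renaming (zero to fz; suc to fs)
import Data.Fin.Properties as FinP
open import Data.List using (List; []; _∷_; _++_; map; concat; length; reverse; _∷ʳ_; tabulate; allFin; upTo; filterᵇ; concatMap; replicate)
import Data.List.Properties as ListP
open import Data.List.Membership.Propositional using (_∈_)
open import Data.List.Membership.Propositional.Properties
  using (∈-map⁺; ∈-map⁻; ∈-++⁺ˡ; ∈-++⁺ʳ; ∈-++⁻; ∈-concat⁺′; ∈-concat⁻′; ∈-upTo⁺; ∈-upTo⁻; ∈-allFin; ∈-∃++)
open import Data.List.Relation.Unary.Any using (here; there)
open import Data.List.Relation.Unary.All as All using (All; []; _∷_)
import Data.List.Relation.Unary.All.Properties as AllP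
open import Data.List.Relation.Unary.AllPairs using (AllPairs; []; _∷_)
open import Data.List.Relation.Unary.Unique.Propositional using (Unique)
import Data.List.Relation.Unary.Unique.Propositional.Properties as UniqueP
open import Data.List.Relation.Binary.Permutation.Propositional as Perm using (_↭_)
open import Data.List.Relation.Binary.Permutation.Propositional.Properties as PermP using (∈-resp-↭)
open import Data.Nat.DivMod using (_mod_; _%_; m%n<n; m<n⇒m%n≡m; m*n%n≡0)
import Data.List.Relation.Binary.Permutation.Setoid.Properties as SetoidPermP
open import Data.Bool using (Bool; true; false; if_then_else_; T; _∧_; not)
import Data.Bool.Properties as BoolP
open import Data.Bool.ListAction using (all)
open import Data.Maybe using (Maybe; just; nothing)
open import Function.Bundles using (_⇔_; mk⇔; mk↔ₛ′; Inverse)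
open import Data.Product using (∃; _×_; _,_; proj₁; proj₂)
open import Data.Sum using (_⊎_; inj₁; inj₂)
open import Data.Unit using (⊤; tt)
open import Data.Empty using (⊥; ⊥-elim)
open import Relation.Nullary using (¬_; Dec; yes; no; ¬?; _×-dec_; _→-dec_)
open import Relation.Nullary.Decidable using (True; False; toWitness; toWitnessFalse)
open import Relation.Binary.Definitions using (tri<; tri≈; tri>)
open import Relation.Binary.PropositionalEquality
  using (_≡_; _≢_; refl; sym; trans; cong; cong₂; subst; subst₂; setoid; module ≡-Reasoning)

-- At the eigenvalue variable (1 + t²)/t the determinant of a path with k vertices becomes the
-- geometric sum [k + 1] = 1 + t² + ... + t^(2k). Lengthening a chain therefore changes Φ only by
-- multiples of a power of t that grows with the chain, so short lengths can be decided first and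
-- long ones left open. Everything is evaluated at integers t: denominators are cleared by products
-- of brackets, which are positive for natural t and hence cancellable. The obstacle is that the
-- lengths in a mate are unbounded while the search must be finite. It only has to find the four
-- pendant paths of length 2: the distance between the hubs may stay undetermined, since the order
-- of the graph fixes it afterwards. The exceptional cases fail at different places. For n = 15 a
-- mate may contain a cycle component, so the reduction to two hubs and paths breaks down. For n =
-- 10 and n = 13 the mates do have the form of two hubs and paths, so these targets must be excluded
-- inside the search itself.

∑ : {A : Set} → List A → (A → ℤ) → ℤ
∑ []       f = 0ℤ
∑ (x ∷ xs) f = f x + ∑ xs f

∑-cong : {A : Set} (xs : List A) {f g : A → ℤ} → (∀ {x} → x ∈ xs → f x ≡ g x) → ∑ xs f ≡ ∑ xs g
∑-cong []       h = refl
∑-cong (x ∷ xs) h = cong₂ _+_ (h (here refl)) (∑-cong xs (λ m → h (there m)))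

∑-zero : {A : Set} (xs : List A) {f : A → ℤ} → (∀ {x} → x ∈ xs → f x ≡ 0ℤ) → ∑ xs f ≡ 0ℤ
∑-zero []       h = refl
∑-zero (x ∷ xs) h = cong₂ _+_ (h (here refl)) (∑-zero xs (λ m → h (there m)))

∑-lin : {A : Set} (xs : List A) (a b : ℤ) (f g : A → ℤ) →
        ∑ xs (λ x → a * f x + b * g x) ≡ a * ∑ xs f + b * ∑ xs g
∑-lin []       a b f g = lemma a b
  where
  lemma : ∀ a b → 0ℤ ≡ a * 0ℤ + b * 0ℤ
  lemma = solve-∀
∑-lin (x ∷ xs) a b f g = trans (cong (_+_ (a * f x + b * g x)) (∑-lin xs a b f g)) (lemma a b _ _ _ _)
  where
  lemma : ∀ a b u v s t → a * u + b * v + (a * s + b * t) ≡ a * (u + s) + b * (v + t)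
  lemma = solve-∀

-- Laplace expansion along the first row, with the columns kept as a list, so that signs and
-- column deletions need no index arithmetic.

alt : {C : Set} → (C → List C → ℤ) → List C → ℤ
alt f []       = 0ℤ
alt f (c ∷ cs) = f c cs - alt (λ x xs → f x (c ∷ xs)) cs

Det : {C : Set} → List (C → ℤ) → List C → ℤ
Det []       []      = 1ℤ
Det []       (_ ∷ _) = 0ℤ
Det (r ∷ rs) cs      = alt (λ c rest → r c * Det rs rest) cs

-- Determinants as alternating multilinear functions; fraction-free elimination.

module _ {C : Set} where

  alt-cong : {f g : C → List C → ℤ} (cs : List C) → (∀ {c} → c ∈ cs → ∀ xs → f c xs ≡ g c xs) → alt f cs ≡ alt g cs
  alt-cong []       h = refl
  alt-cong (c ∷ cs) h = cong₂ _-_ (h (here refl) cs) (alt-cong cs (λ m xs → h (there m) (c ∷ xs)))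

  alt-lin : ∀ (a b : ℤ) (f g : C → List C → ℤ) cs →
            alt (λ c xs → a * f c xs + b * g c xs) cs ≡ a * alt f cs + b * alt g cs
  alt-lin a b f g []       = lemma a b
    where
    lemma : ∀ a b → 0ℤ ≡ a * 0ℤ + b * 0ℤ
    lemma = solve-∀
  alt-lin a b f g (c ∷ cs) =
    trans (cong (_-_ (a * f c cs + b * g c cs)) (alt-lin a b f′ g′ cs))
          (lemma a b (f c cs) (g c cs) (alt f′ cs) (alt g′ cs))
    where
    f′ = λ x xs → f x (c ∷ xs)
    g′ = λ x xs → g x (c ∷ xs)
    lemma : ∀ a b u v s t → a * u + b * v - (a * s + b * t) ≡ a * (u - s) + b * (v - t)
    lemma = solve-∀

  alt-zero : ∀ {f : C → List C → ℤ} cs → (∀ {c} → c ∈ cs → ∀ xs → f c xs ≡ 0ℤ) → alt f cs ≡ 0ℤ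
  alt-zero []       h = refl
  alt-zero (c ∷ cs) h = cong₂ _-_ (h (here refl) cs) (alt-zero cs (λ m xs → h (there m) (c ∷ xs)))

  alt-neg : ∀ (f : C → List C → ℤ) cs → alt (λ c xs → - f c xs) cs ≡ - alt f cs
  alt-neg f []       = refl
  alt-neg f (c ∷ cs) = trans (cong (_-_ (- f c cs)) (alt-neg f′ cs)) (lemma (f c cs) (alt f′ cs))
    where
    f′ = λ x xs → f x (c ∷ xs)
    lemma : ∀ u v → - u - - v ≡ - (u - v)
    lemma = solve-∀

  -- If `x` or `y` is the column expanded along, the two terms trade places with opposite signs; if
  -- another column is, the hypothesis on `f` supplies the sign.
  alt-swap : (f : C → List C → ℤ) →
             (∀ z ps x y qs → f z (ps ++ x ∷ y ∷ qs) ≡ - f z (ps ++ y ∷ x ∷ qs)) →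
             ∀ ps x y qs → alt f (ps ++ x ∷ y ∷ qs) ≡ - alt f (ps ++ y ∷ x ∷ qs)
  alt-swap f h []       x y qs = trans
    (cong (λ e → f x (y ∷ qs) - (f y (x ∷ qs) - e))
       (trans (alt-cong qs (λ {z} _ zs → h z [] x y zs)) (alt-neg (λ z zs → f z (y ∷ x ∷ zs)) qs)))
    (lemma (f x (y ∷ qs)) (f y (x ∷ qs)) (alt (λ z zs → f z (y ∷ x ∷ zs)) qs))
    where
    lemma : ∀ u v w → u - (v - - w) ≡ - (v - (u - w))
    lemma = solve-∀
  alt-swap f h (p ∷ ps) x y qs = trans
    (cong₂ _-_ (h p ps x y qs) (alt-swap (λ z zs → f z (p ∷ zs)) (λ z ps' → h z (p ∷ ps')) ps x y qs))
    (lemma (f p (ps ++ y ∷ x ∷ qs)) (alt (λ z zs → f z (p ∷ zs)) (ps ++ y ∷ x ∷ qs)))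
    where
    lemma : ∀ u v → - u - - v ≡ - (u - v)
    lemma = solve-∀

  Det-swapCols : ∀ (rs : List (C → ℤ)) ps x y qs → Det rs (ps ++ x ∷ y ∷ qs) ≡ - Det rs (ps ++ y ∷ x ∷ qs)
  Det-swapCols []       []       x y qs = refl
  Det-swapCols []       (p ∷ ps) x y qs = refl
  Det-swapCols (r ∷ rs) ps x y qs = alt-swap (λ c rest → r c * Det rs rest)
    (λ z ps' x' y' qs' → trans (cong (_*_ (r z)) (Det-swapCols rs ps' x' y' qs'))
                               (sym (ℤP.neg-distribʳ-* (r z) _)))
    ps x y qs

  -- Expansion along two rows `r` and `s` at once; `F` stands for the determinant of the remaining
  -- rows as a function of the remaining columns.
  alt₂ : (C → ℤ) → (C → ℤ) → (List C → ℤ) → List C → ℤ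
  alt₂ r s F = alt (λ c xs → r c * alt (λ d ys → s d * F ys) xs)

  -- The first column goes to `r`, to `s`, or to neither. In the last case the sign is unchanged
  -- because `x` is passed over twice. Exchanging `r` and `s` swaps the first two terms, which gives
  -- antisymmetry.
  alt₂-∷ : ∀ r s F x cs → alt₂ r s F (x ∷ cs) ≡
           r x * alt (λ d ys → s d * F ys) cs - s x * alt (λ c ys → r c * F ys) cs
             + alt₂ r s (λ ys → F (x ∷ ys)) cs
  alt₂-∷ r s F x cs = trans (cong (_-_ (r x * alt (λ d ys → s d * F ys) cs)) step)
    (lemma (r x * alt (λ d ys → s d * F ys) cs) (s x * alt (λ c ys → r c * F ys) cs) (alt₂ r s (λ ys → F (x ∷ ys)) cs))
    where
    lemma : ∀ u v w → u - (v + - 1ℤ * w) ≡ u - v + w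
    lemma = solve-∀
    lemma′ : ∀ a b c d → a * (b * c - d) ≡ b * (a * c) + - 1ℤ * (a * d)
    lemma′ = solve-∀
    step : alt (λ c xs → r c * alt (λ d ys → s d * F ys) (x ∷ xs)) cs ≡
           s x * alt (λ c ys → r c * F ys) cs + - 1ℤ * alt₂ r s (λ ys → F (x ∷ ys)) cs
    step = trans
      (alt-cong cs (λ {c} _ xs → lemma′ (r c) (s x) (F xs) (alt (λ d ys → s d * F (x ∷ ys)) xs)))
      (alt-lin (s x) (- 1ℤ) (λ c xs → r c * F xs) (λ c xs → r c * alt (λ d ys → s d * F (x ∷ ys)) xs) cs)

  alt₂-antisym : ∀ r s F cs → alt₂ r s F cs ≡ - alt₂ s r F cs
  alt₂-antisym r s F []       = refl
  alt₂-antisym r s F (x ∷ cs) = begin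
    alt₂ r s F (x ∷ cs)                       ≡⟨ alt₂-∷ r s F x cs ⟩
    u - v + alt₂ r s F′ cs                    ≡⟨ cong (_+_ (u - v)) (alt₂-antisym r s F′ cs) ⟩
    u - v + - alt₂ s r F′ cs                  ≡⟨ lemma u v (alt₂ s r F′ cs) ⟩
    - (v - u + alt₂ s r F′ cs)                ≡⟨ cong -_ (sym (alt₂-∷ s r F x cs)) ⟩
    - alt₂ s r F (x ∷ cs)                     ∎
    where
    open ≡-Reasoning
    F′ = λ ys → F (x ∷ ys)
    u = r x * alt (λ d ys → s d * F ys) cs
    v = s x * alt (λ d ys → r d * F ys) cs
    lemma : ∀ u v w → u - v + - w ≡ - (v - u + w)
    lemma = solve-∀

  Det-swapRows : ∀ ps r s (rs : List (C → ℤ)) cs → Det (ps ++ r ∷ s ∷ rs) cs ≡ - Det (ps ++ s ∷ r ∷ rs) cs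
  Det-swapRows []       r s rs cs = alt₂-antisym r s (Det rs) cs
  Det-swapRows (p ∷ ps) r s rs cs = trans
    (alt-cong cs (λ {c} _ xs → trans (cong (_*_ (p c)) (Det-swapRows ps r s rs xs))
                                     (sym (ℤP.neg-distribʳ-* (p c) _))))
    (alt-neg (λ c xs → p c * Det (ps ++ s ∷ r ∷ rs) xs) cs)

  x≡-x⇒x≡0 : ∀ {x : ℤ} → x ≡ - x → x ≡ 0ℤ
  x≡-x⇒x≡0 {+ zero} _ = refl

  -- An adjacent copy gives x = -x by a row swap. A copy further down stays below `r` when `r`
  -- trades places with the next row, and then every minor of the expansion contains the repetition.
  Det-dup : ∀ r {rs : List (C → ℤ)} → r ∈ rs → ∀ cs → Det (r ∷ rs) cs ≡ 0ℤ
  Det-dup r {.r ∷ rs} (here refl) cs = x≡-x⇒x≡0 (Det-swapRows [] r r rs cs)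
  Det-dup r {s ∷ rs}  (there r∈)  cs = trans (Det-swapRows [] r s rs cs)
    (cong -_ (alt-zero cs (λ {c} _ xs → trans (cong (_*_ (s c)) (Det-dup r r∈ xs)) (ℤP.*-zeroʳ (s c)))))

  Det-head-lin : ∀ a b (r s : C → ℤ) rs cs →
                 Det ((λ c → a * r c + b * s c) ∷ rs) cs ≡ a * Det (r ∷ rs) cs + b * Det (s ∷ rs) cs
  Det-head-lin a b r s rs cs = trans
    (alt-cong cs (λ {c} _ xs → lemma a b (r c) (s c) (Det rs xs)))
    (alt-lin a b (λ c xs → r c * Det rs xs) (λ c xs → s c * Det rs xs) cs)
    where
    lemma : ∀ a b u v w → (a * u + b * v) * w ≡ a * (u * w) + b * (v * w)
    lemma = solve-∀

  Det-head-cong : ∀ {r s : C → ℤ} rs cs → (∀ {c} → c ∈ cs → r c ≡ s c) → Det (r ∷ rs) cs ≡ Det (s ∷ rs) cs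
  Det-head-cong rs cs h = alt-cong cs (λ m xs → cong (_* Det rs xs) (h m))

  Det-head-∷ : ∀ {r : C → ℤ} rs x cs → (∀ {c} → c ∈ cs → r c ≡ 0ℤ) → Det (r ∷ rs) (x ∷ cs) ≡ r x * Det rs cs
  Det-head-∷ {r} rs x cs h = trans
    (cong (_-_ (r x * Det rs cs)) (alt-zero cs (λ m xs → cong (_* Det rs (x ∷ xs)) (h m))))
    (ℤP.+-identityʳ (r x * Det rs cs))

  module _ {V W : Set} (M : V → C → ℤ) (y : W → ℤ) (s : W → V) where

    row+ : ℤ → (C → ℤ) → List W → C → ℤ
    row+ N r ws c = N * r c + ∑ ws (λ w → y w * M (s w) c)

    -- Each added multiple repeats a row already present in `map M vs`, so `Det-dup` removes it and
    -- only the scaling by `N` remains.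
    Det-row+ : ∀ N r ws vs → (∀ {w} → w ∈ ws → s w ∈ vs) → ∀ cs →
               Det (row+ N r ws ∷ map M vs) cs ≡ N * Det (r ∷ map M vs) cs
    Det-row+ N r []       vs ws⊆vs cs = trans
      (Det-head-cong (map M vs) cs (λ {c} _ → lemma N (r c)))
      (trans (Det-head-lin N 0ℤ r r (map M vs) cs) (lemma′ N (Det (r ∷ map M vs) cs)))
      where
      lemma : ∀ N u → N * u + 0ℤ ≡ N * u + 0ℤ * u
      lemma = solve-∀
      lemma′ : ∀ N u → N * u + 0ℤ * u ≡ N * u
      lemma′ = solve-∀
    Det-row+ N r (w ∷ ws) vs ws⊆vs cs = begin
      Det (row+ N r (w ∷ ws) ∷ map M vs) cs
        ≡⟨ Det-head-cong (map M vs) cs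
             (λ {c} _ → lemma N (r c) (y w) (M (s w) c) (∑ ws (λ v → y v * M (s v) c))) ⟩
      Det ((λ c → 1ℤ * row+ N r ws c + y w * M (s w) c) ∷ map M vs) cs
        ≡⟨ Det-head-lin 1ℤ (y w) (row+ N r ws) (M (s w)) (map M vs) cs ⟩
      1ℤ * Det (row+ N r ws ∷ map M vs) cs + y w * Det (M (s w) ∷ map M vs) cs
        ≡⟨ cong₂ (λ a b → 1ℤ * a + y w * b) (Det-row+ N r ws vs (λ m → ws⊆vs (there m)) cs)
             (Det-dup (M (s w)) (∈-map⁺ M (ws⊆vs (here refl))) cs) ⟩
      1ℤ * (N * Det (r ∷ map M vs) cs) + y w * 0ℤ
        ≡⟨ lemma′ N (Det (r ∷ map M vs) cs) (y w) ⟩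
      N * Det (r ∷ map M vs) cs ∎
      where
      open ≡-Reasoning
      lemma : ∀ N u y m s → N * u + (y * m + s) ≡ 1ℤ * (N * u + s) + y * m
      lemma = solve-∀
      lemma′ : ∀ N u y → 1ℤ * (N * u) + y * 0ℤ ≡ N * u
      lemma′ = solve-∀

    -- Gaussian elimination without division: the first row is scaled by `N` before multiples of the
    -- other rows clear it outside column `x`.
    Det-eliminate : ∀ N r ws vs → (∀ {w} → w ∈ ws → s w ∈ vs) → ∀ x cs →
                    (∀ {c} → c ∈ cs → row+ N r ws c ≡ 0ℤ) →
                    N * Det (r ∷ map M vs) (x ∷ cs) ≡ row+ N r ws x * Det (map M vs) cs
    Det-eliminate N r ws vs ws⊆vs x cs h =
      trans (sym (Det-row+ N r ws vs ws⊆vs (x ∷ cs))) (Det-head-∷ (map M vs) x cs h)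

    -- The variant with two columns left uncleared serves the row of the first hub, whose entries in
    -- both hub columns survive.
    Det-eliminate₂ : ∀ N r ws vs → (∀ {w} → w ∈ ws → s w ∈ vs) → ∀ x x′ cs →
                     (∀ {c} → c ∈ cs → row+ N r ws c ≡ 0ℤ) →
                     N * Det (r ∷ map M vs) (x ∷ x′ ∷ cs) ≡
                     row+ N r ws x * Det (map M vs) (x′ ∷ cs) - row+ N r ws x′ * Det (map M vs) (x ∷ cs)
    Det-eliminate₂ N r ws vs ws⊆vs x x′ cs h =
      trans (sym (Det-row+ N r ws vs ws⊆vs (x ∷ x′ ∷ cs)))
        (cong (_-_ (row+ N r ws x * Det (map M vs) (x′ ∷ cs)))
          (trans (cong (_-_ (row+ N r ws x′ * Det (map M vs) (x ∷ cs)))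
            (alt-zero cs (λ {c} m xs → cong (_* Det (map M vs) (x ∷ x′ ∷ xs)) (h m))))
            (ℤP.+-identityʳ (row+ N r ws x′ * Det (map M vs) (x ∷ cs)))))

-- Principal minors and their independence of the order of the index list.

PrincipalMinor : {V : Set} → (V → V → ℤ) → List V → ℤ
PrincipalMinor M vs = Det (map M vs) vs

module _ {V : Set} (M : V → V → ℤ) where

  private
    -- One sign comes from the rows and one from the columns.
    swapBoth : ∀ ps x y vs → PrincipalMinor M (ps ++ x ∷ y ∷ vs) ≡ PrincipalMinor M (ps ++ y ∷ x ∷ vs)
    swapBoth ps x y vs = begin
      Det (map M (ps ++ x ∷ y ∷ vs)) (ps ++ x ∷ y ∷ vs)
        ≡⟨ cong (λ rs → Det rs (ps ++ x ∷ y ∷ vs)) (ListP.map-++ M ps (x ∷ y ∷ vs)) ⟩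
      Det (map M ps ++ M x ∷ M y ∷ map M vs) (ps ++ x ∷ y ∷ vs)
        ≡⟨ Det-swapRows (map M ps) (M x) (M y) (map M vs) _ ⟩
      - Det (map M ps ++ M y ∷ M x ∷ map M vs) (ps ++ x ∷ y ∷ vs)
        ≡⟨ cong -_ (Det-swapCols (map M ps ++ M y ∷ M x ∷ map M vs) ps x y vs) ⟩
      - - Det (map M ps ++ M y ∷ M x ∷ map M vs) (ps ++ y ∷ x ∷ vs)
        ≡⟨ ℤP.neg-involutive _ ⟩
      Det (map M ps ++ M y ∷ M x ∷ map M vs) (ps ++ y ∷ x ∷ vs)
        ≡⟨ cong (λ rs → Det rs (ps ++ y ∷ x ∷ vs)) (sym (ListP.map-++ M ps (y ∷ x ∷ vs))) ⟩
      Det (map M (ps ++ y ∷ x ∷ vs)) (ps ++ y ∷ x ∷ vs) ∎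
      where open ≡-Reasoning

    -- The prefix is needed for the recursion under `prep`, where the common head moves to the end
    -- of `ps`.
    minor-↭-prefix : ∀ {vs ws} → vs ↭ ws → ∀ ps → PrincipalMinor M (ps ++ vs) ≡ PrincipalMinor M (ps ++ ws)
    minor-↭-prefix Perm.refl                    ps = refl
    minor-↭-prefix (Perm.prep {vs} {ws} x p)    ps = begin
      PrincipalMinor M (ps ++ x ∷ vs)        ≡⟨ cong (PrincipalMinor M) (sym (ListP.++-assoc ps (x ∷ []) vs)) ⟩
      PrincipalMinor M ((ps ++ x ∷ []) ++ vs) ≡⟨ minor-↭-prefix p (ps ++ x ∷ []) ⟩
      PrincipalMinor M ((ps ++ x ∷ []) ++ ws) ≡⟨ cong (PrincipalMinor M) (ListP.++-assoc ps (x ∷ []) ws) ⟩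
      PrincipalMinor M (ps ++ x ∷ ws)        ∎
      where open ≡-Reasoning
    minor-↭-prefix (Perm.swap {vs} {ws} x y p)  ps = trans (swapBoth ps x y vs) (begin
      PrincipalMinor M (ps ++ y ∷ x ∷ vs)          ≡⟨ cong (PrincipalMinor M) (sym (ListP.++-assoc ps (y ∷ x ∷ []) vs)) ⟩
      PrincipalMinor M ((ps ++ y ∷ x ∷ []) ++ vs) ≡⟨ minor-↭-prefix p (ps ++ y ∷ x ∷ []) ⟩
      PrincipalMinor M ((ps ++ y ∷ x ∷ []) ++ ws) ≡⟨ cong (PrincipalMinor M) (ListP.++-assoc ps (y ∷ x ∷ []) ws) ⟩
      PrincipalMinor M (ps ++ y ∷ x ∷ ws)          ∎)
      where open ≡-Reasoning
    minor-↭-prefix (Perm.trans p q)             ps = trans (minor-↭-prefix p ps) (minor-↭-prefix q ps)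

  minor-↭ : ∀ {vs ws} → vs ↭ ws → PrincipalMinor M vs ≡ PrincipalMinor M ws
  minor-↭ p = minor-↭-prefix p []

  -- A linear relation with coefficient 1 at row `v`: adding the other rows involved turns row `v`
  -- into zero.
  minor-singular : ∀ {vs v ws us} → vs ↭ v ∷ ws → (∀ {u} → u ∈ us → u ∈ ws) → ∀ y →
                   (∀ {c} → c ∈ vs → 1ℤ * M v c + ∑ us (λ u → y u * M u c) ≡ 0ℤ) → PrincipalMinor M vs ≡ 0ℤ
  minor-singular {vs} {v} {ws} {us} p us⊆ws y h = begin
    PrincipalMinor M vs                       ≡⟨ minor-↭ p ⟩
    Det (M v ∷ map M ws) (v ∷ ws)             ≡⟨ sym (ℤP.*-identityˡ (Det (M v ∷ map M ws) (v ∷ ws))) ⟩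
    1ℤ * Det (M v ∷ map M ws) (v ∷ ws)        ≡⟨ sym (Det-row+ M y (λ w → w) 1ℤ (M v) us ws us⊆ws (v ∷ ws)) ⟩
    Det (row+ M y (λ w → w) 1ℤ (M v) us ∷ map M ws) (v ∷ ws)
      ≡⟨ alt-zero (v ∷ ws) (λ {c} m xs → cong (_* Det (map M ws) xs) (h (∈-resp-↭ (Perm.↭-sym p) m))) ⟩
    0ℤ                                        ∎
    where open ≡-Reasoning

-- Homogenised evaluation, turning `det` of polynomials into an integer determinant.

module Homogenise (y z : ℤ) where

  -- hom N p = Σ_{k ≤ N} (coeff p k) yᵏ zᴺ⁻ᵏ
  hom : ℕ → Poly → ℤ
  hom N       []      = 0ℤ
  hom zero    (a ∷ p) = a
  hom (suc N) (a ∷ p) = a * z ^ suc N + y * hom N p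

  hom-+ : ∀ N p q → hom N (p +ₚ q) ≡ hom N p + hom N q
  hom-+ N       []      q       = sym (ℤP.+-identityˡ (hom N q))
  hom-+ zero    (a ∷ p) []      = sym (ℤP.+-identityʳ a)
  hom-+ (suc N) (a ∷ p) []      = sym (ℤP.+-identityʳ (hom (suc N) (a ∷ p)))
  hom-+ zero    (a ∷ p) (b ∷ q) = refl
  hom-+ (suc N) (a ∷ p) (b ∷ q) = trans
    (cong (λ e → (a + b) * z ^ suc N + y * e) (hom-+ N p q))
    (lemma a b (z ^ suc N) y (hom N p) (hom N q))
    where
    lemma : ∀ a b w y u v → (a + b) * w + y * (u + v) ≡ (a * w + y * u) + (b * w + y * v)
    lemma = solve-∀

  hom-· : ∀ N c p → hom N (c ·ₚ p) ≡ c * hom N p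
  hom-· N       c []      = sym (ℤP.*-zeroʳ c)
  hom-· zero    c (a ∷ p) = refl
  hom-· (suc N) c (a ∷ p) = trans
    (cong (λ e → c * a * z ^ suc N + y * e) (hom-· N c p))
    (lemma c a (z ^ suc N) y (hom N p))
    where
    lemma : ∀ c a w y u → c * a * w + y * (c * u) ≡ c * (a * w + y * u)
    lemma = solve-∀

  hom-≈0 : ∀ N p → (∀ k → coeff p k ≡ 0ℤ) → hom N p ≡ 0ℤ
  hom-≈0 N       []      h = refl
  hom-≈0 zero    (a ∷ p) h = h 0
  hom-≈0 (suc N) (a ∷ p) h = trans
    (cong₂ (λ e f → e * z ^ suc N + y * f) (h 0) (hom-≈0 N p (λ k → h (suc k))))
    (lemma (z ^ suc N) y)
    where
    lemma : ∀ w y → 0ℤ * w + y * 0ℤ ≡ 0ℤ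
    lemma = solve-∀

  hom-≈ : ∀ N p q → p ≈ₚ q → hom N p ≡ hom N q
  hom-≈ N       []      q       h = sym (hom-≈0 N q (λ k → sym (h k)))
  hom-≈ N       (a ∷ p) []      h = hom-≈0 N (a ∷ p) h
  hom-≈ zero    (a ∷ p) (b ∷ q) h = h 0
  hom-≈ (suc N) (a ∷ p) (b ∷ q) h =
    cong₂ (λ e f → e * z ^ suc N + y * f) (h 0) (hom-≈ N p q (λ k → h (suc k)))

  -- Degree at most n, expressed through evaluation: from N = n on, raising N by one only multiplies
  -- the value by `z`. This is the form in which products and expansions consume a degree bound.
  Deg≤ : ℕ → Poly → Set
  Deg≤ n p = ∀ k → n ≤ k → hom (suc k) p ≡ z * hom k p

  data Linear : Poly → Set where
    zeroₚ  : Linear []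
    const  : ∀ a → Linear (a ∷ [])
    linear : ∀ a b → Linear (a ∷ b ∷ [])

  private
    hom-0∷[] : ∀ N → hom N (0ℤ ∷ []) ≡ 0ℤ
    hom-0∷[] zero    = refl
    hom-0∷[] (suc N) = lemma (z ^ suc N) y
      where
      lemma : ∀ w y → 0ℤ * w + y * 0ℤ ≡ 0ℤ
      lemma = solve-∀

  -- Since `hom` drops terms beyond its index, it is multiplicative only when the index is large
  -- enough; the linear factor uses one degree and leaves k ≥ n for `q`.
  hom-Linear-* : ∀ {n e} q → Linear e → Deg≤ n q → ∀ k → n ≤ k →
                 hom (suc k) (e *ₚ q) ≡ hom 1 e * hom k q
  hom-Linear-* q zeroₚ        d k n≤k = refl
  hom-Linear-* q (const a)    d k n≤k = begin
    hom (suc k) ((a ·ₚ q) +ₚ (0ℤ ∷ []))  ≡⟨ hom-+ (suc k) (a ·ₚ q) (0ℤ ∷ []) ⟩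
    hom (suc k) (a ·ₚ q) + hom (suc k) (0ℤ ∷ [])
      ≡⟨ cong₂ _+_ (trans (hom-· (suc k) a q) (cong (a *_) (d k n≤k))) (hom-0∷[] (suc k)) ⟩
    a * (z * hom k q) + 0ℤ               ≡⟨ lemma a z y (hom k q) ⟩
    (a * (z * 1ℤ) + y * 0ℤ) * hom k q    ∎
    where
    open ≡-Reasoning
    lemma : ∀ a z y u → a * (z * u) + 0ℤ ≡ (a * (z * 1ℤ) + y * 0ℤ) * u
    lemma = solve-∀
  hom-Linear-* q (linear a b) d k n≤k = begin
    hom (suc k) ((a ·ₚ q) +ₚ (0ℤ ∷ bq))  ≡⟨ hom-+ (suc k) (a ·ₚ q) (0ℤ ∷ bq) ⟩
    hom (suc k) (a ·ₚ q) + (0ℤ * z ^ suc k + y * hom k bq)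
      ≡⟨ cong₂ (λ u v → u + (0ℤ * z ^ suc k + y * v)) (trans (hom-· (suc k) a q) (cong (a *_) (d k n≤k)))
           (trans (hom-+ k (b ·ₚ q) (0ℤ ∷ [])) (cong₂ _+_ (hom-· k b q) (hom-0∷[] k))) ⟩
    a * (z * hom k q) + (0ℤ * z ^ suc k + y * (b * hom k q + 0ℤ)) ≡⟨ lemma a b z y (z ^ suc k) (hom k q) ⟩
    (a * (z * 1ℤ) + y * b) * hom k q     ∎
    where
    open ≡-Reasoning
    bq = (b ·ₚ q) +ₚ (0ℤ ∷ [])
    lemma : ∀ a b z y w u → a * (z * u) + (0ℤ * w + y * (b * u + 0ℤ)) ≡ (a * (z * 1ℤ) + y * b) * u
    lemma = solve-∀

  Deg≤-Linear-* : ∀ {n e} q → Linear e → Deg≤ n q → Deg≤ (suc n) (e *ₚ q)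
  Deg≤-Linear-* {n} {e} q l d (suc k) (s≤s n≤k) = begin
    hom (suc (suc k)) (e *ₚ q)   ≡⟨ hom-Linear-* q l d (suc k) (ℕP.m≤n⇒m≤1+n n≤k) ⟩
    hom 1 e * hom (suc k) q      ≡⟨ cong (hom 1 e *_) (d k n≤k) ⟩
    hom 1 e * (z * hom k q)      ≡⟨ lemma (hom 1 e) z (hom k q) ⟩
    z * (hom 1 e * hom k q)      ≡⟨ cong (z *_) (sym (hom-Linear-* q l d k n≤k)) ⟩
    z * hom (suc k) (e *ₚ q)     ∎
    where
    open ≡-Reasoning
    lemma : ∀ a b c → a * (b * c) ≡ b * (a * c)
    lemma = solve-∀

  sgn : ℕ → ℤ
  sgn zero    = 1ℤ
  sgn (suc k) = - sgn k

  private
    signed-2 : ∀ k p → signed (suc (suc k)) p ≡ signed k p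
    signed-2 k p with k ℕ.% 2
    ... | zero  = refl
    ... | suc _ = refl

  hom-signed : ∀ N k p → hom N (signed k p) ≡ sgn k * hom N p
  hom-signed N zero          p = sym (ℤP.*-identityˡ (hom N p))
  hom-signed N (suc zero)    p = hom-· N (- (+ 1)) p
  hom-signed N (suc (suc k)) p = trans (cong (hom N) (signed-2 k p))
    (trans (hom-signed N k p) (cong (_* hom N p) (sym (ℤP.neg-involutive (sgn k)))))

  Deg≤-+ : ∀ {n p q} → Deg≤ n p → Deg≤ n q → Deg≤ n (p +ₚ q)
  Deg≤-+ {n} {p} {q} dp dq k n≤k = trans (hom-+ (suc k) p q) (trans (cong₂ _+_ (dp k n≤k) (dq k n≤k))
    (trans (sym (ℤP.*-distribˡ-+ z (hom k p) (hom k q))) (cong (z *_) (sym (hom-+ k p q)))))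

  Deg≤-signed : ∀ {n p} j → Deg≤ n p → Deg≤ n (signed j p)
  Deg≤-signed {n} {p} j d k n≤k = trans (hom-signed (suc k) j p) (trans (cong (sgn j *_) (d k n≤k))
    (trans (lemma (sgn j) z (hom k p)) (cong (z *_) (sym (hom-signed k j p)))))
    where
    lemma : ∀ a b c → a * (b * c) ≡ b * (a * c)
    lemma = solve-∀

  Deg≤-sumFin : ∀ {n} m {f : Fin m → Poly} → (∀ j → Deg≤ n (f j)) → Deg≤ n (sumFin m f)
  Deg≤-sumFin zero    d k n≤k = sym (ℤP.*-zeroʳ z)
  Deg≤-sumFin (suc m) {f} d = Deg≤-+ {p = f fz} {sumFin m (λ j → f (fs j))} (d fz) (Deg≤-sumFin m (λ j → d (fs j)))

  Deg≤-det : ∀ n {M : Fin n → Fin n → Poly} → (∀ i j → Linear (M i j)) → Deg≤ n (det n M)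
  Deg≤-det zero    l k _ = trans (lemma z (z ^ k) y) (cong (z *_) (one k))
    where
    lemma : ∀ z w y → 1ℤ * (z * w) + y * 0ℤ ≡ z * w
    lemma = solve-∀
    lemma′ : ∀ w y → w ≡ 1ℤ * w + y * 0ℤ
    lemma′ = solve-∀
    one : ∀ k → z ^ k ≡ hom k (1ℤ ∷ [])
    one zero    = refl
    one (suc k) = lemma′ (z ^ suc k) y
  Deg≤-det (suc n) {M} l = Deg≤-sumFin {suc n} (suc n) {λ j → signed (toℕ j) (M fz j *ₚ minor j)}
    (λ j → Deg≤-signed {suc n} {M fz j *ₚ minor j} (toℕ j)
      (Deg≤-Linear-* (minor j) (l fz j) (Deg≤-det n (λ i k → l (fs i) (punchIn j k)))))
    where
    minor = λ j → det n (λ i k → M (fs i) (punchIn j k))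

  -- The starting sign `k` and the continuation `τ` are general so that the indexed sum of `det` can
  -- be unrolled column by column against `alt`: passing a column flips the sign and puts that
  -- column back into the list given to `τ`.
  hom-laplace : ∀ {C : Set} N m k (c : Fin (suc m) → C) (g : Fin (suc m) → Poly) (τ : C → List C → ℤ) →
                (∀ j → hom N (g j) ≡ τ (c j) (tabulate (λ i → c (punchIn j i)))) →
                hom N (sumFin (suc m) (λ j → signed (k ℕ.+ toℕ j) (g j))) ≡ sgn k * alt τ (tabulate c)
  hom-laplace N m k c g τ h = trans (hom-+ N (signed (k ℕ.+ 0) (g fz)) (sumFin m rest)) (trans
    (cong₂ _+_ (trans (hom-signed N (k ℕ.+ 0) (g fz)) (cong₂ _*_ (cong sgn (ℕP.+-identityʳ k)) (h fz))) (tail m c g τ h))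
    (lemma (sgn k) (τ (c fz) (tabulate (λ i → c (fs i)))) (alt (λ x xs → τ x (c fz ∷ xs)) (tabulate (λ i → c (fs i))))))
    where
    rest = λ j → signed (k ℕ.+ suc (toℕ j)) (g (fs j))
    lemma : ∀ s a b → s * a + (- s) * b ≡ s * (a - b)
    lemma = solve-∀
    tail : ∀ m (c : Fin (suc m) → _) (g : Fin (suc m) → Poly) τ →
           (∀ j → hom N (g j) ≡ τ (c j) (tabulate (λ i → c (punchIn j i)))) →
           hom N (sumFin m (λ j → signed (k ℕ.+ suc (toℕ j)) (g (fs j)))) ≡
           (- sgn k) * alt (λ x xs → τ x (c fz ∷ xs)) (tabulate (λ i → c (fs i)))
    tail zero    c g τ h = sym (ℤP.*-zeroʳ (- sgn k))
    tail (suc m) c g τ h = trans (cong (hom N) (sum-cong (suc m) (λ j → cong (λ i → signed i (g (fs j))) (ℕP.+-suc k (toℕ j)))))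
      (hom-laplace N m (suc k) (λ i → c (fs i)) (λ j → g (fs j)) (λ x xs → τ x (c fz ∷ xs)) (λ j → h (fs j)))
      where
      sum-cong : ∀ m {f f′ : Fin m → Poly} → (∀ j → f j ≡ f′ j) → sumFin m f ≡ sumFin m f′
      sum-cong zero    e = refl
      sum-cong (suc m) e = cong₂ _+ₚ_ (e fz) (sum-cong m (λ j → e (fs j)))

  hom-det : ∀ {C : Set} n (R : Fin n → C → Poly) (c : Fin n → C) → (∀ i x → Linear (R i x)) →
            hom n (det n (λ i k → R i (c k))) ≡ Det (tabulate (λ i x → hom 1 (R i x))) (tabulate c)
  hom-det zero    R c l = refl
  hom-det (suc n) R c l = trans
    (hom-laplace (suc n) n 0 c (λ j → R fz (c j) *ₚ minor j) τ
      (λ j → trans (hom-Linear-* (minor j) (l fz (c j)) (Deg≤-det n (λ i k → l (fs i) (c (punchIn j k)))) n ℕP.≤-refl)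
        (cong (hom 1 (R fz (c j)) *_) (hom-det n (λ i → R (fs i)) (λ k → c (punchIn j k)) (λ i → l (fs i))))))
    (ℤP.*-identityˡ (alt τ (tabulate c)))
    where
    minor = λ j → det n (λ i k → R (fs i) (c (punchIn j k)))
    τ = λ x xs → hom 1 (R fz x) * Det (tabulate (λ i x → hom 1 (R (fs i) x))) xs

Det-rows-cong : ∀ {C : Set} n {f g : Fin n → C → ℤ} → (∀ i x → f i x ≡ g i x) →
                ∀ cs → Det (tabulate f) cs ≡ Det (tabulate g) cs
Det-rows-cong zero    e []       = refl
Det-rows-cong zero    e (_ ∷ _)  = refl
Det-rows-cong (suc n) e cs       =
  alt-cong cs (λ {c} _ xs → cong₂ _*_ (e fz c) (Det-rows-cong n (λ i → e (fs i)) xs))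

-- The adjacency matrix at (1 + t²)/t; cospectral graphs have equal order and equal Φ.

edge : Bool → ℤ
edge true  = 1ℤ
edge false = 0ℤ

A : ∀ {n} → Graph n → Fin n → Fin n → ℤ
A G i j = edge (adj G i j)

A-sym : ∀ {n} (G : Graph n) i j → A G i j ≡ A G j i
A-sym G i j = cong edge (adj-sym G i j)

A-irrefl : ∀ {n} (G : Graph n) i → A G i i ≡ 0ℤ
A-irrefl G i = cong edge (irrefl G i)

-- The substitution x = (1 + t²)/t, cleared of denominators: K G t = (1 + t²) I − t A.
K : ∀ {n} → Graph n → ℤ → Fin n → Fin n → ℤ
K G t i j = if toℕ i ≡ᵇ toℕ j then 1ℤ + t * t else - (t * A G i j)

Φ : ∀ {n} → Graph n → ℤ → ℤ
Φ {n} G t = PrincipalMinor (K G t) (allFin n)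

K-diag : ∀ {n} (G : Graph n) t i → K G t i i ≡ 1ℤ + t * t
K-diag G t i with toℕ i ≡ᵇ toℕ i | ℕP.≡⇒≡ᵇ (toℕ i) (toℕ i) refl
... | true | _ = refl

K-off : ∀ {n} (G : Graph n) t {i j} → i ≢ j → K G t i j ≡ - (t * A G i j)
K-off G t {i} {j} i≢j with toℕ i ≡ᵇ toℕ j | ℕP.≡ᵇ⇒≡ (toℕ i) (toℕ j)
... | false | _ = refl
... | true  | e = ⊥-elim (i≢j (FinP.toℕ-injective (e tt)))

K-nonadj : ∀ {n} (G : Graph n) t {i j} → i ≢ j → adj G i j ≡ false → K G t i j ≡ 0ℤ
K-nonadj G t {i} {j} i≢j e = trans (K-off G t i≢j) (trans (cong (λ b → - (t * edge b)) e) (cong -_ (ℤP.*-zeroʳ t)))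

K-adj : ∀ {n} (G : Graph n) t {i j} → i ≢ j → adj G i j ≡ true → K G t i j ≡ - t
K-adj G t {i} {j} i≢j e = trans (K-off G t i≢j) (trans (cong (λ b → - (t * edge b)) e) (cong -_ (ℤP.*-identityʳ t)))

module _ {n} (G : Graph n) (t : ℤ) where
  private
    y = 1ℤ + t * t
  open Homogenise y t

  private
    entry : Fin n → Fin n → Poly
    entry i j = if toℕ i ≡ᵇ toℕ j then (+ 0 ∷ + 1 ∷ []) else (if adj G i j then (- (+ 1)) ∷ [] else [])

    entry-linear : ∀ i j → Linear (entry i j)
    entry-linear i j with toℕ i ≡ᵇ toℕ j | adj G i j
    ... | true  | _     = linear (+ 0) (+ 1)
    ... | false | true  = const (- (+ 1))
    ... | false | false = zeroₚ

    hom-entry : ∀ i j → hom 1 (entry i j) ≡ K G t i j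
    hom-entry i j with toℕ i ≡ᵇ toℕ j | adj G i j
    ... | true  | _     = lemma t
      where
      lemma : ∀ t → 0ℤ * (t * 1ℤ) + (1ℤ + t * t) * 1ℤ ≡ 1ℤ + t * t
      lemma = solve-∀
    ... | false | true  = lemma t
      where
      lemma : ∀ t → (- 1ℤ) * (t * 1ℤ) + (1ℤ + t * t) * 0ℤ ≡ - (t * 1ℤ)
      lemma = solve-∀
    ... | false | false = lemma t
      where
      lemma : ∀ t → 0ℤ ≡ - (t * 0ℤ)
      lemma = solve-∀

  hom-charPoly : hom n (charPoly G) ≡ Φ G t
  hom-charPoly = begin
    hom n (charPoly G)                                            ≡⟨ hom-det n entry (λ k → k) entry-linear ⟩
    Det (tabulate (λ i x → hom 1 (entry i x))) (allFin n)         ≡⟨ Det-rows-cong n hom-entry (allFin n) ⟩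
    Det (tabulate (K G t)) (allFin n)
      ≡⟨ cong (λ rs → Det rs (allFin n)) (sym (ListP.map-tabulate (λ i → i) (K G t))) ⟩
    Φ G t                                                         ∎
    where open ≡-Reasoning

  Deg≤-charPoly : Deg≤ n (charPoly G)
  Deg≤-charPoly = Deg≤-det n entry-linear

minor-identity : ∀ {V : Set} {M : V → V → ℤ} → (∀ i → M i i ≡ 1ℤ) → (∀ {i j} → i ≢ j → M i j ≡ 0ℤ) →
                 ∀ vs → Unique vs → PrincipalMinor M vs ≡ 1ℤ
minor-identity         d o []       u        = refl
minor-identity {M = M} d o (v ∷ vs) (v∉ ∷ u) = trans
  (Det-head-∷ (map M vs) v vs (λ m → o (All.lookup v∉ m)))
  (cong₂ _*_ (d v) (minor-identity d o vs u))

-- With y = 1 and z = 0, `hom N` reads off the coefficient of degree N. At the order of the larger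
-- graph this is 1 for that graph, because the matrix becomes the identity, and 0 for the smaller
-- one by its degree bound.
cospectral⇒≮ : ∀ {n m} (G : Graph n) (G′ : Graph m) → Cospectral G G′ → n < m → ⊥
cospectral⇒≮ {n} {suc m} G G′ co (s≤s n≤m) = 1≢0 (trans (sym one) nil)
  where
  1≢0 : 1ℤ ≢ 0ℤ
  1≢0 ()
  open Homogenise 1ℤ 0ℤ
  one : hom (suc m) (charPoly G′) ≡ 1ℤ
  one = trans (hom-charPoly G′ 0ℤ)
    (minor-identity (K-diag G′ 0ℤ) (K-off G′ 0ℤ) (allFin (suc m)) (UniqueP.allFin⁺ (suc m)))
  nil : hom (suc m) (charPoly G′) ≡ 0ℤ
  nil = trans (sym (hom-≈ (suc m) (charPoly G) (charPoly G′) co)) (Deg≤-charPoly G 0ℤ m n≤m)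

cospectral⇒≡ : ∀ {n m} (G : Graph n) (G′ : Graph m) → Cospectral G G′ → n ≡ m
cospectral⇒≡ {n} {m} G G′ co with ℕP.<-cmp n m
... | tri< n<m _ _ = ⊥-elim (cospectral⇒≮ G G′ co n<m)
... | tri≈ _ e _   = e
... | tri> _ _ m<n = ⊥-elim (cospectral⇒≮ G′ G (λ k → sym (co k)) m<n)

cospectral⇒Φ : ∀ {n} (G G′ : Graph n) → Cospectral G G′ → ∀ t → Φ G t ≡ Φ G′ t
cospectral⇒Φ {n} G G′ co t = trans (sym (hom-charPoly G t))
  (trans (hom-≈ n (charPoly G) (charPoly G′) co) (hom-charPoly G′ t))
  where open Homogenise (1ℤ + t * t) t

-- Chains attached to two hubs, and the adjugate column of a chain.

data Hub : Set where
  hubA hubB : Hub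

-- The hub, if any, to which an end of a chain is attached.
End : Set
End = Maybe Hub

ι : End → Hub → ℤ
ι nothing     h    = 0ℤ
ι (just hubA) hubA = 1ℤ
ι (just hubA) hubB = 0ℤ
ι (just hubB) hubA = 0ℤ
ι (just hubB) hubB = 1ℤ

Apart : ∀ {n} → Graph n → Fin n → Fin n → Set
Apart G u v = u ≢ v × adj G u v ≡ false

Apart-sym : ∀ {n} {G : Graph n} {u v} → Apart G u v → Apart G v u
Apart-sym {G = G} {u} {v} (u≢v , e) = (λ v≡u → u≢v (sym v≡u)) , trans (adj-sym G v u) e

adj⇒≢ : ∀ {n} (G : Graph n) {u v} → adj G u v ≡ true → u ≢ v
adj⇒≢ G {u} e refl with trans (sym e) (irrefl G u)
... | ()

-- An induced path whose inner vertices avoid both hubs: a proper tail always has left label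
-- `nothing`, so edges to hubs occur only at the two ends. A single vertex is both ends at once,
-- whence the sum of labels in `one`.
data Chain {n} (G : Graph n) (hub : Hub → Fin n) : End → List (Fin n) → End → Set where
  one  : ∀ {e v f} → (∀ h → A G v (hub h) ≡ ι e h + ι f h) → Chain G hub e (v ∷ []) f
  cons : ∀ {e v w vs f} → (∀ h → A G v (hub h) ≡ ι e h) → adj G v w ≡ true → All (Apart G v) vs →
         Chain G hub nothing (w ∷ vs) f → Chain G hub e (v ∷ w ∷ vs) f

module _ {n} {G : Graph n} {hub : Hub → Fin n} where

  Chain-snoc : ∀ {e f w v} ys → Chain G hub f (ys ∷ʳ w) nothing → adj G w v ≡ true →
               All (λ u → Apart G u v) ys → (∀ h → A G v (hub h) ≡ ι e h) →
               Chain G hub f ((ys ∷ʳ w) ∷ʳ v) e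
  Chain-snoc {e} []           (one p)         wv ap q =
    cons (λ h → trans (p h) (ℤP.+-identityʳ _)) wv [] (one (λ h → trans (q h) (sym (ℤP.+-identityˡ (ι e h)))))
  Chain-snoc (y ∷ [])     (cons p a b ch) wv (ap ∷ aps) q = cons p a (AllP.∷ʳ⁺ b ap) (Chain-snoc [] ch wv aps q)
  Chain-snoc (y ∷ z ∷ ys) (cons p a b ch) wv (ap ∷ aps) q =
    cons p a (AllP.∷ʳ⁺ b ap) (Chain-snoc (z ∷ ys) ch wv aps q)

  Chain-reverse : ∀ {e vs f} → Chain G hub e vs f → Chain G hub f (reverse vs) e
  Chain-reverse {e} {v ∷ []} {f} (one p) = one (λ h → trans (p h) (ℤP.+-comm (ι e h) (ι f h)))
  Chain-reverse {e} {v ∷ w ∷ vs} {f} (cons p a b ch) =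
    subst (λ l → Chain G hub f l e) (sym (trans (ListP.unfold-reverse v (w ∷ vs)) (cong (_∷ʳ v) (ListP.unfold-reverse w vs))))
      (Chain-snoc (reverse vs) (subst (λ l → Chain G hub f l nothing) (ListP.unfold-reverse w vs) (Chain-reverse ch))
        (trans (adj-sym G w v) a)
        (All.tabulate (λ m → Apart-sym {G = G} (All.lookup b (∈-resp-↭ (PermP.↭-reverse vs) m)))) p)

-- The geometric sum 1 + t² + ... + t^(2L - 2), written [L] below. By `minor-chain`, [k + 1] is the
-- determinant of `K` on a path with k vertices.
bracket : ℤ → ℕ → ℤ
bracket t zero    = 0ℤ
bracket t (suc L) = 1ℤ + t * t * bracket t L

scale : {V : Set} → ℤ → List (ℤ × V) → List (ℤ × V)
scale a = map (λ p → a * proj₁ p , proj₂ p)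

combine : {V C : Set} → (V → C → ℤ) → List (ℤ × V) → C → ℤ
combine M ws c = ∑ ws (λ p → proj₁ p * M (proj₂ p) c)

combine-scale : {V C : Set} (M : V → C → ℤ) (a : ℤ) (ws : List (ℤ × V)) (c : C) →
                combine M (scale a ws) c ≡ a * combine M ws c
combine-scale M a []       c = sym (ℤP.*-zeroʳ a)
combine-scale M a (w ∷ ws) c = trans (cong (λ s → a * proj₁ w * M (proj₂ w) c + s) (combine-scale M a ws c))
  (lemma a (proj₁ w) (M (proj₂ w) c) (combine M ws c))
  where
  lemma : ∀ a b m s → a * b * m + a * s ≡ a * (b * m + s)
  lemma = solve-∀

combine-++ : {V C : Set} (M : V → C → ℤ) (ws ws′ : List (ℤ × V)) (c : C) →
             combine M (ws ++ ws′) c ≡ combine M ws c + combine M ws′ c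
combine-++ M []       ws′ c = sym (ℤP.+-identityˡ (combine M ws′ c))
combine-++ M (w ∷ ws) ws′ c = trans (cong (λ s → proj₁ w * M (proj₂ w) c + s) (combine-++ M ws ws′ c))
  (sym (ℤP.+-assoc (proj₁ w * M (proj₂ w) c) (combine M ws c) (combine M ws′ c)))

combine-zero : {V C : Set} (M : V → C → ℤ) (ws : List (ℤ × V)) {c : C} →
               (∀ {w} → w ∈ ws → M (proj₂ w) c ≡ 0ℤ) → combine M ws c ≡ 0ℤ
combine-zero M ws h = ∑-zero ws (λ {w} m → trans (cong (proj₁ w *_) (h m)) (ℤP.*-zeroʳ (proj₁ w)))

∈-scale : {V : Set} (a : ℤ) (ws : List (ℤ × V)) (vs : List V) → (∀ {w} → w ∈ ws → proj₂ w ∈ vs) →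
          ∀ {w} → w ∈ scale a ws → proj₂ w ∈ vs
∈-scale a ws vs h m with ∈-map⁻ _ m
... | _ , m′ , refl = h m′

-- The first column of the adjugate of the chain's own matrix.
green : {V : Set} → ℤ → List V → List (ℤ × V)
green t []       = []
green t (v ∷ vs) = (bracket t (suc (length vs)) , v) ∷ scale t (green t vs)

∈-green : {V : Set} (t : ℤ) (vs : List V) → ∀ {w} → w ∈ green t vs → proj₂ w ∈ vs
∈-green t (v ∷ vs) (here refl) = here refl
∈-green t (v ∷ vs) (there m)   = there (∈-scale t (green t vs) vs (∈-green t vs) m)

-- For natural t every [L] with L > 0 is positive. This is what allows brackets to be cancelled
-- after fraction-free elimination.
bracket-pos : ∀ τ L → ∃ λ m → bracket (+ τ) L ≡ + m × (L ≢ 0 → m ≢ 0)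
bracket-pos τ zero    = 0 , refl , λ z → z
bracket-pos τ (suc L) with bracket-pos τ L
... | m , e , _ = suc (τ ℕ.* τ ℕ.* m) ,
  trans (cong (λ b → 1ℤ + + τ * + τ * b) e)
    (cong (λ s → 1ℤ + s) (trans (cong (_* + m) (sym (ℤP.pos-* τ τ))) (sym (ℤP.pos-* (τ ℕ.* τ) m)))) , λ _ ()

bracket-≢0 : ∀ τ L → bracket (+ τ) (suc L) ≢ 0ℤ
bracket-≢0 τ L e with bracket-pos τ (suc L)
... | m , e′ , pos = pos (λ ()) (ℤP.+-injective (trans (sym e′) e))

*-cancelˡ : ∀ a {b c} → a ≢ 0ℤ → a * b ≡ a * c → b ≡ c
*-cancelˡ a {b} {c} a≢0 = ℤP.*-cancelˡ-≡ a b c {{ℤ.≢-nonZero a≢0}}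

module _ {n} (G : Graph n) (hub : Hub → Fin n) (t : ℤ) where
  private
    M = K G t
    br = bracket t
    S : List (Fin n) → Fin n → ℤ
    S vs = combine M (green t vs)

  Apart⇒K≡0 : ∀ {u v} → Apart G u v → K G t u v ≡ 0ℤ
  Apart⇒K≡0 (u≢v , e) = K-nonadj G t u≢v e

  green-∷ : ∀ v vs c → S (v ∷ vs) c ≡ br (suc (length vs)) * M v c + t * S vs c
  green-∷ v vs c = cong (λ s → br (suc (length vs)) * M v c + s) (combine-scale M t (green t vs) c)

  green-outside : ∀ vs {c} → (∀ {x} → x ∈ vs → Apart G x c) → S vs c ≡ 0ℤ
  green-outside vs h = combine-zero M (green t vs) (λ m → Apart⇒K≡0 (h (∈-green t vs m)))

  -- Together with `green-tail` this is adjugate times matrix: [k + 1] times the first unit vector.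
  -- It rests on the recurrence [k + 1] = (1 + t²) [k] - t² [k - 1].
  green-head : ∀ {e v vs f} → Chain G hub e (v ∷ vs) f → S (v ∷ vs) v ≡ br (suc (suc (length vs)))
  green-head {v = v} (one _) = trans (green-∷ v [] v) (trans
    (cong (λ k → br 1 * k + t * 0ℤ) (K-diag G t v)) (lemma t))
    where
    lemma : ∀ t → (1ℤ + t * t * 0ℤ) * (1ℤ + t * t) + t * 0ℤ ≡ 1ℤ + t * t * (1ℤ + t * t * 0ℤ)
    lemma = solve-∀
  green-head {v = v} (cons {w = w} {vs} _ vw ap _) = begin
    S (v ∷ w ∷ vs) v                                    ≡⟨ green-∷ v (w ∷ vs) v ⟩
    br k * M v v + t * S (w ∷ vs) v                     ≡⟨ cong₂ (λ a b → br k * a + t * b) (K-diag G t v) tail ⟩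
    (1ℤ + t * t * b) * (1ℤ + t * t) + t * (b * - t + t * 0ℤ) ≡⟨ lemma t b ⟩
    1ℤ + t * t * (1ℤ + t * t * b)                       ∎
    where
    open ≡-Reasoning
    k = suc (suc (length vs))
    b = br (suc (length vs))
    tail : S (w ∷ vs) v ≡ b * - t + t * 0ℤ
    tail = trans (green-∷ w vs v) (cong₂ (λ x y → b * x + t * y)
      (K-adj G t (λ w≡v → adj⇒≢ G vw (sym w≡v)) (trans (adj-sym G w v) vw))
      (green-outside vs (λ m → Apart-sym {G = G} (All.lookup ap m))))
    lemma : ∀ t b → (1ℤ + t * t * b) * (1ℤ + t * t) + t * (b * - t + t * 0ℤ) ≡ 1ℤ + t * t * (1ℤ + t * t * b)
    lemma = solve-∀

  green-tail : ∀ {e v vs f} → Chain G hub e (v ∷ vs) f → ∀ {c} → c ∈ vs → S (v ∷ vs) c ≡ 0ℤ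
  green-tail {v = v} (cons {w = w} {vs} _ vw ap ch) {c} (here refl) = trans (green-∷ v (w ∷ vs) w) (trans
    (cong₂ (λ a b → br k * a + t * b) (K-adj G t (adj⇒≢ G vw) vw) (green-head ch))
    (lemma t (br k)))
    where
    k = suc (suc (length vs))
    lemma : ∀ t b → b * - t + t * b ≡ 0ℤ
    lemma = solve-∀
  green-tail {v = v} (cons {w = w} {vs} _ vw ap ch) {c} (there m) = trans (green-∷ v (w ∷ vs) c) (trans
    (cong₂ (λ a b → br k * a + t * b) (Apart⇒K≡0 (All.lookup ap m)) (green-tail ch m))
    (lemma t (br k)))
    where
    k = suc (suc (length vs))
    lemma : ∀ t b → b * 0ℤ + t * 0ℤ ≡ 0ℤ
    lemma = solve-∀

  -- Only the end vertices can touch a hub. Their weights in `green` are [k] at the near end and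
  -- t^(k - 1) at the far end, for a chain of k vertices.
  green-hub : ∀ {e v vs f} → Chain G hub e (v ∷ vs) f → ∀ h → (∀ {x} → x ∈ v ∷ vs → x ≢ hub h) →
              S (v ∷ vs) (hub h) ≡ - (t * (br (suc (length vs)) * ι e h + t ^ length vs * ι f h))
  green-hub {e} {v} {f = f} (one p) h ∉ = trans (green-∷ v [] (hub h)) (trans
    (cong (λ a → br 1 * a + t * 0ℤ) (trans (K-off G t (∉ (here refl))) (cong (λ a → - (t * a)) (p h))))
    (lemma t (ι e h) (ι f h)))
    where
    lemma : ∀ t a b → (1ℤ + t * t * 0ℤ) * - (t * (a + b)) + t * 0ℤ ≡ - (t * ((1ℤ + t * t * 0ℤ) * a + 1ℤ * b))
    lemma = solve-∀
  green-hub {e} {v} {f = f} (cons {w = w} {vs} p vw ap ch) h ∉ = trans (green-∷ v (w ∷ vs) (hub h)) (trans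
    (cong₂ (λ a b → br k * a + t * b) (trans (K-off G t (∉ (here refl))) (cong (λ a → - (t * a)) (p h)))
      (green-hub ch h (λ m → ∉ (there m))))
    (lemma t (br k) (br (suc (length vs))) (t ^ length vs) (ι e h) (ι f h)))
    where
    k = suc (suc (length vs))
    lemma : ∀ t b c d x y → b * - (t * x) + t * - (t * (c * 0ℤ + d * y)) ≡ - (t * (b * x + t * d * y))
    lemma = solve-∀

  private
    L1 : ∀ {vs f} → Chain G hub nothing vs f → ∀ {x} → x ∈ vs →
         (∃ λ ys → vs ≡ ys ∷ʳ x × (∀ h → A G x (hub h) ≡ ι f h)) ⊎ (∀ h → A G x (hub h) ≡ 0ℤ)
    L1 {f = f} (one p) (here refl) = inj₁ ([] , refl , λ h → trans (p h) (ℤP.+-identityˡ (ι f h)))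
    L1 (cons p _ _ _)  (here refl) = inj₂ p
    L1 (cons {v = v} _ _ _ ch) (there m) with L1 ch m
    ... | inj₁ (ys , eq , q) = inj₁ (v ∷ ys , cong (v ∷_) eq , q)
    ... | inj₂ q               = inj₂ q

    S-reverse-head : ∀ {e f ys x} → Chain G hub f (reverse (ys ∷ʳ x)) e →
                     S (reverse (ys ∷ʳ x)) x ≡ br (suc (length (ys ∷ʳ x)))
    S-reverse-head {ys = ys} {x} ch with reverse (ys ∷ʳ x) | ListP.reverse-++ ys (x ∷ []) | ListP.length-reverse (ys ∷ʳ x)
    ... | .(x ∷ reverse ys) | refl | l = trans (green-head ch) (cong (λ k → br (suc k)) l)

    S-nonzero : ∀ {e f v w vs} → Chain G hub e (v ∷ w ∷ vs) f → ∀ {x} → x ∈ v ∷ w ∷ vs →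
                (∀ h → A G x (hub h) ≡ 0ℤ) → ∀ h → ι e h * S (v ∷ w ∷ vs) x ≡ 0ℤ
    S-nonzero {v = v} {w} {vs} (cons p _ _ _) (here refl) z h = cong (_* S (v ∷ w ∷ vs) v) (trans (sym (p h)) (z h))
    S-nonzero {e}     ch             (there m)   z h = trans (cong (ι e h *_) (green-tail ch m)) (ℤP.*-zeroʳ (ι e h))

    S-reverse-zero : ∀ {e f vs} → Chain G hub f vs e → ∀ {k} → length vs ≡ suc (suc k) → ∀ {x} → x ∈ vs →
                     (∀ h → A G x (hub h) ≡ 0ℤ) → ∀ h → ι f h * S vs x ≡ 0ℤ
    S-reverse-zero {vs = v ∷ w ∷ vs} ch _ m z h = S-nonzero ch m z h

    S-reverse-last : ∀ {e f} a as x → Chain G hub f ((a ∷ as) ∷ʳ x) e → S ((a ∷ as) ∷ʳ x) x ≡ 0ℤ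
    S-reverse-last a as x ch = green-tail ch (∈-++⁺ʳ as (here refl))

  -- The adjugate columns of the two ends, weighted by the labels of the ends, solve the chain's
  -- linear system with right-hand side [k + 1] times the column of the hub. Each is nonzero only at
  -- its own end; a vertex beyond the first is either the last one or not attached to any hub
  -- (`L1`).
  green-ends : ∀ {e vs f} → Chain G hub e vs f → ∀ {x} → x ∈ vs → ∀ h →
               ι e h * S vs x + ι f h * S (reverse vs) x ≡ br (suc (length vs)) * A G x (hub h)
  green-ends {e} {f = f} ch@(one {v = v} p) (here refl) h = trans
    (cong (λ a → ι e h * a + ι f h * a) (green-head ch))
    (trans (lemma (ι e h) (ι f h) (br 2)) (cong (br 2 *_) (sym (p h))))
    where
    lemma : ∀ a b c → a * c + b * c ≡ c * (a + b)
    lemma = solve-∀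
  green-ends {e} {f = f} ch@(cons {v = v} {w} {vs} p vw ap ch′) (here refl) h = trans
    (cong₂ (λ a b → ι e h * a + ι f h * b) (green-head ch) last)
    (trans (lemma (ι e h) (ι f h) (br L)) (cong (br L *_) (sym (p h))))
    where
    L = suc (suc (suc (length vs)))
    lemma : ∀ a b c → a * c + b * 0ℤ ≡ c * a
    lemma = solve-∀
    nonempty : ∀ (as : List (Fin n)) {k} → length as ≡ suc k → Chain G hub f (as ∷ʳ v) e → S (as ∷ʳ v) v ≡ 0ℤ
    nonempty (a ∷ as) _ c = S-reverse-last a as v c
    last : S (reverse (v ∷ w ∷ vs)) v ≡ 0ℤ
    last = subst (λ l → Chain G hub f l e → S l v ≡ 0ℤ) (sym (ListP.unfold-reverse v (w ∷ vs)))
      (nonempty (reverse (w ∷ vs)) (ListP.length-reverse (w ∷ vs))) (Chain-reverse ch)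
  green-ends {e} {f = f} ch@(cons {v = v} {w} {vs} p vw ap ch′) {x} (there m) h = trans
    (cong (λ a → ι e h * a + ι f h * S (reverse (v ∷ w ∷ vs)) x) (green-tail ch m)) rest
    where
    L = suc (suc (suc (length vs)))
    rest : ι e h * 0ℤ + ι f h * S (reverse (v ∷ w ∷ vs)) x ≡ br L * A G x (hub h)
    rest with L1 ch′ m
    ... | inj₂ z = trans
      (cong₂ (λ a b → a + b) (ℤP.*-zeroʳ (ι e h))
        (S-reverse-zero (Chain-reverse ch) (ListP.length-reverse (v ∷ w ∷ vs))
          (∈-resp-↭ (Perm.↭-sym (PermP.↭-reverse (v ∷ w ∷ vs))) (there m)) z h))
      (trans (sym (ℤP.*-zeroʳ (br L))) (cong (br L *_) (sym (z h))))
    ... | inj₁ (ys , eq , q) = begin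
      ι e h * 0ℤ + ι f h * S (reverse (v ∷ w ∷ vs)) x
        ≡⟨ cong (λ l → ι e h * 0ℤ + ι f h * S (reverse l) x) (cong (v ∷_) eq) ⟩
      ι e h * 0ℤ + ι f h * S (reverse ((v ∷ ys) ∷ʳ x)) x
        ≡⟨ cong (λ a → ι e h * 0ℤ + ι f h * a) (S-reverse-head {ys = v ∷ ys}
             (subst (λ l → Chain G hub f (reverse (v ∷ l)) e) eq (Chain-reverse ch))) ⟩
      ι e h * 0ℤ + ι f h * br (suc (length ((v ∷ ys) ∷ʳ x)))
        ≡⟨ cong (λ l → ι e h * 0ℤ + ι f h * br (suc (suc (length l)))) (sym eq) ⟩
      ι e h * 0ℤ + ι f h * br L                       ≡⟨ lemma (ι e h) (ι f h) (br L) ⟩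
      br L * ι f h                                    ≡⟨ cong (br L *_) (sym (q h)) ⟩
      br L * A G x (hub h)                            ∎
      where
      open ≡-Reasoning
      lemma : ∀ a b c → a * 0ℤ + b * c ≡ c * b
      lemma = solve-∀

-- Two hubs and separate chains: Φ by a Schur complement on the hubs.

record Link {n} (G : Graph n) (hub : Hub → Fin n) : Set where
  field
    {left right} : End
    vertices     : List (Fin n)
    chain        : Chain G hub left vertices right

open Link

Shape : Set
Shape = End × ℕ × End

shape : ∀ {n} {G : Graph n} {hub} → Link G hub → Shape
shape c = left c , length (vertices c) , right c

Separate : ∀ {n} {G : Graph n} {hub} → Link G hub → Link G hub → Set
Separate {G = G} c c′ = ∀ {u v} → u ∈ vertices c → v ∈ vertices c′ → Apart G u v

linkVertices : ∀ {n} {G : Graph n} {hub} → List (Link G hub) → List (Fin n)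
linkVertices cs = concat (map vertices cs)

record Decomposition {n} (G : Graph n) : Set where
  field
    hub      : Hub → Fin n
    links    : List (Link G hub)
    hubA≢hubB : hub hubA ≢ hub hubB
    separate : AllPairs Separate links
    off-hub  : ∀ h {v} → v ∈ linkVertices links → v ≢ hub h
    cover    : hub hubA ∷ hub hubB ∷ linkVertices links ↭ allFin n

separate-∈ : ∀ {n} {G : Graph n} {hub} (c : Link G hub) {cs} → All (Separate c) cs →
             ∀ {u v} → u ∈ vertices c → v ∈ linkVertices cs → Apart G u v
separate-∈ c {c′ ∷ cs} (s ∷ ss) u∈ v∈ with ∈-++⁻ (vertices c′) v∈
... | inj₁ m = s u∈ m
... | inj₂ m = separate-∈ c ss u∈ m

-- The product of the chain determinants, that is, the determinant with both hubs removed
-- (`minor-links`). It is the common denominator of the Schur complement.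
weight : ℤ → List Shape → ℤ
weight t []                 = 1ℤ
weight t ((_ , k , _) ∷ ss) = bracket t (suc k) * weight t ss

-- Schur complement of a chain of k vertices, times its determinant [k + 1].
linkTerm : ℤ → Shape → Hub → Hub → ℤ
linkTerm t (e , k , f) h h′ =
  t * t * bracket t k * (ι e h * ι e h′ + ι f h * ι f h′) + t ^ suc k * (ι e h * ι f h′ + ι f h * ι e h′)

-- The sum of the fractions `linkTerm` / [k + 1] over all links, brought to the common denominator
-- `weight`.
hubSum : ℤ → List Shape → Hub → Hub → ℤ
hubSum t []                   h h′ = 0ℤ
hubSum t ((e , k , f) ∷ ss) h h′ =
  bracket t (suc k) * hubSum t ss h h′ + weight t ss * linkTerm t (e , k , f) h h′

module _ {n} (G : Graph n) (hub : Hub → Fin n) (t : ℤ) where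
  private
    M = K G t
    br = bracket t

  -- The multiples of chain rows to be added to `weight` times the row of hub `h` in order to clear
  -- its entries in all chain columns.
  eliminator : Hub → List (Link G hub) → List (ℤ × Fin n)
  eliminator h []       = []
  eliminator h (c ∷ cs) =
    scale (br (suc (length (vertices c)))) (eliminator h cs) ++
    (scale (weight t (map shape cs) * t * ι (left c) h) (green t (vertices c)) ++
     scale (weight t (map shape cs) * t * ι (right c) h) (green t (reverse (vertices c))))

  private
    value : Hub → List (Link G hub) → Fin n → ℤ
    value h cs = combine M (eliminator h cs)
    S : List (Fin n) → Fin n → ℤ
    S vs = combine M (green t vs)

    value-∷ : ∀ h c cs x → value h (c ∷ cs) x ≡
              br (suc (length (vertices c))) * value h cs x +
              weight t (map shape cs) * t * (ι (left c) h * S (vertices c) x + ι (right c) h * S (reverse (vertices c)) x)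
    value-∷ h c cs x = begin
      value h (c ∷ cs) x
        ≡⟨ combine-++ M (scale b (eliminator h cs)) (scale (w * t * e) (green t vs) ++ scale (w * t * f) (green t (reverse vs))) x ⟩
      combine M (scale b (eliminator h cs)) x +
      combine M (scale (w * t * e) (green t vs) ++ scale (w * t * f) (green t (reverse vs))) x
        ≡⟨ cong₂ _+_ (combine-scale M b (eliminator h cs) x)
             (trans (combine-++ M (scale (w * t * e) (green t vs)) (scale (w * t * f) (green t (reverse vs))) x)
               (cong₂ _+_ (combine-scale M (w * t * e) (green t vs) x)
                          (combine-scale M (w * t * f) (green t (reverse vs)) x))) ⟩
      b * value h cs x + (w * t * e * S vs x + w * t * f * S (reverse vs) x)
        ≡⟨ cong (λ s → b * value h cs x + s) (lemma (w * t) e f (S vs x) (S (reverse vs) x)) ⟩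
      b * value h cs x + w * t * (e * S vs x + f * S (reverse vs) x) ∎
      where
      open ≡-Reasoning
      vs = vertices c
      b = br (suc (length vs))
      w = weight t (map shape cs)
      e = ι (left c) h
      f = ι (right c) h
      lemma : ∀ w e f x y → w * e * x + w * f * y ≡ w * (e * x + f * y)
      lemma = solve-∀

    S-reverse-outside : ∀ vs {x} → (∀ {v} → v ∈ vs → Apart G v x) → S (reverse vs) x ≡ 0ℤ
    S-reverse-outside vs h = green-outside G hub t (reverse vs) (λ m → h (∈-resp-↭ (PermP.↭-reverse vs) m))

  value-outside : ∀ h cs {x} → (∀ {v} → v ∈ linkVertices cs → Apart G v x) → value h cs x ≡ 0ℤ
  value-outside h []           ap = refl
  value-outside h (c ∷ cs) {x} ap = trans (value-∷ h c cs x) (trans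
    (cong₂ (λ a b → br (suc (length vs)) * a + weight t (map shape cs) * t * b)
      (value-outside h cs (λ m → ap (∈-++⁺ʳ vs m)))
      (cong₂ (λ a b → ι (left c) h * a + ι (right c) h * b)
        (green-outside G hub t vs (λ m → ap (∈-++⁺ˡ m)))
        (S-reverse-outside vs (λ m → ap (∈-++⁺ˡ m)))))
    (lemma (br (suc (length vs))) (weight t (map shape cs) * t) (ι (left c) h) (ι (right c) h)))
    where
    vs = vertices c
    lemma : ∀ a b c d → a * 0ℤ + b * (c * 0ℤ + d * 0ℤ) ≡ 0ℤ
    lemma = solve-∀

  -- A chain column is cleared by its own link through `green-ends`; the other links vanish there
  -- because they are separate from it.
  value-link : ∀ h cs → AllPairs Separate cs → (∀ {v} → v ∈ linkVertices cs → v ≢ hub h) →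
               ∀ {x} → x ∈ linkVertices cs → weight t (map shape cs) * M (hub h) x + value h cs x ≡ 0ℤ
  value-link h (c ∷ cs) (s ∷ ss) off {x} m with ∈-++⁻ (vertices c) m
  ... | inj₁ x∈ = begin
    b * w * M (hub h) x + value h (c ∷ cs) x ≡⟨ cong₂ (λ p r → b * w * p + r)
      (trans (K-off G t (λ e → off m (sym e))) (cong (λ a → - (t * a)) (A-sym G (hub h) x))) (value-∷ h c cs x) ⟩
    b * w * - (t * A G x (hub h)) + (b * value h cs x + w * t * (ι (left c) h * S vs x + ι (right c) h * S (reverse vs) x))
      ≡⟨ cong₂ (λ p r → b * w * - (t * A G x (hub h)) + (b * p + w * t * r))
           (value-outside h cs (λ v∈ → Apart-sym {G = G} (separate-∈ c s x∈ v∈))) (green-ends G hub t (chain c) x∈ h) ⟩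
    b * w * - (t * A G x (hub h)) + (b * 0ℤ + w * t * (b * A G x (hub h))) ≡⟨ lemma b w t (A G x (hub h)) ⟩
    0ℤ ∎
    where
    open ≡-Reasoning
    vs = vertices c
    b = br (suc (length vs))
    w = weight t (map shape cs)
    lemma : ∀ b w t a → b * w * - (t * a) + (b * 0ℤ + w * t * (b * a)) ≡ 0ℤ
    lemma = solve-∀
  ... | inj₂ x∈ = begin
    b * w * M (hub h) x + value h (c ∷ cs) x
      ≡⟨ cong (λ r → b * w * M (hub h) x + r) (value-∷ h c cs x) ⟩
    b * w * M (hub h) x + (b * value h cs x + w * t * (ι (left c) h * S vs x + ι (right c) h * S (reverse vs) x))
      ≡⟨ cong₂ (λ p r → b * w * M (hub h) x + (b * value h cs x + w * t * (ι (left c) h * p + ι (right c) h * r)))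
           (green-outside G hub t vs (λ v∈ → separate-∈ c s v∈ x∈)) (S-reverse-outside vs (λ v∈ → separate-∈ c s v∈ x∈)) ⟩
    b * w * M (hub h) x + (b * value h cs x + w * t * (ι (left c) h * 0ℤ + ι (right c) h * 0ℤ))
      ≡⟨ lemma b w t (M (hub h) x) (value h cs x) (ι (left c) h) (ι (right c) h) ⟩
    b * (w * M (hub h) x + value h cs x)
      ≡⟨ cong (b *_) (value-link h cs ss (λ v∈ → off (∈-++⁺ʳ vs v∈)) x∈) ⟩
    b * 0ℤ ≡⟨ ℤP.*-zeroʳ b ⟩
    0ℤ ∎
    where
    open ≡-Reasoning
    vs = vertices c
    b = br (suc (length vs))
    w = weight t (map shape cs)
    lemma : ∀ b w t m v e f → b * w * m + (b * v + w * t * (e * 0ℤ + f * 0ℤ)) ≡ b * (w * m + v)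
    lemma = solve-∀

  private
    green-hub′ : ∀ {e vs f} → Chain G hub e vs f → ∀ h → (∀ {x} → x ∈ vs → x ≢ hub h) →
                 t * S vs (hub h) ≡ - (t * t * br (length vs) * ι e h + t ^ suc (length vs) * ι f h)
    green-hub′ {e} {v ∷ vs} {f} ch h ∉ = trans (cong (t *_) (green-hub G hub t ch h ∉))
      (lemma t (br (suc (length vs))) (ι e h) (t ^ length vs) (ι f h))
      where
      lemma : ∀ t b e p f → t * - (t * (b * e + p * f)) ≡ - (t * t * b * e + t * (t * p) * f)
      lemma = solve-∀

  value-hub : ∀ h h′ cs → (∀ {v} → v ∈ linkVertices cs → v ≢ hub h′) →
              value h cs (hub h′) ≡ - hubSum t (map shape cs) h h′
  value-hub h h′ []       off = refl
  value-hub h h′ (c ∷ cs) off = begin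
    value h (c ∷ cs) (hub h′)      ≡⟨ value-∷ h c cs (hub h′) ⟩
    b * value h cs (hub h′) + w * t * (e * S vs (hub h′) + f * S (reverse vs) (hub h′))
      ≡⟨ cong₂ (λ p r → b * p + r) (value-hub h h′ cs (λ v∈ → off (∈-++⁺ʳ vs v∈)))
           (lemma w t e f (S vs (hub h′)) (S (reverse vs) (hub h′))) ⟩
    b * - hs + w * (e * (t * S vs (hub h′)) + f * (t * S (reverse vs) (hub h′)))
      ≡⟨ cong₂ (λ p r → b * - hs + w * (e * p + f * r))
           (green-hub′ (chain c) h′ (λ m → off (∈-++⁺ˡ m)))
           (trans (green-hub′ (Chain-reverse (chain c)) h′ (λ m → off (∈-++⁺ˡ (∈-resp-↭ (PermP.↭-reverse vs) m))))
             (cong (λ k → - (t * t * br k * f′ + t ^ suc k * e′)) (ListP.length-reverse vs))) ⟩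
    b * - hs + w * (e * - (t * t * br k * e′ + t ^ suc k * f′) + f * - (t * t * br k * f′ + t ^ suc k * e′))
      ≡⟨ lemma′ b hs w (t * t * br k) (t ^ suc k) e f e′ f′ ⟩
    - (b * hs + w * (t * t * br k * (e * e′ + f * f′) + t ^ suc k * (e * f′ + f * e′))) ∎
    where
    open ≡-Reasoning
    vs = vertices c
    k = length vs
    b = br (suc k)
    w = weight t (map shape cs)
    hs = hubSum t (map shape cs) h h′
    e = ι (left c) h
    f = ι (right c) h
    e′ = ι (left c) h′
    f′ = ι (right c) h′
    lemma : ∀ w t e f x y → w * t * (e * x + f * y) ≡ w * (e * (t * x) + f * (t * y))
    lemma = solve-∀
    lemma′ : ∀ b s w p r e f e′ f′ → b * - s + w * (e * - (p * e′ + r * f′) + f * - (p * f′ + r * e′)) ≡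
             - (b * s + w * (p * (e * e′ + f * f′) + r * (e * f′ + f * e′)))
    lemma′ = solve-∀

  ∈-eliminator : ∀ h cs {w} → w ∈ eliminator h cs → proj₂ w ∈ linkVertices cs
  ∈-eliminator h (c ∷ cs) {w} m with ∈-++⁻ (scale b (eliminator h cs)) m
    where b = br (suc (length (vertices c)))
  ... | inj₁ m₁ = ∈-scale (br (suc (length (vertices c)))) (eliminator h cs) (linkVertices (c ∷ cs))
    (λ m → ∈-++⁺ʳ (vertices c) (∈-eliminator h cs m)) m₁
  ... | inj₂ m₂ with ∈-++⁻ (scale (weight t (map shape cs) * t * ι (left c) h) (green t (vertices c))) m₂
  ...   | inj₁ m₃ = ∈-scale (weight t (map shape cs) * t * ι (left c) h) (green t (vertices c)) (linkVertices (c ∷ cs))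
    (λ m → ∈-++⁺ˡ (∈-green t (vertices c) m)) m₃
  ...   | inj₂ m₃ = ∈-scale (weight t (map shape cs) * t * ι (right c) h) (green t (reverse (vertices c))) (linkVertices (c ∷ cs))
    (λ m → ∈-++⁺ˡ (∈-resp-↭ (PermP.↭-reverse (vertices c)) (∈-green t (reverse (vertices c)) m))) m₃

module _ {n} (G : Graph n) (hub : Hub → Fin n) (τ : ℕ) where
  private
    t = + τ
    M = K G t
    br = bracket t

  -- Eliminating the head of a chain of k vertices gives [k] D = [k + 1] D′, where D′ is the minor
  -- without the head. By induction D′ is [k] times the minor on `ws`, and [k] is cancelled.
  minor-chain : ∀ {e vs f} → Chain G hub e vs f → ∀ ws → (∀ {v w} → v ∈ vs → w ∈ ws → Apart G v w) →
                PrincipalMinor M (vs ++ ws) ≡ br (suc (length vs)) * PrincipalMinor M ws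
  minor-chain {vs = v ∷ vs} ch ws ap = *-cancelˡ (br k) (bracket-≢0 τ (length vs)) (trans
      (Det-eliminate M proj₁ proj₂ (br k) (M v) (scale t (green t vs)) (vs ++ ws)
        (∈-scale t (green t vs) (vs ++ ws) (λ m → ∈-++⁺ˡ (∈-green t vs m))) v (vs ++ ws) killed)
      (trans (cong₂ _*_ (green-head G hub t ch) (rest ch ap)) (lemma (br (suc k)) (br k) (PrincipalMinor M ws))))
    where
    k = suc (length vs)
    lemma : ∀ a b c → a * (b * c) ≡ b * (a * c)
    lemma = solve-∀
    killed : ∀ {c} → c ∈ vs ++ ws → combine M (green t (v ∷ vs)) c ≡ 0ℤ
    killed m with ∈-++⁻ vs m
    ... | inj₁ m′ = green-tail G hub t ch m′
    ... | inj₂ m′ = green-outside G hub t (v ∷ vs) (λ x∈ → ap x∈ m′)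
    rest : ∀ {e v vs f} → Chain G hub e (v ∷ vs) f → (∀ {u w} → u ∈ v ∷ vs → w ∈ ws → Apart G u w) →
           PrincipalMinor M (vs ++ ws) ≡ br (suc (length vs)) * PrincipalMinor M ws
    rest (one _)                       _  = lemma′ t (PrincipalMinor M ws)
      where
      lemma′ : ∀ t x → x ≡ (1ℤ + t * t * 0ℤ) * x
      lemma′ = solve-∀
    rest (cons {vs = vs} _ _ _ ch′) ap = minor-chain ch′ ws (λ m → ap (there m))

  minor-links : ∀ cs → AllPairs Separate cs → PrincipalMinor M (linkVertices {G = G} {hub} cs) ≡ weight t (map shape cs)
  minor-links []       []       = refl
  minor-links (c ∷ cs) (s ∷ ss) = trans (minor-chain (chain c) (linkVertices cs) (λ u∈ v∈ → separate-∈ c s u∈ v∈))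
    (cong (br (suc (length (vertices c))) *_) (minor-links cs ss))

weight-≢0 : ∀ τ ss → weight (+ τ) ss ≢ 0ℤ
weight-≢0 τ []                 ()
weight-≢0 τ ((_ , k , _) ∷ ss) e with ℤP.i*j≡0⇒i≡0∨j≡0 (bracket (+ τ) (suc k)) e
... | inj₁ z = bracket-≢0 τ k z
... | inj₂ z = weight-≢0 τ ss z

module _ {n} {G : Graph n} (D : Decomposition G) (τ : ℕ) where
  open Decomposition D
  private
    t = + τ
    M = K G t
    ss = map shape links
    N = weight t ss
    C = linkVertices links

  hubEntry : Hub → Hub → ℤ
  hubEntry h h′ = N * M (hub h) (hub h′) + - hubSum t ss h h′

  -- Clearing the two hub rows costs a factor `N` each, and the chains left over contribute `N` on
  -- the other side; one `N` is cancelled from the resulting equation.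
  hub-formula : N * Φ G t ≡ hubEntry hubA hubA * hubEntry hubB hubB - hubEntry hubA hubB * hubEntry hubB hubA
  hub-formula = *-cancelˡ N (weight-≢0 τ ss) (begin
    N * (N * Φ G t)                              ≡⟨ cong (λ d → N * (N * d)) (sym (minor-↭ M cover)) ⟩
    N * (N * PrincipalMinor M (a ∷ b ∷ C))
      ≡⟨ cong (N *_) (Det-eliminate₂ M proj₁ proj₂ N (M a) (eliminator G hub t hubA links) (b ∷ C)
           (λ m → there (∈-eliminator G hub t hubA links m)) a b C (killed hubA)) ⟩
    N * (entry hubA hubA * Det (map M (b ∷ C)) (b ∷ C) - entry hubA hubB * Det (map M (b ∷ C)) (a ∷ C))
      ≡⟨ lemma N (entry hubA hubA) (entry hubA hubB) (Det (map M (b ∷ C)) (b ∷ C)) (Det (map M (b ∷ C)) (a ∷ C)) ⟩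
    entry hubA hubA * (N * Det (map M (b ∷ C)) (b ∷ C)) - entry hubA hubB * (N * Det (map M (b ∷ C)) (a ∷ C))
      ≡⟨ cong₂ (λ x y → entry hubA hubA * x - entry hubA hubB * y) (second hubB) (second hubA) ⟩
    entry hubA hubA * (entry hubB hubB * N) - entry hubA hubB * (entry hubB hubA * N)
      ≡⟨ lemma′ N (entry hubA hubA) (entry hubA hubB) (entry hubB hubB) (entry hubB hubA) ⟩
    N * (entry hubA hubA * entry hubB hubB - entry hubA hubB * entry hubB hubA)
      ≡⟨ cong (N *_) (cong₂ _-_ (cong₂ _*_ (entry≡ hubA hubA) (entry≡ hubB hubB)) (cong₂ _*_ (entry≡ hubA hubB) (entry≡ hubB hubA))) ⟩
    N * (hubEntry hubA hubA * hubEntry hubB hubB - hubEntry hubA hubB * hubEntry hubB hubA) ∎)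
    where
    open ≡-Reasoning
    a = hub hubA
    b = hub hubB
    entry : Hub → Hub → ℤ
    entry h h′ = N * M (hub h) (hub h′) + combine M (eliminator G hub t h links) (hub h′)
    entry≡ : ∀ h h′ → entry h h′ ≡ hubEntry h h′
    entry≡ h h′ = cong (λ x → N * M (hub h) (hub h′) + x) (value-hub G hub t h h′ links (off-hub h′))
    killed : ∀ h {c} → c ∈ C → N * M (hub h) c + combine M (eliminator G hub t h links) c ≡ 0ℤ
    killed h m = value-link G hub t h links separate (off-hub h) m
    second : ∀ h → N * Det (map M (b ∷ C)) (hub h ∷ C) ≡ entry hubB h * N
    second h = trans (Det-eliminate M proj₁ proj₂ N (M b) (eliminator G hub t hubB links) C
      (∈-eliminator G hub t hubB links) (hub h) C (killed hubB))
      (cong (entry hubB h *_) (minor-links G hub τ links separate))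
    lemma : ∀ N x y u v → N * (x * u - y * v) ≡ x * (N * u) - y * (N * v)
    lemma = solve-∀
    lemma′ : ∀ N x y u v → x * (u * N) - y * (v * N) ≡ N * (x * u - y * v)
    lemma′ = solve-∀

-- Sums, divisibility, and the coefficients of Φ up to t⁴.

∑-+ : {A : Set} (xs : List A) (f g : A → ℤ) → ∑ xs (λ x → f x + g x) ≡ ∑ xs f + ∑ xs g
∑-+ []       f g = refl
∑-+ (x ∷ xs) f g = trans (cong (λ s → f x + g x + s) (∑-+ xs f g)) (lemma (f x) (g x) (∑ xs f) (∑ xs g))
  where
  lemma : ∀ a b c d → a + b + (c + d) ≡ a + c + (b + d)
  lemma = solve-∀

∑-*ˡ : {A : Set} (xs : List A) (a : ℤ) (f : A → ℤ) → ∑ xs (λ x → a * f x) ≡ a * ∑ xs f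
∑-*ˡ []       a f = sym (ℤP.*-zeroʳ a)
∑-*ˡ (x ∷ xs) a f = trans (cong (λ s → a * f x + s) (∑-*ˡ xs a f)) (sym (ℤP.*-distribˡ-+ a (f x) (∑ xs f)))

∑-*ʳ : {A : Set} (xs : List A) (a : ℤ) (f : A → ℤ) → ∑ xs (λ x → f x * a) ≡ ∑ xs f * a
∑-*ʳ []       a f = refl
∑-*ʳ (x ∷ xs) a f = trans (cong (λ s → f x * a + s) (∑-*ʳ xs a f)) (sym (ℤP.*-distribʳ-+ a (f x) (∑ xs f)))

∑-swap : {A B : Set} (xs : List A) (ys : List B) (f : A → B → ℤ) →
         ∑ xs (λ x → ∑ ys (f x)) ≡ ∑ ys (λ y → ∑ xs (λ x → f x y))
∑-swap []       ys f = sym (∑-zero ys (λ _ → refl))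
∑-swap (x ∷ xs) ys f = trans (cong (λ s → ∑ ys (f x) + s) (∑-swap xs ys f))
  (sym (∑-+ ys (f x) (λ y → ∑ xs (λ x′ → f x′ y))))

∑-mono : {A : Set} (xs : List A) {f g : A → ℤ} → (∀ x → f x ℤ.≤ g x) → ∑ xs f ℤ.≤ ∑ xs g
∑-mono []       h = ℤP.≤-refl
∑-mono (x ∷ xs) h = ℤP.+-mono-≤ (h x) (∑-mono xs h)

x≤x*x : ∀ x → x ℤ.≤ x * x
x≤x*x (+ n)      = subst (+ n ℤ.≤_) (ℤP.pos-* n n) (ℤ.+≤+ (n≤n*n n))
  where
  n≤n*n : ∀ n → n ≤ n ℕ.* n
  n≤n*n zero    = z≤n
  n≤n*n (suc n) = ℕP.m≤m+n (suc n) (n ℕ.* suc n)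
x≤x*x ℤ.-[1+ n ] = ℤ.-≤+

record _divides_ (m x : ℤ) : Set where
  constructor factor
  field
    quotient : ℤ
    equality : x ≡ m * quotient

divides-+ : ∀ {m x y} → m divides x → m divides y → m divides (x + y)
divides-+ {m} (factor d refl) (factor e refl) = factor (d + e) (sym (ℤP.*-distribˡ-+ m d e))

divides-neg : ∀ {m x} → m divides x → m divides (- x)
divides-neg {m} (factor d refl) = factor (- d) (ℤP.neg-distribʳ-* m d)

divides-*ˡ : ∀ {m x} y → m divides x → m divides (y * x)
divides-*ˡ {m} y (factor d refl) = factor (y * d) (lemma y m d)
  where
  lemma : ∀ y m d → y * (m * d) ≡ m * (y * d)
  lemma = solve-∀

alt-divides : {C : Set} {m : ℤ} {f : C → List C → ℤ} (cs : List C) →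
              (∀ {c} → c ∈ cs → ∀ xs → m divides f c xs) → m divides alt f cs
alt-divides {m = m} []       h = factor 0ℤ (sym (ℤP.*-zeroʳ m))
alt-divides         (c ∷ cs) h = divides-+ (h (here refl) cs) (divides-neg (alt-divides cs (λ m xs → h (there m) (c ∷ xs))))

Det-divides : {C : Set} {m : ℤ} (rs : List (C → ℤ)) (x : C) (xs : List C) →
              (∀ {r} → r ∈ rs → m divides r x) → m divides Det rs (x ∷ xs)
Det-divides {m = m} []       x xs h = factor 0ℤ (sym (ℤP.*-zeroʳ m))
Det-divides {m = m} (r ∷ rs) x xs h = divides-+
  (subst (m divides_) (ℤP.*-comm (Det rs xs) (r x)) (divides-*ˡ (Det rs xs) (h (here refl))))
  (divides-neg (alt-divides xs (λ {c} _ ys → divides-*ˡ (r c) (Det-divides rs x ys (λ m → h (there m))))))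

-- Φ modulo t⁵, by eliminating the vertices of the list one at a time: writing r for the row of A
-- at v and A′ for the rest, adding t(1 − t²) r + t² rA′ + t³ rA′² times the remaining rows makes
-- the off-diagonal part of the row at v divisible by t⁴.
module LowOrder {n} (G : Graph n) where
  private
    a = A G

  -- `walkᵢ v vs w` counts the walks with i + 1 edges from `v` to `w` whose inner vertices lie in
  -- `vs`.
  walk₁ walk₂ walk₃ : Fin n → List (Fin n) → Fin n → ℤ
  walk₁ v vs w = ∑ vs (λ u → a v u * a u w)
  walk₂ v vs w = ∑ vs (λ u → walk₁ v vs u * a u w)
  walk₃ v vs w = ∑ vs (λ u → walk₂ v vs u * a u w)

  -- The `coeffᵢ` are the coefficients of tⁱ in `Truncation`, built up one vertex at a time from
  -- `row-corner`. `sumSquares` follows the same recursion for the squared degrees in the induced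
  -- subgraph (`sumSquares-degrees`).
  edges coeff₂ coeff₃ coeff₄ sumSquares : List (Fin n) → ℤ
  edges []       = 0ℤ
  edges (v ∷ vs) = edges vs + ∑ vs (a v)
  coeff₂ []       = 0ℤ
  coeff₂ (v ∷ vs) = coeff₂ vs + 1ℤ - ∑ vs (a v)
  coeff₃ []       = 0ℤ
  coeff₃ (v ∷ vs) = coeff₃ vs - walk₂ v vs v
  coeff₄ []       = 0ℤ
  coeff₄ (v ∷ vs) = coeff₄ vs + coeff₂ vs * (1ℤ - ∑ vs (a v)) + ∑ vs (a v) - walk₃ v vs v
  sumSquares []       = 0ℤ
  sumSquares (v ∷ vs) = sumSquares vs + (+ 2) * ∑ vs (walk₁ v vs) + ∑ vs (a v) + ∑ vs (a v) * ∑ vs (a v)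

  private
    edge-idem : ∀ b → edge b * edge b ≡ edge b
    edge-idem true  = refl
    edge-idem false = refl

    walk₁-self : ∀ v vs → walk₁ v vs v ≡ ∑ vs (a v)
    walk₁-self v vs = ∑-cong vs (λ {u} _ → trans (cong (a v u *_) (A-sym G u v)) (edge-idem (adj G v u)))

    -- A closed walk with four edges is cut at its midpoint; each half is counted by `walk₁`.
    walk₃-self : ∀ v vs → walk₃ v vs v ≡ ∑ vs (λ w → walk₁ v vs w * walk₁ v vs w)
    walk₃-self v vs = begin
      ∑ vs (λ u → ∑ vs (λ w → walk₁ v vs w * a w u) * a u v)
        ≡⟨ ∑-cong vs (λ {u} _ → sym (∑-*ʳ vs (a u v) (λ w → walk₁ v vs w * a w u))) ⟩
      ∑ vs (λ u → ∑ vs (λ w → walk₁ v vs w * a w u * a u v))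
        ≡⟨ ∑-swap vs vs (λ u w → walk₁ v vs w * a w u * a u v) ⟩
      ∑ vs (λ w → ∑ vs (λ u → walk₁ v vs w * a w u * a u v))
        ≡⟨ ∑-cong vs (λ {w} _ → trans (∑-cong vs (λ {u} _ → back w u)) (∑-*ˡ vs (walk₁ v vs w) (λ u → a v u * a u w))) ⟩
      ∑ vs (λ w → walk₁ v vs w * walk₁ v vs w) ∎
      where
      open ≡-Reasoning
      lemma : ∀ x y z → x * y * z ≡ x * (z * y)
      lemma = solve-∀
      back : ∀ w u → walk₁ v vs w * a w u * a u v ≡ walk₁ v vs w * (a v u * a u w)
      back w u = trans (lemma (walk₁ v vs w) (a w u) (a u v))
        (cong (walk₁ v vs w *_) (cong₂ _*_ (A-sym G u v) (A-sym G w u)))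

  coeff₂-edges : ∀ vs → coeff₂ vs ≡ + length vs - edges vs
  coeff₂-edges []       = refl
  coeff₂-edges (v ∷ vs) = trans (cong (λ s → s + 1ℤ - ∑ vs (a v)) (coeff₂-edges vs))
    (lemma (+ length vs) (edges vs) (∑ vs (a v)))
    where
    lemma : ∀ l e b → l - e + 1ℤ - b ≡ 1ℤ + l - (e + b)
    lemma = solve-∀

  -- Equality would require that no two vertices have two common neighbours (x² = x for codegrees x).
  coeff₄-bound : ∀ vs → (+ 2) * coeff₄ vs ℤ.≤ coeff₂ vs * coeff₂ vs - + length vs + (+ 5) * edges vs - sumSquares vs
  coeff₄-bound []       = ℤP.≤-refl
  coeff₄-bound (v ∷ vs) = begin
    (+ 2) * (c₄ + c₂ * (1ℤ - b) + b - walk₃ v vs v)     ≡⟨ lemma c₄ c₂ b (walk₃ v vs v) ⟩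
    (+ 2) * c₄ + ((+ 2) * (c₂ * (1ℤ - b)) + (+ 2) * b + (- (+ 2)) * walk₃ v vs v)
      ≤⟨ ℤP.+-mono-≤ (coeff₄-bound vs) (ℤP.+-monoʳ-≤ ((+ 2) * (c₂ * (1ℤ - b)) + (+ 2) * b)
           (ℤP.*-monoˡ-≤-nonPos (- (+ 2)) codeg)) ⟩
    c₂ * c₂ - l + (+ 5) * e - s + ((+ 2) * (c₂ * (1ℤ - b)) + (+ 2) * b + (- (+ 2)) * w)
      ≡⟨ lemma′ c₂ l e s b w ⟩
    (c₂ + 1ℤ - b) * (c₂ + 1ℤ - b) - (1ℤ + l) + (+ 5) * (e + b) - (s + (+ 2) * w + b + b * b) ∎
    where
    open ℤP.≤-Reasoning
    b = ∑ vs (a v)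
    c₂ = coeff₂ vs
    c₄ = coeff₄ vs
    e = edges vs
    s = sumSquares vs
    l = + length vs
    w = ∑ vs (walk₁ v vs)
    codeg : w ℤ.≤ walk₃ v vs v
    codeg = subst (w ℤ.≤_) (sym (walk₃-self v vs)) (∑-mono vs (λ u → x≤x*x (walk₁ v vs u)))
    lemma : ∀ c₄ c₂ b w → (+ 2) * (c₄ + c₂ * (1ℤ - b) + b - w) ≡
            (+ 2) * c₄ + ((+ 2) * (c₂ * (1ℤ - b)) + (+ 2) * b + (- (+ 2)) * w)
    lemma = solve-∀
    lemma′ : ∀ c₂ l e s b w →
             c₂ * c₂ - l + (+ 5) * e - s + ((+ 2) * (c₂ * (1ℤ - b)) + (+ 2) * b + (- (+ 2)) * w) ≡
             (c₂ + 1ℤ - b) * (c₂ + 1ℤ - b) - (1ℤ + l) + (+ 5) * (e + b) - (s + (+ 2) * w + b + b * b)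
    lemma′ = solve-∀

  edges-degrees : ∀ vs → ∑ vs (λ u → ∑ vs (a u)) ≡ (+ 2) * edges vs
  edges-degrees []       = refl
  edges-degrees (v ∷ vs) = begin
    a v v + b + ∑ vs (λ u → a u v + ∑ vs (a u))
      ≡⟨ cong₂ (λ x y → x + b + y) (A-irrefl G v) (trans (∑-+ vs (λ u → a u v) (λ u → ∑ vs (a u)))
           (cong₂ _+_ (∑-cong vs (λ {u} _ → A-sym G u v)) (edges-degrees vs))) ⟩
    0ℤ + b + (b + (+ 2) * edges vs) ≡⟨ lemma b (edges vs) ⟩
    (+ 2) * (edges vs + b)          ∎
    where
    open ≡-Reasoning
    b = ∑ vs (a v)
    lemma : ∀ b e → 0ℤ + b + (b + (+ 2) * e) ≡ (+ 2) * (e + b)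
    lemma = solve-∀

  -- Adding `v` raises the degree of each of its neighbours by one. The cross terms of the squares
  -- count walks of two edges from `v`.
  sumSquares-degrees : ∀ vs → ∑ vs (λ u → ∑ vs (a u) * ∑ vs (a u)) ≡ sumSquares vs
  sumSquares-degrees []       = refl
  sumSquares-degrees (v ∷ vs) = begin
    (a v v + b) * (a v v + b) + ∑ vs (λ u → (a u v + d u) * (a u v + d u))
      ≡⟨ cong₂ (λ x y → (x + b) * (x + b) + y) (A-irrefl G v) (∑-cong vs (λ {u} _ → square u)) ⟩
    (0ℤ + b) * (0ℤ + b) + ∑ vs (λ u → a v u + (+ 2) * (a v u * d u) + d u * d u)
      ≡⟨ cong (λ s → (0ℤ + b) * (0ℤ + b) + s)
           (trans (∑-+ vs (λ u → a v u + (+ 2) * (a v u * d u)) (λ u → d u * d u))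
             (cong₂ _+_ (trans (∑-+ vs (a v) (λ u → (+ 2) * (a v u * d u)))
               (cong (λ s → b + s) (trans (∑-*ˡ vs (+ 2) (λ u → a v u * d u)) (cong ((+ 2) *_) paths))))
               (sumSquares-degrees vs))) ⟩
    (0ℤ + b) * (0ℤ + b) + (b + (+ 2) * ∑ vs (walk₁ v vs) + sumSquares vs)
      ≡⟨ lemma b (∑ vs (walk₁ v vs)) (sumSquares vs) ⟩
    sumSquares vs + (+ 2) * ∑ vs (walk₁ v vs) + b + b * b ∎
    where
    open ≡-Reasoning
    b = ∑ vs (a v)
    d = λ u → ∑ vs (a u)
    paths : ∑ vs (λ u → a v u * d u) ≡ ∑ vs (walk₁ v vs)
    paths = trans (∑-cong vs (λ {u} _ → sym (∑-*ˡ vs (a v u) (a u)))) (∑-swap vs vs (λ u w → a v u * a u w))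
    expand : ∀ x y → (x + y) * (x + y) ≡ x * x + (+ 2) * (x * y) + y * y
    expand = solve-∀
    square : ∀ u → (a u v + d u) * (a u v + d u) ≡ a v u + (+ 2) * (a v u * d u) + d u * d u
    square u = trans (expand (a u v) (d u)) (cong (λ s → s + d u * d u)
      (cong₂ (λ x y → x + (+ 2) * (y * d u)) (trans (edge-idem (adj G u v)) (A-sym G u v)) (A-sym G u v)))
    lemma : ∀ b w s → (0ℤ + b) * (0ℤ + b) + (b + (+ 2) * w + s) ≡ s + (+ 2) * w + b + b * b
    lemma = solve-∀

  module _ (t : ℤ) where
    private
      M = K G t
      q = t * t

    Truncation : List (Fin n) → ℤ
    Truncation vs = 1ℤ + coeff₂ vs * q + coeff₃ vs * (q * t) + coeff₄ vs * (q * q)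

    ∑-K-out : ∀ (c : Fin n → ℤ) vs {w} → (∀ {u} → u ∈ vs → u ≢ w) →
              ∑ vs (λ u → c u * M u w) ≡ - (t * ∑ vs (λ u → c u * a u w))
    ∑-K-out c []       h = sym (cong -_ (ℤP.*-zeroʳ t))
    ∑-K-out c (u ∷ vs) {w} h = trans
      (cong₂ (λ x y → c u * x + y) (K-off G t (h (here refl))) (∑-K-out c vs (λ m → h (there m))))
      (lemma (c u) t (a u w) (∑ vs (λ u → c u * a u w)))
      where
      lemma : ∀ c t a s → c * - (t * a) + - (t * s) ≡ - (t * (c * a + s))
      lemma = solve-∀

    ∑-K-in : ∀ (c : Fin n → ℤ) vs → Unique vs → ∀ {w} → w ∈ vs →
             ∑ vs (λ u → c u * M u w) ≡ (1ℤ + q) * c w - t * ∑ vs (λ u → c u * a u w)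
    ∑-K-in c (u ∷ vs) (u∉ ∷ _) (here refl) = trans
      (cong₂ (λ x y → c u * x + y) (K-diag G t u) (∑-K-out c vs (λ m e → All.lookup u∉ m (sym e))))
      (trans (lemma (c u) t (∑ vs (λ v → c v * a v u)))
        (cong (λ z → (1ℤ + q) * c u - t * (c u * z + ∑ vs (λ v → c v * a v u))) (sym (A-irrefl G u))))
      where
      lemma : ∀ c t s → c * (1ℤ + t * t) + - (t * s) ≡ (1ℤ + t * t) * c - t * (c * 0ℤ + s)
      lemma = solve-∀
    ∑-K-in c (u ∷ vs) (u∉ ∷ uq) {w} (there m) = trans
      (cong₂ (λ x y → c u * x + y) (K-off G t (All.lookup u∉ m)) (∑-K-in c vs uq m))
      (lemma (c u) t (a u w) (c w) (∑ vs (λ v → c v * a v w)))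
      where
      lemma : ∀ c t a cw s → c * - (t * a) + ((1ℤ + t * t) * cw - t * s) ≡ (1ℤ + t * t) * cw - t * (c * a + s)
      lemma = solve-∀

    module _ (v : Fin n) (vs : List (Fin n)) where
      private
        r = a v
        r₁ = walk₁ v vs
        r₂ = walk₂ v vs
        r₃ = walk₃ v vs
        c : Fin n → ℤ
        -- The row t r times the inverse of (1 + t²) I - t A′, expanded in powers of t and cut after
        -- t³.
        c w = t * (1ℤ - q) * r w + q * r₁ w + q * t * r₂ w
        row = row+ M c (λ w → w) 1ℤ (M v) vs

        ∑-c : ∀ w → ∑ vs (λ u → c u * a u w) ≡ t * (1ℤ - q) * r₁ w + q * r₂ w + q * t * r₃ w
        ∑-c w = begin
          ∑ vs (λ u → c u * a u w)
            ≡⟨ ∑-cong vs (λ {u} _ → lemma t q (r u) (r₁ u) (r₂ u) (a u w)) ⟩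
          ∑ vs (λ u → t * (1ℤ - q) * (r u * a u w) + q * (r₁ u * a u w) + q * t * (r₂ u * a u w))
            ≡⟨ ∑-+ vs (λ u → t * (1ℤ - q) * (r u * a u w) + q * (r₁ u * a u w)) (λ u → q * t * (r₂ u * a u w)) ⟩
          ∑ vs (λ u → t * (1ℤ - q) * (r u * a u w) + q * (r₁ u * a u w)) + ∑ vs (λ u → q * t * (r₂ u * a u w))
            ≡⟨ cong₂ _+_ (∑-lin vs (t * (1ℤ - q)) q (λ u → r u * a u w) (λ u → r₁ u * a u w))
                 (∑-*ˡ vs (q * t) (λ u → r₂ u * a u w)) ⟩
          t * (1ℤ - q) * r₁ w + q * r₂ w + q * t * r₃ w ∎
          where
          open ≡-Reasoning
          lemma : ∀ t q r r₁ r₂ a → (t * (1ℤ - q) * r + q * r₁ + q * t * r₂) * a ≡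
                  t * (1ℤ - q) * (r * a) + q * (r₁ * a) + q * t * (r₂ * a)
          lemma = solve-∀

      row-off : Unique vs → (∀ {u} → u ∈ vs → v ≢ u) → ∀ {w} → w ∈ vs →
                row w ≡ q * q * ((+ 2) * r₁ w + t * r₂ w - t * r w - r₃ w)
      row-off uq v∉ {w} m = begin
        1ℤ * M v w + ∑ vs (λ u → c u * M u w)
          ≡⟨ cong₂ (λ x y → 1ℤ * x + y) (K-off G t (v∉ m)) (∑-K-in c vs uq m) ⟩
        1ℤ * - (t * r w) + ((1ℤ + q) * c w - t * ∑ vs (λ u → c u * a u w))
          ≡⟨ cong (λ s → 1ℤ * - (t * r w) + ((1ℤ + q) * c w - t * s)) (∑-c w) ⟩
        1ℤ * - (t * r w) + ((1ℤ + q) * c w - t * (t * (1ℤ - q) * r₁ w + q * r₂ w + q * t * r₃ w))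
          ≡⟨ lemma t (r w) (r₁ w) (r₂ w) (r₃ w) ⟩
        q * q * ((+ 2) * r₁ w + t * r₂ w - t * r w - r₃ w) ∎
        where
        open ≡-Reasoning
        lemma : ∀ t r r₁ r₂ r₃ →
          1ℤ * - (t * r) + ((1ℤ + t * t) * (t * (1ℤ - t * t) * r + t * t * r₁ + t * t * t * r₂)
            - t * (t * (1ℤ - t * t) * r₁ + t * t * r₂ + t * t * t * r₃)) ≡
          t * t * (t * t) * ((+ 2) * r₁ + t * r₂ - t * r - r₃)
        lemma = solve-∀

      row-corner : (∀ {u} → u ∈ vs → v ≢ u) →
                   row v ≡ 1ℤ + (1ℤ - ∑ vs r) * q - r₂ v * (q * t) + (∑ vs r - r₃ v) * (q * q)
      row-corner v∉ = begin
        1ℤ * M v v + ∑ vs (λ u → c u * M u v)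
          ≡⟨ cong₂ (λ x y → 1ℤ * x + y) (K-diag G t v)
               (trans (∑-K-out c vs (λ m e → v∉ m (sym e))) (cong (λ s → - (t * s)) (∑-c v))) ⟩
        1ℤ * (1ℤ + q) + - (t * (t * (1ℤ - q) * r₁ v + q * r₂ v + q * t * r₃ v))
          ≡⟨ cong (λ b → 1ℤ * (1ℤ + q) + - (t * (t * (1ℤ - q) * b + q * r₂ v + q * t * r₃ v))) (walk₁-self v vs) ⟩
        1ℤ * (1ℤ + q) + - (t * (t * (1ℤ - q) * ∑ vs r + q * r₂ v + q * t * r₃ v))
          ≡⟨ lemma t (∑ vs r) (r₂ v) (r₃ v) ⟩
        1ℤ + (1ℤ - ∑ vs r) * q - r₂ v * (q * t) + (∑ vs r - r₃ v) * (q * q) ∎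
        where
        open ≡-Reasoning
        lemma : ∀ t b r₂ r₃ → 1ℤ * (1ℤ + t * t) + - (t * (t * (1ℤ - t * t) * b + t * t * r₂ + t * t * t * r₃)) ≡
                1ℤ + (1ℤ - b) * (t * t) - r₂ * (t * t * t) + (b - r₃) * (t * t * (t * t))
        lemma = solve-∀

      -- After the row operation the row at `v` is divisible by t⁴ off the diagonal, and the rest of
      -- the column at `v` is divisible by t. So every term of the expansion but the diagonal one is
      -- divisible by t⁵.
      minor-step : Unique vs → (∀ {u} → u ∈ vs → v ≢ u) →
                   (q * q * t) divides (PrincipalMinor M (v ∷ vs) - row v * PrincipalMinor M vs)
      minor-step uq v∉ = subst ((q * q * t) divides_) (sym eq) (divides-neg (alt-divides vs off))
        where
        R = alt (λ w rest → row w * Det (map M vs) (v ∷ rest)) vs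
        lemma : ∀ x y → x - y - x ≡ - y
        lemma = solve-∀
        eq : PrincipalMinor M (v ∷ vs) - row v * PrincipalMinor M vs ≡ - R
        eq = trans (cong (_- row v * PrincipalMinor M vs)
               (sym (trans (Det-row+ M c (λ w → w) 1ℤ (M v) vs vs (λ m → m) (v ∷ vs))
                 (ℤP.*-identityˡ (PrincipalMinor M (v ∷ vs))))))
             (lemma (row v * PrincipalMinor M vs) R)
        col : ∀ {ρ} → ρ ∈ map M vs → t divides ρ v
        col m with ∈-map⁻ M m
        ... | u , u∈ , refl = factor (- a u v) (trans (K-off G t (λ e → v∉ u∈ (sym e))) (ℤP.neg-distribʳ-* t (a u v)))
        off : ∀ {w} → w ∈ vs → ∀ rest → (q * q * t) divides (row w * Det (map M vs) (v ∷ rest))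
        off {w} m rest with Det-divides {m = t} (map M vs) v rest col
        ... | factor d e = factor (z * d) (trans (cong₂ _*_ (row-off uq v∉ m) e) (lemma′ (q * q) z t d))
          where
          z = (+ 2) * r₁ w + t * r₂ w - t * r w - r₃ w
          lemma′ : ∀ p z t d → p * z * (t * d) ≡ p * t * (z * d)
          lemma′ = solve-∀

    minor-truncation : ∀ vs → Unique vs → (q * q * t) divides (PrincipalMinor M vs - Truncation vs)
    minor-truncation []       _ = factor 0ℤ (lemma t)
      where
      lemma : ∀ t → 1ℤ - (1ℤ + 0ℤ * (t * t) + 0ℤ * (t * t * t) + 0ℤ * (t * t * (t * t))) ≡ t * t * (t * t) * t * 0ℤ
      lemma = solve-∀
    minor-truncation (v ∷ vs) (v∉ ∷ uq) = factor (d′ + row v * d + rest) (begin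
      X - Truncation (v ∷ vs)                             ≡⟨ lemma₁ X (row v) Y (Truncation vs) (Truncation (v ∷ vs)) ⟩
      X - row v * Y + row v * (Y - Truncation vs) + (row v * Truncation vs - Truncation (v ∷ vs))
        ≡⟨ cong₂ (λ x y → x + row v * y + (row v * Truncation vs - Truncation (v ∷ vs))) e′ e ⟩
      q * q * t * d′ + row v * (q * q * t * d) + (row v * Truncation vs - Truncation (v ∷ vs))
        ≡⟨ cong (λ x → q * q * t * d′ + row v * (q * q * t * d) + x)
             (trans (cong (λ x → x * Truncation vs - Truncation (v ∷ vs)) (row-corner v vs (All.lookup v∉)))
               (lemma₂ t (coeff₂ vs) (coeff₃ vs) (coeff₄ vs) b (walk₂ v vs v) (walk₃ v vs v))) ⟩
      q * q * t * d′ + row v * (q * q * t * d) + q * q * t * rest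
        ≡⟨ lemma₃ (q * q * t) d′ (row v) d rest ⟩
      q * q * t * (d′ + row v * d + rest)                 ∎)
      where
      open ≡-Reasoning
      row = row+ M (λ w → t * (1ℤ - q) * a v w + q * walk₁ v vs w + q * t * walk₂ v vs w) (λ w → w) 1ℤ (M v) vs
      ih = minor-truncation vs uq
      d = _divides_.quotient ih
      e = _divides_.equality ih
      step = minor-step v vs uq (All.lookup v∉)
      d′ = _divides_.quotient step
      e′ = _divides_.equality step
      X = PrincipalMinor M (v ∷ vs)
      Y = PrincipalMinor M vs
      b = ∑ vs (a v)
      -- The part of degree at least 5 in the product of the corner entry with the truncation for
      -- `vs`, divided by t⁵.
      remainder : ℤ → ℤ → ℤ → ℤ → ℤ → ℤ → ℤ → ℤ
      remainder t α γ β b w₂ w₃ =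
        ((1ℤ - b) * γ - w₂ * α) + t * ((1ℤ - b) * β + (b - w₃) * α - w₂ * γ) + t * t * ((b - w₃) * γ - w₂ * β)
          + t * t * t * ((b - w₃) * β)
      rest = remainder t (coeff₂ vs) (coeff₃ vs) (coeff₄ vs) b (walk₂ v vs v) (walk₃ v vs v)
      lemma₁ : ∀ X r Y T T′ → X - T′ ≡ X - r * Y + r * (Y - T) + (r * T - T′)
      lemma₁ = solve-∀
      lemma₂ : ∀ t α γ β b w₂ w₃ →
        (1ℤ + (1ℤ - b) * (t * t) - w₂ * (t * t * t) + (b - w₃) * (t * t * (t * t)))
          * (1ℤ + α * (t * t) + γ * (t * t * t) + β * (t * t * (t * t)))
        - (1ℤ + (α + 1ℤ - b) * (t * t) + (γ - w₂) * (t * t * t) + (β + α * (1ℤ - b) + b - w₃) * (t * t * (t * t)))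
        ≡ t * t * (t * t) * t * (((1ℤ - b) * γ - w₂ * α) + t * ((1ℤ - b) * β + (b - w₃) * α - w₂ * γ)
            + t * t * ((b - w₃) * γ - w₂ * β) + t * t * t * ((b - w₃) * β))
      lemma₂ = solve-∀
      lemma₃ : ∀ m x r y z → m * x + r * (m * y) + m * z ≡ m * (x + r * y + z)
      lemma₃ = solve-∀

-- The tree of the theorem with its vertices numbered.

-- The edges and the vertices of H₍₁₀₊ⱼ₎ by number.
module Numbering (j : ℕ) where

  data Edge : ℕ → ℕ → Set where
    path     : ∀ {i} → i < 5 ℕ.+ j → Edge i (suc i)
    pendant₁ : Edge 2 (6 ℕ.+ j)
    pendant₂ : Edge (6 ℕ.+ j) (7 ℕ.+ j)
    pendant₃ : Edge (3 ℕ.+ j) (8 ℕ.+ j)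
    pendant₄ : Edge (8 ℕ.+ j) (9 ℕ.+ j)

  -- Membership of a vertex in one of the five chains left by removing the branch vertices 2 and 3 + j.
  data In : ℕ → ℕ → Set where
    v₀     : In 1 0
    v₁     : In 1 1
    middle : ∀ {i} → i < j → In 0 (3 ℕ.+ i)
    v₄     : In 3 (4 ℕ.+ j)
    v₅     : In 3 (5 ℕ.+ j)
    v₆     : In 2 (6 ℕ.+ j)
    v₇     : In 2 (7 ℕ.+ j)
    v₈     : In 4 (8 ℕ.+ j)
    v₉     : In 4 (9 ℕ.+ j)

  private
    k+j≮j : ∀ k → ¬ (k ℕ.+ j < j)
    k+j≮j k p = ℕP.<⇒≱ p (ℕP.m≤n+m j k)

    k+5+j≮5+j : ∀ k → ¬ (k ℕ.+ (5 ℕ.+ j) < 5 ℕ.+ j)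
    k+5+j≮5+j k p = ℕP.<⇒≱ p (ℕP.m≤n+m (5 ℕ.+ j) k)

  -- The five chains are not joined to each other. The absurd cases are clashes of numbers: a middle
  -- vertex 3 + i would have i ≥ j, or a path edge would start at or beyond the last path vertex 5 +
  -- j.
  edge-In : ∀ {u v k l} → Edge u v → In k u → In l v → k ≡ l
  edge-In (path p) v₀ v₁ = refl
  edge-In (path p) v₁ ()
  edge-In (path p) (middle q) (middle _) = refl
  edge-In (path p) (middle q) v₄ = ⊥-elim (k+j≮j 0 q)
  edge-In (path p) (middle q) v₅ = ⊥-elim (k+j≮j 1 q)
  edge-In (path p) (middle q) v₆ = ⊥-elim (k+j≮j 2 q)
  edge-In (path p) (middle q) v₇ = ⊥-elim (k+j≮j 3 q)
  edge-In (path p) (middle q) v₈ = ⊥-elim (k+j≮j 4 q)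
  edge-In (path p) (middle q) v₉ = ⊥-elim (k+j≮j 5 q)
  edge-In (path p) v₄ (middle q) = ⊥-elim (k+j≮j 2 q)
  edge-In (path p) v₄ v₅ = refl
  edge-In (path p) v₅ _ = ⊥-elim (k+5+j≮5+j 0 p)
  edge-In (path p) v₆ _ = ⊥-elim (k+5+j≮5+j 1 p)
  edge-In (path p) v₇ _ = ⊥-elim (k+5+j≮5+j 2 p)
  edge-In (path p) v₈ _ = ⊥-elim (k+5+j≮5+j 3 p)
  edge-In (path p) v₉ _ = ⊥-elim (k+5+j≮5+j 4 p)
  edge-In pendant₁ ()
  edge-In pendant₂ (middle q) _ = ⊥-elim (k+j≮j 3 q)
  edge-In pendant₂ v₆ (middle q) = ⊥-elim (k+j≮j 4 q)
  edge-In pendant₂ v₆ v₇ = refl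
  edge-In pendant₃ (middle q) _ = ⊥-elim (k+j≮j 0 q)
  edge-In pendant₄ (middle q) _ = ⊥-elim (k+j≮j 5 q)
  edge-In pendant₄ v₈ (middle q) = ⊥-elim (k+j≮j 6 q)
  edge-In pendant₄ v₈ v₉ = refl

  In-unique : ∀ {u k l} → In k u → In l u → k ≡ l
  In-unique v₀ v₀ = refl
  In-unique v₁ v₁ = refl
  In-unique (middle _) (middle _) = refl
  In-unique (middle q) v₄ = ⊥-elim (k+j≮j 1 q)
  In-unique (middle q) v₅ = ⊥-elim (k+j≮j 2 q)
  In-unique (middle q) v₆ = ⊥-elim (k+j≮j 3 q)
  In-unique (middle q) v₇ = ⊥-elim (k+j≮j 4 q)
  In-unique (middle q) v₈ = ⊥-elim (k+j≮j 5 q)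
  In-unique (middle q) v₉ = ⊥-elim (k+j≮j 6 q)
  In-unique v₄ (middle q) = ⊥-elim (k+j≮j 1 q)
  In-unique v₅ (middle q) = ⊥-elim (k+j≮j 2 q)
  In-unique v₆ (middle q) = ⊥-elim (k+j≮j 3 q)
  In-unique v₇ (middle q) = ⊥-elim (k+j≮j 4 q)
  In-unique v₈ (middle q) = ⊥-elim (k+j≮j 5 q)
  In-unique v₉ (middle q) = ⊥-elim (k+j≮j 6 q)
  In-unique v₄ v₄ = refl
  In-unique v₅ v₅ = refl
  In-unique v₆ v₆ = refl
  In-unique v₇ v₇ = refl
  In-unique v₈ v₈ = refl
  In-unique v₉ v₉ = refl

  In-≢2 : ∀ {k} → ¬ In k 2
  In-≢2 ()

  In-≢3+j : ∀ {k} → ¬ In k (3 ℕ.+ j)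
  In-≢3+j (middle q) = k+j≮j 0 q

module PathWithTwoPendants (j : ℕ) where
  open Numbering j

  N : ℕ
  N = proj₁ (H (10 ℕ.+ j))

  G : Graph N
  G = proj₂ (H (10 ℕ.+ j))

  private
    es : List (ℕ × ℕ)
    es = pathEdges (6 ℕ.+ j) ++ pendantEdges 2 (6 ℕ.+ j) 2 ++ pendantEdges (3 ℕ.+ j) (6 ℕ.+ j ℕ.+ 2) 2

    hasEdge⁻ : ∀ ds {u v} → hasEdge ds u v ≡ true → (u , v) ∈ ds
    hasEdge⁻ ((a , b) ∷ ds) {u} {v} e with a ≡ᵇ u in p | b ≡ᵇ v in q
    ... | true  | true  = here (sym (cong₂ _,_ (ℕP.≡ᵇ⇒≡ a u (subst T (sym p) tt)) (ℕP.≡ᵇ⇒≡ b v (subst T (sym q) tt))))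
    ... | true  | false = there (hasEdge⁻ ds e)
    ... | false | _     = there (hasEdge⁻ ds e)

    T⇒≡ : ∀ {b} → T b → b ≡ true
    T⇒≡ {true} _ = refl

    hasEdge⁺ : ∀ ds {u v} → (u , v) ∈ ds → hasEdge ds u v ≡ true
    hasEdge⁺ ((a , b) ∷ ds) (here refl)
      rewrite T⇒≡ (ℕP.≡⇒≡ᵇ a a refl) | T⇒≡ (ℕP.≡⇒≡ᵇ b b refl) = refl
    hasEdge⁺ ((a , b) ∷ ds) {u} {v} (there m) with (a ≡ᵇ u) ∧ (b ≡ᵇ v)
    ... | true  = refl
    ... | false = hasEdge⁺ ds m

  private
    Edge⇒∈ : ∀ {u v} → Edge u v → (u , v) ∈ es
    Edge⇒∈ (path p) = ∈-++⁺ˡ (∈-map⁺ _ (∈-upTo⁺ p))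
    Edge⇒∈ pendant₁ = ∈-++⁺ʳ (pathEdges (6 ℕ.+ j)) (here refl)
    Edge⇒∈ pendant₂ = ∈-++⁺ʳ (pathEdges (6 ℕ.+ j)) (there (here
      (cong₂ _,_ (sym (ℕP.+-identityʳ (6 ℕ.+ j))) (sym (ℕP.+-comm (6 ℕ.+ j) 1)))))
    Edge⇒∈ pendant₃ = ∈-++⁺ʳ (pathEdges (6 ℕ.+ j)) (there (there (here
      (cong (3 ℕ.+ j ,_) (sym (ℕP.+-comm (6 ℕ.+ j) 2))))))
    Edge⇒∈ pendant₄ = ∈-++⁺ʳ (pathEdges (6 ℕ.+ j)) (there (there (there (here
      (cong₂ _,_ (sym (trans (ℕP.+-identityʳ (6 ℕ.+ j ℕ.+ 2)) (ℕP.+-comm (6 ℕ.+ j) 2)))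
                 (sym (trans (ℕP.+-comm (6 ℕ.+ j ℕ.+ 2) 1) (cong suc (ℕP.+-comm (6 ℕ.+ j) 2)))))))))

    ∈⇒Edge : ∀ {u v} → (u , v) ∈ es → Edge u v
    ∈⇒Edge m with ∈-++⁻ (pathEdges (6 ℕ.+ j)) m
    ... | inj₁ m′ with ∈-map⁻ _ m′
    ...   | i , i∈ , refl = path (∈-upTo⁻ i∈)
    ∈⇒Edge m | inj₂ (here refl) = pendant₁
    ∈⇒Edge m | inj₂ (there (here refl)) =
      subst₂ Edge (sym (ℕP.+-identityʳ (6 ℕ.+ j))) (sym (ℕP.+-comm (6 ℕ.+ j) 1)) pendant₂
    ∈⇒Edge m | inj₂ (there (there (here refl))) = subst (Edge (3 ℕ.+ j)) (sym (ℕP.+-comm (6 ℕ.+ j) 2)) pendant₃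
    ∈⇒Edge m | inj₂ (there (there (there (here refl)))) =
      subst₂ Edge (sym (trans (ℕP.+-identityʳ (6 ℕ.+ j ℕ.+ 2)) (ℕP.+-comm (6 ℕ.+ j) 2)))
        (sym (trans (ℕP.+-comm (6 ℕ.+ j ℕ.+ 2) 1) (cong suc (ℕP.+-comm (6 ℕ.+ j) 2)))) pendant₄

    Edge-≢ : ∀ {u v} → Edge u v → (u ≡ᵇ v) ≡ false
    Edge-≢ {u} {v} e with u ≡ᵇ v in p
    ... | false = refl
    ... | true with ℕP.≡ᵇ⇒≡ u v (subst T (sym p) tt)
    ...   | refl = ⊥-elim (irr e refl)
      where
      irr : ∀ {u v} → Edge u v → u ≢ v
      irr (path _)  ()
      irr pendant₁ ()
      irr pendant₂ ()
      irr pendant₃ ()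
      irr pendant₄ ()

  size : N ≡ 10 ℕ.+ j
  size = trans (ℕP.+-assoc (6 ℕ.+ j) 2 2) (ℕP.+-comm (6 ℕ.+ j) 4)

  -- `N` reduces to a sum other than `10 ℕ.+ j`. Reduction modulo `N` gives a total numbering
  -- without carrying bounds or transporting `Fin` along `size`.
  vtx : ℕ → Fin N
  vtx k = k mod N

  toℕ-vtx : ∀ {k} → k < 10 ℕ.+ j → toℕ (vtx k) ≡ k
  toℕ-vtx {k} k< = trans (FinP.toℕ-fromℕ< (m%n<n k N)) (m<n⇒m%n≡m (subst (k <_) (sym size) k<))

  vtx-toℕ : ∀ v → vtx (toℕ v) ≡ v
  vtx-toℕ v = FinP.toℕ-injective (toℕ-vtx (subst (toℕ v <_) size (FinP.toℕ<n v)))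

  adj-Edge : ∀ {u v} → u < 10 ℕ.+ j → v < 10 ℕ.+ j → Edge u v → adj G (vtx u) (vtx v) ≡ true
  adj-Edge {u} {v} u< v< e rewrite toℕ-vtx u< | toℕ-vtx v< | Edge-≢ e | hasEdge⁺ es (Edge⇒∈ e) = refl

  nonadj-Edge : ∀ {u v} → u < 10 ℕ.+ j → v < 10 ℕ.+ j → ¬ Edge u v → ¬ Edge v u → adj G (vtx u) (vtx v) ≡ false
  nonadj-Edge {u} {v} u< v< ¬e ¬e′ rewrite toℕ-vtx u< | toℕ-vtx v<
    with u ≡ᵇ v | hasEdge es u v in p | hasEdge es v u in q
  ... | true  | _     | _     = refl
  ... | false | true  | _     = ⊥-elim (¬e (∈⇒Edge (hasEdge⁻ es p)))
  ... | false | false | true  = ⊥-elim (¬e′ (∈⇒Edge (hasEdge⁻ es q)))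
  ... | false | false | false = refl

-- Φ as a function of the shapes alone.

phantom : Bool → List Shape
phantom true  = (just hubA , 0 , just hubB) ∷ []
phantom false = []

-- An edge between the hubs counts as a chain without vertices.
shapes : ∀ {n} {G : Graph n} → Decomposition G → List Shape
shapes {G = G} D = phantom (adj G (hub hubA) (hub hubB)) ++ map shape links
  where open Decomposition D

δ : Hub → Hub → ℤ
δ hubA hubA = 1ℤ
δ hubB hubB = 1ℤ
δ _    _    = 0ℤ

schur : ℤ → List Shape → Hub → Hub → ℤ
schur t ss h h′ = weight t ss * (δ h h′ * (1ℤ + t * t)) - hubSum t ss h h′

schurDet : ℤ → List Shape → ℤ
schurDet t ss = schur t ss hubA hubA * schur t ss hubB hubB - schur t ss hubA hubB * schur t ss hubB hubA

-- A link with no vertices has weight [1] = 1 and contributes only t off the diagonal, which is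
-- minus the entry of `K` between adjacent hubs. So an edge between the hubs can be moved from the
-- hub entries into the list of shapes.
shapes-formula : ∀ {n} {G : Graph n} (D : Decomposition G) τ →
                 weight (+ τ) (shapes D) * Φ G (+ τ) ≡ schurDet (+ τ) (shapes D)
shapes-formula {G = G} D τ with adj G (Decomposition.hub D hubA) (Decomposition.hub D hubB) in eq
... | true  = trans (cong (_* Φ G t) one*) (trans (hub-formula D τ)
  (cong₂ _-_ (cong₂ _*_ (diag hubA refl) (diag hubB refl))
             (cong₂ _*_ (off hubA hubB refl refl (K-adj G t hubA≢hubB eq))
                        (off hubB hubA refl refl (K-adj G t (λ e → hubA≢hubB (sym e)) (trans (adj-sym G (hub hubB) (hub hubA)) eq))))))
  where
  open Decomposition D
  t = + τ
  ss = map shape links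
  W = weight t ss
  one* : (1ℤ + t * t * 0ℤ) * W ≡ W
  one* = lemma t W
    where
    lemma : ∀ t w → (1ℤ + t * t * 0ℤ) * w ≡ w
    lemma = solve-∀
  diag : ∀ h → δ h h ≡ 1ℤ → hubEntry D τ h h ≡ schur t ((just hubA , 0 , just hubB) ∷ ss) h h
  diag h d = trans (cong (λ k → W * k + - hubSum t ss h h) (K-diag G t (hub h)))
    (trans (lemma t W (hubSum t ss h h) (ι (just hubA) h) (ι (just hubB) h) (ab h))
      (cong (λ x → (1ℤ + t * t * 0ℤ) * W * (x * (1ℤ + t * t)) - hubSum t ((just hubA , 0 , just hubB) ∷ ss) h h) (sym d)))
    where
    ab : ∀ h → ι (just hubA) h * ι (just hubB) h ≡ 0ℤ
    ab hubA = refl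
    ab hubB = refl
    lemma : ∀ t w s a b → a * b ≡ 0ℤ → w * (1ℤ + t * t) + - s ≡
      (1ℤ + t * t * 0ℤ) * w * (1ℤ * (1ℤ + t * t))
        - ((1ℤ + t * t * 0ℤ) * s + w * (t * t * 0ℤ * (a * a + b * b) + t * 1ℤ * (a * b + b * a)))
    lemma t w s a b ab = trans (lemma₁ t w s) (trans
      (cong₂ (λ x y → (1ℤ + t * t * 0ℤ) * w * (1ℤ * (1ℤ + t * t)) - ((1ℤ + t * t * 0ℤ) * s + w * (0ℤ + t * 1ℤ * (x + y))))
        (sym ab) (sym (trans (ℤP.*-comm b a) ab)))
      (lemma₂ t w s a b))
      where
      lemma₁ : ∀ t w s → w * (1ℤ + t * t) + - s ≡
        (1ℤ + t * t * 0ℤ) * w * (1ℤ * (1ℤ + t * t)) - ((1ℤ + t * t * 0ℤ) * s + w * (0ℤ + t * 1ℤ * (0ℤ + 0ℤ)))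
      lemma₁ = solve-∀
      lemma₂ : ∀ t w s a b →
        (1ℤ + t * t * 0ℤ) * w * (1ℤ * (1ℤ + t * t)) - ((1ℤ + t * t * 0ℤ) * s + w * (0ℤ + t * 1ℤ * (a * b + b * a))) ≡
        (1ℤ + t * t * 0ℤ) * w * (1ℤ * (1ℤ + t * t))
          - ((1ℤ + t * t * 0ℤ) * s + w * (t * t * 0ℤ * (a * a + b * b) + t * 1ℤ * (a * b + b * a)))
      lemma₂ = solve-∀
  off : ∀ h h′ → δ h h′ ≡ 0ℤ → ι (just hubA) h * ι (just hubB) h′ + ι (just hubB) h * ι (just hubA) h′ ≡ 1ℤ →
        K G t (hub h) (hub h′) ≡ - t → hubEntry D τ h h′ ≡ schur t ((just hubA , 0 , just hubB) ∷ ss) h h′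
  off h h′ d i k = trans (cong (λ k → W * k + - hubSum t ss h h′) k)
    (trans (lemma t W (hubSum t ss h h′) (ι (just hubA) h * ι (just hubA) h′ + ι (just hubB) h * ι (just hubB) h′))
      (cong₂ (λ x y → (1ℤ + t * t * 0ℤ) * W * (x * (1ℤ + t * t)) -
        ((1ℤ + t * t * 0ℤ) * hubSum t ss h h′ +
          W * (t * t * 0ℤ * (ι (just hubA) h * ι (just hubA) h′ + ι (just hubB) h * ι (just hubB) h′) + t * 1ℤ * y)))
        (sym d) (sym i)))
    where
    lemma : ∀ t w s p → w * - t + - s ≡ (1ℤ + t * t * 0ℤ) * w * (0ℤ * (1ℤ + t * t)) -
      ((1ℤ + t * t * 0ℤ) * s + w * (t * t * 0ℤ * p + t * 1ℤ * 1ℤ))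
    lemma = solve-∀
... | false = trans (hub-formula D τ)
  (cong₂ _-_ (cong₂ _*_ (diag hubA refl) (diag hubB refl))
             (cong₂ _*_ (off hubA hubB refl (K-nonadj G t hubA≢hubB eq))
                        (off hubB hubA refl (K-nonadj G t (λ e → hubA≢hubB (sym e)) (trans (adj-sym G (hub hubB) (hub hubA)) eq)))))
  where
  open Decomposition D
  t = + τ
  ss = map shape links
  W = weight t ss
  diag : ∀ h → δ h h ≡ 1ℤ → hubEntry D τ h h ≡ schur t ss h h
  diag h d = cong (λ k → W * k + - hubSum t ss h h) (trans (K-diag G t (hub h))
    (trans (sym (ℤP.*-identityˡ (1ℤ + t * t))) (cong (_* (1ℤ + t * t)) (sym d))))
  off : ∀ h h′ → δ h h′ ≡ 0ℤ → K G t (hub h) (hub h′) ≡ 0ℤ → hubEntry D τ h h′ ≡ schur t ss h h′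
  off h h′ d k = cong (λ k → W * k + - hubSum t ss h h′) (trans k (cong (_* (1ℤ + t * t)) (sym d)))

-- The tree decomposed at its two branch vertices.

range : ℕ → ℕ → List ℕ
range i zero    = []
range i (suc m) = i ∷ range (suc i) m

range-++ : ∀ i m n → range i (m ℕ.+ n) ≡ range i m ++ range (m ℕ.+ i) n
range-++ i zero    n = refl
range-++ i (suc m) n = cong (i ∷_) (trans (range-++ (suc i) m n) (cong (λ k → range (suc i) m ++ range k n) (ℕP.+-suc m i)))

map-range : ∀ {A : Set} (f : ℕ → A) i n → map f (range i n) ≡ tabulate {n = n} (λ k → f (toℕ k ℕ.+ i))
map-range f i zero    = refl
map-range f i (suc n) = cong (f i ∷_) (trans (map-range f (suc i) n)
  (ListP.tabulate-cong (λ k → cong f (ℕP.+-suc (toℕ k) i))))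

length-range : ∀ i n → length (range i n) ≡ n
length-range i zero    = refl
length-range i (suc n) = cong suc (length-range (suc i) n)

pathShapes : ℕ → List Shape
pathShapes j = (just hubA , j , just hubB) ∷ (just hubA , 2 , nothing) ∷ (just hubA , 2 , nothing) ∷
               (just hubB , 2 , nothing) ∷ (just hubB , 2 , nothing) ∷ []

-- The graph enters only through its numbering and adjacency rules, so that it stays opaque and its
-- edge list is never unfolded in what is derived from the decomposition.
module PathDecomposition
  (j : ℕ) {N : ℕ} (size : N ≡ 10 ℕ.+ j) (G : Graph N) (vtx : ℕ → Fin N)
  (toℕ-vtx : ∀ {k} → k < 10 ℕ.+ j → toℕ (vtx k) ≡ k) (vtx-toℕ : ∀ v → vtx (toℕ v) ≡ v)
  (adj-Edge : ∀ {u v} → u < 10 ℕ.+ j → v < 10 ℕ.+ j → Numbering.Edge j u v → adj G (vtx u) (vtx v) ≡ true)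
  (nonadj-Edge : ∀ {u v} → u < 10 ℕ.+ j → v < 10 ℕ.+ j → ¬ Numbering.Edge j u v → ¬ Numbering.Edge j v u → adj G (vtx u) (vtx v) ≡ false)
  where
  open Numbering j


  private
    hub : Hub → Fin N
    hub hubA = vtx 2
    hub hubB = vtx (3 ℕ.+ j)

    <N : ∀ {k} → k ≤ 9 → k ℕ.+ j < 10 ℕ.+ j
    <N p = s≤s (ℕP.+-monoˡ-≤ j p)

    low : ∀ {k} → k < 10 → k < 10 ℕ.+ j
    low p = ℕP.<-≤-trans p (ℕP.m≤m+n 10 j)

    In-< : ∀ {k u} → In k u → u < 10 ℕ.+ j
    In-< v₀         = s≤s z≤n
    In-< v₁         = s≤s (s≤s z≤n)
    In-< (middle q) = ℕP.<-trans (ℕP.+-monoʳ-< 3 q) (<N (s≤s (s≤s (s≤s z≤n))))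
    In-< v₄         = <N (ℕP.m≤m+n 4 5)
    In-< v₅         = <N (ℕP.m≤m+n 5 4)
    In-< v₆         = <N (ℕP.m≤m+n 6 3)
    In-< v₇         = <N (ℕP.m≤m+n 7 2)
    In-< v₈         = <N (ℕP.m≤m+n 8 1)
    In-< v₉         = <N (ℕP.m≤m+n 9 0)

    hubℕ : Hub → ℕ
    hubℕ hubA = 2
    hubℕ hubB = 3 ℕ.+ j

    hub-vtx : ∀ h → hub h ≡ vtx (hubℕ h)
    hub-vtx hubA = refl
    hub-vtx hubB = refl

    hub-< : ∀ h → hubℕ h < 10 ℕ.+ j
    hub-< hubA = s≤s (s≤s (s≤s z≤n))
    hub-< hubB = <N (ℕP.m≤m+n 3 6)

    vtx-inj : ∀ {u v} → u < 10 ℕ.+ j → v < 10 ℕ.+ j → vtx u ≡ vtx v → u ≡ v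
    vtx-inj u< v< e = trans (sym (toℕ-vtx u<)) (trans (cong toℕ e) (toℕ-vtx v<))

    In-Apart : ∀ {k l u v} → In k u → In l v → k ≢ l → Apart G (vtx u) (vtx v)
    In-Apart i i′ k≢l = (λ e → k≢l (In-unique (subst (In _) (vtx-inj (In-< i) (In-< i′) e) i) i′)) ,
      nonadj-Edge (In-< i) (In-< i′) (λ e → k≢l (edge-In e i i′)) (λ e → k≢l (sym (edge-In e i′ i)))

    attached : ∀ {k u} h → In k u → Edge u (hubℕ h) ⊎ Edge (hubℕ h) u → A G (vtx u) (hub h) ≡ 1ℤ
    attached h i (inj₁ e) rewrite hub-vtx h = cong edge (adj-Edge (In-< i) (hub-< h) e)
    attached h i (inj₂ e) rewrite hub-vtx h =
      cong edge (trans (adj-sym G (vtx _) (vtx (hubℕ h))) (adj-Edge (hub-< h) (In-< i) e))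

    free : ∀ {k u} h → In k u → ¬ Edge u (hubℕ h) → ¬ Edge (hubℕ h) u → A G (vtx u) (hub h) ≡ 0ℤ
    free h i ¬e ¬e′ rewrite hub-vtx h = cong edge (nonadj-Edge (In-< i) (hub-< h) ¬e ¬e′)

    <5+j : ∀ {k} → k ≤ 4 → k ℕ.+ j < 5 ℕ.+ j
    <5+j p = s≤s (ℕP.+-monoˡ-≤ j p)

    leg₁ : Chain G hub (just hubA) (vtx 1 ∷ vtx 0 ∷ []) nothing
    leg₁ = cons (λ { hubA → attached hubA v₁ (inj₁ (path (s≤s (s≤s z≤n))))
                   ; hubB → free hubB v₁ (λ ()) (λ ()) })
                (trans (adj-sym G (vtx 1) (vtx 0)) (adj-Edge (In-< v₀) (In-< v₁) (path (s≤s z≤n)))) []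
                (one (λ { hubA → free hubA v₀ (λ ()) (λ ()) ; hubB → free hubB v₀ (λ ()) (λ ()) }))

    leg₂ : Chain G hub (just hubA) (vtx (6 ℕ.+ j) ∷ vtx (7 ℕ.+ j) ∷ []) nothing
    leg₂ = cons (λ { hubA → attached hubA v₆ (inj₂ pendant₁) ; hubB → free hubB v₆ (λ ()) (λ ()) })
                (adj-Edge (In-< v₆) (In-< v₇) pendant₂) []
                (one (λ { hubA → free hubA v₇ (λ ()) (λ ()) ; hubB → free hubB v₇ (λ ()) (λ ()) }))

    leg₃ : Chain G hub (just hubB) (vtx (4 ℕ.+ j) ∷ vtx (5 ℕ.+ j) ∷ []) nothing
    leg₃ = cons (λ { hubA → free hubA v₄ (λ ()) (λ ()) ; hubB → attached hubB v₄ (inj₂ (path (<5+j (ℕP.m≤m+n 3 1)))) })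
                (adj-Edge (In-< v₄) (In-< v₅) (path (<5+j ℕP.≤-refl))) []
                (one (λ { hubA → free hubA v₅ (λ ()) (λ ()) ; hubB → free hubB v₅ (λ ()) (λ ()) }))

    leg₄ : Chain G hub (just hubB) (vtx (8 ℕ.+ j) ∷ vtx (9 ℕ.+ j) ∷ []) nothing
    leg₄ = cons (λ { hubA → free hubA v₈ (λ ()) (λ ()) ; hubB → attached hubB v₈ (inj₂ pendant₃) })
                (adj-Edge (In-< v₈) (In-< v₉) pendant₄) []
                (one (λ { hubA → free hubA v₉ (λ ()) (λ ()) ; hubB → free hubB v₉ (λ ()) (λ ()) }))

    start : ℕ → End
    start zero    = just hubA
    start (suc _) = nothing

    edge-middle : ∀ {i i′} → i < j → i′ ≤ j → Edge (3 ℕ.+ i) (3 ℕ.+ i′) → i′ ≡ suc i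
    edge-middle i< i′< (path _)  = refl
    edge-middle i< i′< pendant₂ = ⊥-elim (ℕP.<⇒≱ i< (ℕP.m≤n+m j 3))
    edge-middle i< i′< pendant₃ = ⊥-elim (ℕP.<-irrefl refl i<)
    edge-middle i< i′< pendant₄ = ⊥-elim (ℕP.<⇒≱ i< (ℕP.m≤n+m j 5))

    edge-middle′ : ∀ {i i′} → i ≤ j → i′ < j → Edge (3 ℕ.+ i) (3 ℕ.+ i′) → i′ ≡ suc i
    edge-middle′ i< i′< (path _)  = refl
    edge-middle′ i< i′< pendant₂ = ⊥-elim (ℕP.<⇒≱ i′< (ℕP.m≤n+m j 4))
    edge-middle′ i< i′< pendant₃ = ⊥-elim (ℕP.<⇒≱ i′< (ℕP.m≤n+m j 5))
    edge-middle′ i< i′< pendant₄ = ⊥-elim (ℕP.<⇒≱ i′< (ℕP.m≤n+m j 6))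

    middle-A : ∀ {i} → i < j → A G (vtx (3 ℕ.+ i)) (hub hubA) ≡ ι (start i) hubA
    middle-A {zero}  q = attached hubA (middle q) (inj₂ (path (s≤s (s≤s (s≤s z≤n)))))
    middle-A {suc i} q = free hubA (middle q) (λ ()) (λ { pendant₁ → ℕP.<⇒≱ q (ℕP.m≤n+m j 3) })

    start-B : ∀ i → ι (start i) hubB ≡ 0ℤ
    start-B zero    = refl
    start-B (suc _) = refl

    range-In : ∀ m i → m ℕ.+ i ≤ j → ∀ {v} → v ∈ map vtx (range (3 ℕ.+ i) m) → ∃ λ i′ → v ≡ vtx (3 ℕ.+ i′) × i ≤ i′ × i′ < j
    range-In (suc m) i p (here refl) = i , refl , ℕP.≤-refl , ℕP.≤-trans (s≤s (ℕP.m≤n+m i m)) p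
    range-In (suc m) i p (there w) with range-In m (suc i) (subst (_≤ j) (sym (ℕP.+-suc m i)) p) w
    ... | i′ , e , q , r = i′ , e , ℕP.<⇒≤ q , r

    -- Here `i` middle vertices have been passed and `suc m` remain; the label of the first hub is
    -- present only for i = 0, hence `start`.
    middle-chain : ∀ m i → suc m ℕ.+ i ≡ j → Chain G hub (start i) (map vtx (range (3 ℕ.+ i) (suc m))) (just hubB)
    middle-chain zero    i refl = one (λ
      { hubA → trans (middle-A ℕP.≤-refl) (sym (ℤP.+-identityʳ (ι (start i) hubA)))
      ; hubB → trans (attached hubB (middle ℕP.≤-refl) (inj₁ (path (ℕP.m≤n+m (4 ℕ.+ i) 2))))
                     (cong (_+ 1ℤ) (sym (start-B i))) })
    middle-chain (suc m) i refl = cons (λ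
      { hubA → middle-A i<
      ; hubB → trans (free hubB (middle i<)
          (λ e → ℕP.m≢1+n+m i (sym (ℕP.suc-injective (edge-middle i< ℕP.≤-refl e))))
          (λ e → ℕP.<⇒≱ i< (subst (j ≤_) (sym (edge-middle′ ℕP.≤-refl i< e)) (ℕP.n≤1+n j)))) (sym (start-B i)) })
      (adj-Edge (In-< (middle i<)) (In-< (middle i<′)) (path (ℕP.≤-trans (ℕP.+-monoʳ-≤ 3 i<) (ℕP.m≤n+m (3 ℕ.+ j) 2))))
      (All.tabulate far)
      (middle-chain m (suc i) (ℕP.+-suc (suc m) i))
      where
      i< : i < j
      i< = s≤s (ℕP.m≤n+m i (suc m))
      i<′ : suc i < j
      i<′ = s≤s (s≤s (ℕP.m≤n+m i m))
      far : ∀ {v} → v ∈ map vtx (range (5 ℕ.+ i) m) → Apart G (vtx (3 ℕ.+ i)) v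
      far w with range-In m (2 ℕ.+ i) (ℕP.≤-reflexive (trans (ℕP.+-suc m (suc i)) (cong suc (ℕP.+-suc m i)))) w
      ... | i′ , refl , q , r =
        (λ e → ℕP.<⇒≱ q (ℕP.≤-trans (ℕP.≤-reflexive (sym (ℕP.+-cancelˡ-≡ 3 i i′
          (vtx-inj (In-< (middle i<)) (In-< (middle r)) e)))) (ℕP.n≤1+n i))) ,
        nonadj-Edge (In-< (middle i<)) (In-< (middle r))
          (λ e → ℕP.<-irrefl (sym (edge-middle i< (ℕP.<⇒≤ r) e)) q)
          (λ e → ℕP.<⇒≱ q (ℕP.≤-trans (ℕP.≤-trans (ℕP.n≤1+n i′) (ℕP.≤-reflexive (sym (edge-middle r (ℕP.<⇒≤ i<) e)))) (ℕP.n≤1+n i)))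

    -- For j = 0 the branch vertices are adjacent and no chain lies between them. The equation k ≡ j
    -- allows this case distinction while `j` stays a module parameter.
    middleLinks : ∀ k → k ≡ j → List (Link G hub)
    middleLinks zero    _ = []
    middleLinks (suc m) e = record { chain = middle-chain m 0 (trans (ℕP.+-identityʳ (suc m)) e) } ∷ []

    legs : List (Link G hub)
    legs = record { chain = leg₁ } ∷ record { chain = leg₂ } ∷ record { chain = leg₃ } ∷ record { chain = leg₄ } ∷ []

    middle-vertices : ∀ k (e : k ≡ j) → linkVertices (middleLinks k e) ≡ map vtx (range 3 k)
    middle-vertices zero    e = refl
    middle-vertices (suc m) e = ListP.++-identityʳ (map vtx (range 3 (suc m)))

    links : List (Link G hub)
    links = middleLinks j refl ++ legs

    vertices-links : linkVertices links ≡ map vtx (range 3 j) ++ linkVertices legs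
    vertices-links = trans (cong concat (ListP.map-++ Link.vertices (middleLinks j refl) legs))
      (trans (sym (ListP.concat-++ (map Link.vertices (middleLinks j refl)) (map Link.vertices legs)))
        (cong (_++ linkVertices legs) (middle-vertices j refl)))

    data Labelled (k : ℕ) : Fin N → Set where
      label : ∀ {u} → In k u → Labelled k (vtx u)

    Labelled-Apart : ∀ {k l u v} → k ≢ l → Labelled k u → Labelled l v → Apart G u v
    Labelled-Apart k≢l (label i) (label i′) = In-Apart i i′ k≢l

    all-middle : ∀ {v} → v ∈ map vtx (range 3 j) → Labelled 0 v
    all-middle m with range-In j 0 (ℕP.≤-reflexive (ℕP.+-identityʳ j)) m
    ... | i , refl , _ , i<j = label (middle i<j)

    all₁ : All (Labelled 1) (vtx 1 ∷ vtx 0 ∷ [])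
    all₁ = label v₁ ∷ label v₀ ∷ []
    all₂ : All (Labelled 2) (vtx (6 ℕ.+ j) ∷ vtx (7 ℕ.+ j) ∷ [])
    all₂ = label v₆ ∷ label v₇ ∷ []
    all₃ : All (Labelled 3) (vtx (4 ℕ.+ j) ∷ vtx (5 ℕ.+ j) ∷ [])
    all₃ = label v₄ ∷ label v₅ ∷ []
    all₄ : All (Labelled 4) (vtx (8 ℕ.+ j) ∷ vtx (9 ℕ.+ j) ∷ [])
    all₄ = label v₈ ∷ label v₉ ∷ []

    separated : ∀ {k l us vs} → k ≢ l → All (Labelled k) us → All (Labelled l) vs →
                ∀ {u v} → u ∈ us → v ∈ vs → Apart G u v
    separated k≢l as bs u∈ v∈ = Labelled-Apart k≢l (All.lookup as u∈) (All.lookup bs v∈)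

    separate-legs : AllPairs Separate legs
    separate-legs = (separated (λ ()) all₁ all₂ ∷ separated (λ ()) all₁ all₃ ∷ separated (λ ()) all₁ all₄ ∷ []) ∷
                    (separated (λ ()) all₂ all₃ ∷ separated (λ ()) all₂ all₄ ∷ []) ∷
                    (separated (λ ()) all₃ all₄ ∷ []) ∷ [] ∷ []

    separate-middle : ∀ k (e : k ≡ j) → AllPairs Separate (middleLinks k e ++ legs)
    separate-middle zero    e    = separate-legs
    separate-middle (suc m) refl = (sep all₁ ∷ sep all₂ ∷ sep all₃ ∷ sep all₄ ∷ []) ∷ separate-legs
      where
      sep : ∀ {k vs} → All (Labelled (suc k)) vs → ∀ {u v} → u ∈ map vtx (range 3 (suc m)) → v ∈ vs → Apart G u v
      sep bs u∈ v∈ = Labelled-Apart (λ ()) (all-middle u∈) (All.lookup bs v∈)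

    all-labelled : ∀ {v} → v ∈ linkVertices links → ∃ λ k → Labelled k v
    all-labelled m with ∈-++⁻ (map vtx (range 3 j)) (subst (_ ∈_) vertices-links m)
    ... | inj₁ m′ = 0 , all-middle m′
    ... | inj₂ m′ with ∈-++⁻ (vtx 1 ∷ vtx 0 ∷ []) m′
    ...   | inj₁ m₁ = 1 , All.lookup all₁ m₁
    ...   | inj₂ m″ with ∈-++⁻ (vtx (6 ℕ.+ j) ∷ vtx (7 ℕ.+ j) ∷ []) m″
    ...     | inj₁ m₂ = 2 , All.lookup all₂ m₂
    ...     | inj₂ m‴ with ∈-++⁻ (vtx (4 ℕ.+ j) ∷ vtx (5 ℕ.+ j) ∷ []) m‴
    ...       | inj₁ m₃ = 3 , All.lookup all₃ m₃
    ...       | inj₂ m₄ = 4 , All.lookup all₄ m₄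

    hub-not-In : ∀ h {k} → ¬ In k (hubℕ h)
    hub-not-In hubA = In-≢2
    hub-not-In hubB = In-≢3+j

    off : ∀ h {v} → v ∈ linkVertices links → v ≢ hub h
    off h m e with all-labelled m
    ... | k , label i = hub-not-In h
      (subst (In k) (vtx-inj (In-< i) (hub-< h) (trans e (hub-vtx h))) i)

    enumeration : allFin N ≡ map vtx (range 0 N)
    enumeration = sym (trans (map-range vtx 0 N)
      (ListP.tabulate-cong (λ k → trans (cong vtx (ℕP.+-identityʳ (toℕ k))) (vtx-toℕ k))))

    sorted : range 0 N ≡ 0 ∷ 1 ∷ 2 ∷ range 3 j ++ range (3 ℕ.+ j) 7
    sorted = trans (cong (range 0) (trans size (cong (3 ℕ.+_) (ℕP.+-comm 7 j))))
      (cong (λ l → 0 ∷ 1 ∷ 2 ∷ l) (trans (range-++ 3 j 7) (cong (λ k → range 3 j ++ range k 7) (ℕP.+-comm j 3))))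

    rearrange : {V : Set} (X : List V) (a₀ a₁ a₂ a₃ a₄ a₅ a₆ a₇ a₈ a₉ : V) →
                a₂ ∷ a₃ ∷ X ++ a₁ ∷ a₀ ∷ a₆ ∷ a₇ ∷ a₄ ∷ a₅ ∷ a₈ ∷ a₉ ∷ [] ↭
                a₀ ∷ a₁ ∷ a₂ ∷ X ++ a₃ ∷ a₄ ∷ a₅ ∷ a₆ ∷ a₇ ∷ a₈ ∷ a₉ ∷ []
    rearrange X a₀ a₁ a₂ a₃ a₄ a₅ a₆ a₇ a₈ a₉ = begin
      a₂ ∷ a₃ ∷ X ++ a₁ ∷ a₀ ∷ R      ↭⟨ prep a₂ (prep a₃ (PermP.shift a₁ X (a₀ ∷ R))) ⟩
      a₂ ∷ a₃ ∷ a₁ ∷ X ++ a₀ ∷ R      ↭⟨ prep a₂ (prep a₃ (prep a₁ (PermP.shift a₀ X R))) ⟩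
      a₂ ∷ a₃ ∷ a₁ ∷ a₀ ∷ X ++ R      ↭⟨ PermP.shift a₀ (a₂ ∷ a₃ ∷ a₁ ∷ []) (X ++ R) ⟩
      a₀ ∷ a₂ ∷ a₃ ∷ a₁ ∷ X ++ R      ↭⟨ prep a₀ (PermP.shift a₁ (a₂ ∷ a₃ ∷ []) (X ++ R)) ⟩
      a₀ ∷ a₁ ∷ a₂ ∷ a₃ ∷ X ++ R      ↭⟨ prep a₀ (prep a₁ (prep a₂ (Perm.↭-sym (PermP.shift a₃ X R)))) ⟩
      a₀ ∷ a₁ ∷ a₂ ∷ X ++ a₃ ∷ R      ↭⟨ PermP.++⁺ˡ (a₀ ∷ a₁ ∷ a₂ ∷ X) (prep a₃
        (PermP.shifts (a₆ ∷ a₇ ∷ []) (a₄ ∷ a₅ ∷ []))) ⟩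
      a₀ ∷ a₁ ∷ a₂ ∷ X ++ a₃ ∷ a₄ ∷ a₅ ∷ a₆ ∷ a₇ ∷ a₈ ∷ a₉ ∷ [] ∎
      where
      open Perm using (prep)
      open Perm.PermutationReasoning
      R = a₆ ∷ a₇ ∷ a₄ ∷ a₅ ∷ a₈ ∷ a₉ ∷ []

    covering : hub hubA ∷ hub hubB ∷ linkVertices links ↭ allFin N
    covering = Perm.↭-trans (Perm.↭-reflexive (cong (λ l → vtx 2 ∷ vtx (3 ℕ.+ j) ∷ l) vertices-links))
      (Perm.↭-trans
        (rearrange (map vtx (range 3 j)) (vtx 0) (vtx 1) (vtx 2) (vtx (3 ℕ.+ j)) (vtx (4 ℕ.+ j))
          (vtx (5 ℕ.+ j)) (vtx (6 ℕ.+ j)) (vtx (7 ℕ.+ j)) (vtx (8 ℕ.+ j)) (vtx (9 ℕ.+ j)))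
        (Perm.↭-reflexive (sym (trans enumeration (trans (cong (map vtx) sorted)
          (cong (λ l → vtx 0 ∷ vtx 1 ∷ vtx 2 ∷ l) (ListP.map-++ vtx (range 3 j) (range (3 ℕ.+ j) 7))))))))

  decomposition : Decomposition G
  decomposition = record
    { hub       = hub
    ; links     = links
    ; hubA≢hubB = λ e → hubs≢ (vtx-inj (hub-< hubA) (hub-< hubB) e)
    ; separate  = separate-middle j refl
    ; off-hub   = off
    ; cover     = covering
    }
    where
    hubs≢ : 2 ≢ 3 ℕ.+ j
    hubs≢ ()

  far-hubs : j ≢ 0 → adj G (vtx 2) (vtx (3 ℕ.+ j)) ≡ false
  far-hubs j≢0 = nonadj-Edge (hub-< hubA) (hub-< hubB) (λ { (path _) → j≢0 refl }) (λ ())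

  near-hubs : j ≡ 0 → adj G (vtx 2) (vtx (3 ℕ.+ j)) ≡ true
  near-hubs refl = adj-Edge (hub-< hubA) (hub-< hubB) (path (s≤s (s≤s (s≤s z≤n))))

  -- The shape between the hubs comes from `phantom` if j = 0 and from the middle chain otherwise.
  shapes-path : shapes decomposition ≡ pathShapes j
  shapes-path = helper j refl
    where
    helper : ∀ k (e : k ≡ j) → phantom (adj G (vtx 2) (vtx (3 ℕ.+ j))) ++ map shape (middleLinks k e ++ legs) ≡
             (just hubA , k , just hubB) ∷ map shape legs
    helper zero    e = cong (λ b → phantom b ++ map shape legs) (near-hubs (sym e))
    helper (suc m) e = trans
      (cong (λ b → phantom b ++ map shape (middleLinks (suc m) e ++ legs)) (far-hubs (λ j≡0 → case (trans e j≡0))))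
      (cong (λ k → (just hubA , k , just hubB) ∷ map shape legs)
        (trans (ListP.length-map vtx (range 3 (suc m))) (length-range 3 (suc m))))
      where
      case : suc m ≡ 0 → ⊥
      case ()

-- The closed form of Φ for the tree.

bracket-geometric : ∀ t L → (1ℤ - t * t) * bracket t L ≡ 1ℤ - t ^ L * t ^ L
bracket-geometric t zero    = lemma t
  where
  lemma : ∀ t → (1ℤ - t * t) * 0ℤ ≡ 1ℤ - 1ℤ * 1ℤ
  lemma = solve-∀
bracket-geometric t (suc L) = begin
  (1ℤ - t * t) * (1ℤ + t * t * bracket t L)              ≡⟨ lemma t (bracket t L) ⟩
  1ℤ - t * t + t * t * ((1ℤ - t * t) * bracket t L)      ≡⟨ cong (λ x → 1ℤ - t * t + t * t * x) (bracket-geometric t L) ⟩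
  1ℤ - t * t + t * t * (1ℤ - t ^ L * t ^ L)              ≡⟨ lemma′ t (t ^ L) ⟩
  1ℤ - t * t ^ L * (t * t ^ L)                           ∎
  where
  open ≡-Reasoning
  lemma : ∀ t b → (1ℤ - t * t) * (1ℤ + t * t * b) ≡ 1ℤ - t * t + t * t * ((1ℤ - t * t) * b)
  lemma = solve-∀
  lemma′ : ∀ t p → 1ℤ - t * t + t * t * (1ℤ - p * p) ≡ 1ℤ - t * p * (t * p)
  lemma′ = solve-∀

-- The palindromic factor of H₍₁₀₊ⱼ₎: with p = tʲ⁺¹ one has (1 − t²) Φ = reduced.
reduced : ℤ → ℤ → ℤ
reduced t p = c * c * (a * a - p * p * (b * b))
  where
  q = t * t
  c = 1ℤ + q + q * q
  a = 1ℤ - q - q * q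
  b = q * (1ℤ + q - q * q)

private
  -- The left-hand sides of this and the next three identities are the entries of
  -- `schur t (pathShapes j)` unfolded, with b, x, y for the brackets [j], [3], [2] and p for the
  -- power of t with exponent j + 1. Independent variables make them polynomial identities.
  path-schurAA : ∀ t b p x y →
    ((1ℤ + t * t * b) * (x * (x * (x * (x * (1ℤ)))))) * (1ℤ * (1ℤ + t * t)) - ((1ℤ + t * t * b) * (x * (x *
      (x * (x * (0ℤ) + (1ℤ) * (t * t * y * (0ℤ * 0ℤ + 0ℤ * 0ℤ) + (t * (t * (t * 1ℤ))) * (0ℤ * 0ℤ + 0ℤ *
      0ℤ))) + (x * (1ℤ)) * (t * t * y * (0ℤ * 0ℤ + 0ℤ * 0ℤ) + (t * (t * (t * 1ℤ))) * (0ℤ * 0ℤ + 0ℤ * 0ℤ))) +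
      (x * (x * (1ℤ))) * (t * t * y * (1ℤ * 1ℤ + 0ℤ * 0ℤ) + (t * (t * (t * 1ℤ))) * (1ℤ * 0ℤ + 0ℤ * 1ℤ))) +
      (x * (x * (x * (1ℤ)))) * (t * t * y * (1ℤ * 1ℤ + 0ℤ * 0ℤ) + (t * (t * (t * 1ℤ))) * (1ℤ * 0ℤ + 0ℤ *
      1ℤ))) + (x * (x * (x * (x * (1ℤ))))) * (t * t * b * (1ℤ * 1ℤ + 0ℤ * 0ℤ) + p * (1ℤ * 0ℤ + 0ℤ * 1ℤ))) ≡
    x * x * x * (x * ((1ℤ + t * t * b) * (1ℤ + t * t) - t * t * b) - (+ 2) * (1ℤ + t * t * b) * (t * t) * y)
  path-schurAA = solve-∀

  path-schurBB : ∀ t b p x y →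
    ((1ℤ + t * t * b) * (x * (x * (x * (x * (1ℤ)))))) * (1ℤ * (1ℤ + t * t)) - ((1ℤ + t * t * b) * (x * (x *
      (x * (x * (0ℤ) + (1ℤ) * (t * t * y * (1ℤ * 1ℤ + 0ℤ * 0ℤ) + (t * (t * (t * 1ℤ))) * (1ℤ * 0ℤ + 0ℤ *
      1ℤ))) + (x * (1ℤ)) * (t * t * y * (1ℤ * 1ℤ + 0ℤ * 0ℤ) + (t * (t * (t * 1ℤ))) * (1ℤ * 0ℤ + 0ℤ * 1ℤ))) +
      (x * (x * (1ℤ))) * (t * t * y * (0ℤ * 0ℤ + 0ℤ * 0ℤ) + (t * (t * (t * 1ℤ))) * (0ℤ * 0ℤ + 0ℤ * 0ℤ))) +
      (x * (x * (x * (1ℤ)))) * (t * t * y * (0ℤ * 0ℤ + 0ℤ * 0ℤ) + (t * (t * (t * 1ℤ))) * (0ℤ * 0ℤ + 0ℤ *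
      0ℤ))) + (x * (x * (x * (x * (1ℤ))))) * (t * t * b * (0ℤ * 0ℤ + 1ℤ * 1ℤ) + p * (0ℤ * 1ℤ + 1ℤ * 0ℤ))) ≡
    x * x * x * (x * ((1ℤ + t * t * b) * (1ℤ + t * t) - t * t * b) - (+ 2) * (1ℤ + t * t * b) * (t * t) * y)
  path-schurBB = solve-∀

  path-schurAB : ∀ t b p x y →
    ((1ℤ + t * t * b) * (x * (x * (x * (x * (1ℤ)))))) * (0ℤ * (1ℤ + t * t)) - ((1ℤ + t * t * b) * (x * (x *
      (x * (x * (0ℤ) + (1ℤ) * (t * t * y * (0ℤ * 1ℤ + 0ℤ * 0ℤ) + (t * (t * (t * 1ℤ))) * (0ℤ * 0ℤ + 0ℤ *
      1ℤ))) + (x * (1ℤ)) * (t * t * y * (0ℤ * 1ℤ + 0ℤ * 0ℤ) + (t * (t * (t * 1ℤ))) * (0ℤ * 0ℤ + 0ℤ * 1ℤ))) +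
      (x * (x * (1ℤ))) * (t * t * y * (1ℤ * 0ℤ + 0ℤ * 0ℤ) + (t * (t * (t * 1ℤ))) * (1ℤ * 0ℤ + 0ℤ * 0ℤ))) +
      (x * (x * (x * (1ℤ)))) * (t * t * y * (1ℤ * 0ℤ + 0ℤ * 0ℤ) + (t * (t * (t * 1ℤ))) * (1ℤ * 0ℤ + 0ℤ *
      0ℤ))) + (x * (x * (x * (x * (1ℤ))))) * (t * t * b * (1ℤ * 0ℤ + 0ℤ * 1ℤ) + p * (1ℤ * 1ℤ + 0ℤ * 0ℤ))) ≡
    - (x * x * x * x * p)
  path-schurAB = solve-∀

  path-schurBA : ∀ t b p x y →
    ((1ℤ + t * t * b) * (x * (x * (x * (x * (1ℤ)))))) * (0ℤ * (1ℤ + t * t)) - ((1ℤ + t * t * b) * (x * (x *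
      (x * (x * (0ℤ) + (1ℤ) * (t * t * y * (1ℤ * 0ℤ + 0ℤ * 0ℤ) + (t * (t * (t * 1ℤ))) * (1ℤ * 0ℤ + 0ℤ *
      0ℤ))) + (x * (1ℤ)) * (t * t * y * (1ℤ * 0ℤ + 0ℤ * 0ℤ) + (t * (t * (t * 1ℤ))) * (1ℤ * 0ℤ + 0ℤ * 0ℤ))) +
      (x * (x * (1ℤ))) * (t * t * y * (0ℤ * 1ℤ + 0ℤ * 0ℤ) + (t * (t * (t * 1ℤ))) * (0ℤ * 0ℤ + 0ℤ * 1ℤ))) +
      (x * (x * (x * (1ℤ)))) * (t * t * y * (0ℤ * 1ℤ + 0ℤ * 0ℤ) + (t * (t * (t * 1ℤ))) * (0ℤ * 0ℤ + 0ℤ *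
      1ℤ))) + (x * (x * (x * (x * (1ℤ))))) * (t * t * b * (0ℤ * 1ℤ + 1ℤ * 0ℤ) + p * (0ℤ * 0ℤ + 1ℤ * 1ℤ))) ≡
    - (x * x * x * x * p)
  path-schurBA = solve-∀


module _ (t : ℤ) (j : ℕ) where
  private
    q = t * t
    b = bracket t j
    B = bracket t (suc j)
    p = t ^ suc j
    x = bracket t 3
    y = bracket t 2
    V = x * (B * (1ℤ + q) - q * b) - (+ 2) * B * q * y

  schurDet-path : schurDet t (pathShapes j) ≡ x * x * x * x * (x * x * (V * V - x * x * (p * p)))
  schurDet-path = trans
    (cong₂ _-_ (cong₂ _*_ (path-schurAA t b p x y) (path-schurBB t b p x y))
               (cong₂ _*_ (path-schurAB t b p x y) (path-schurBA t b p x y)))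
    (lemma V x p)
    where
    lemma : ∀ V x p → x * x * x * V * (x * x * x * V) - - (x * x * x * x * p) * - (x * x * x * x * p) ≡
            x * x * x * x * (x * x * (V * V - x * x * (p * p)))
    lemma = solve-∀

  weight-path : weight t (pathShapes j) ≡ x * x * x * x * B
  weight-path = lemma B x
    where
    lemma : ∀ B x → B * (x * (x * (x * (x * 1ℤ)))) ≡ x * x * x * x * B
    lemma = solve-∀

  V≡ : V ≡ 1ℤ + q + q * q - B * (q * (1ℤ + q - q * q))
  V≡ = lemma q b
    where
    lemma : ∀ q b → (1ℤ + q * (1ℤ + q * (1ℤ + q * 0ℤ))) * ((1ℤ + q * b) * (1ℤ + q) - q * b)
            - (+ 2) * (1ℤ + q * b) * q * (1ℤ + q * (1ℤ + q * 0ℤ)) ≡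
            1ℤ + q + q * q - (1ℤ + q * b) * (q * (1ℤ + q - q * q))
    lemma = solve-∀
  x≡ : x ≡ 1ℤ + q + q * q
  x≡ = lemma q
    where
    lemma : ∀ q → 1ℤ + q * (1ℤ + q * (1ℤ + q * 0ℤ)) ≡ 1ℤ + q + q * q
    lemma = solve-∀

  -- This version precedes the multiplication by 1 - t² and so still carries information at t = 1.
  schurDet-path≡0 : x ≢ 0ℤ → schurDet t (pathShapes j) ≡ 0ℤ →
                    let c = 1ℤ + q + q * q; W = c - B * (q * (1ℤ + q - q * q)) in W * W - c * c * (p * p) ≡ 0ℤ
  schurDet-path≡0 x≢0 e = trans (cong₂ (λ x V → V * V - x * x * (p * p)) (sym x≡) (sym V≡))
    (c (c (c (c (c (c (trans (lemma x (V * V - x * x * (p * p))) (trans (sym schurDet-path) e))))))))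
    where
    c : ∀ {y} → x * y ≡ 0ℤ → y ≡ 0ℤ
    c e = *-cancelˡ x x≢0 (trans e (sym (ℤP.*-zeroʳ x)))
    lemma : ∀ x r → x * (x * (x * (x * (x * (x * r))))) ≡ x * x * x * x * (x * x * r)
    lemma = solve-∀

  -- Substituting p² = 1 - (1 - t²) B leaves a polynomial in B with no constant term. The factor B
  -- thus obtained is the one in `weight-path`, and it cancels in `Φ-reduced`.
  path-reduced : (1ℤ - q) * (x * x * (V * V - x * x * (p * p))) ≡ B * reduced t p
  path-reduced = begin
    (1ℤ - q) * (x * x * (V * V - x * x * (p * p)))
      ≡⟨ cong₂ (λ x V → (1ℤ - q) * (x * x * (V * V - x * x * (p * p)))) x≡ V≡ ⟩
    (1ℤ - q) * (c * c * ((c - B * b′) * (c - B * b′) - c * c * (p * p)))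
      ≡⟨ cong (λ r → (1ℤ - q) * (c * c * ((c - B * b′) * (c - B * b′) - c * c * r))) (sym pp) ⟩
    (1ℤ - q) * (c * c * ((c - B * b′) * (c - B * b′) - c * c * (1ℤ - (1ℤ - q) * B)))
      ≡⟨ move (1ℤ - q) (c * c) ((c - B * b′) * (c - B * b′) - c * c * (1ℤ - (1ℤ - q) * B)) ⟩
    c * c * ((1ℤ - q) * ((c - B * b′) * (c - B * b′) - c * c * (1ℤ - (1ℤ - q) * B)))
      ≡⟨ cong (c * c *_) (factored B) ⟩
    c * c * (B * (a * a - (1ℤ - (1ℤ - q) * B) * (b′ * b′)))
      ≡⟨ move (c * c) B (a * a - (1ℤ - (1ℤ - q) * B) * (b′ * b′)) ⟩
    B * (c * c * (a * a - (1ℤ - (1ℤ - q) * B) * (b′ * b′)))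
      ≡⟨ cong (λ r → B * (c * c * (a * a - r * (b′ * b′)))) pp ⟩
    B * (c * c * (a * a - p * p * (b′ * b′))) ∎
    where
    open ≡-Reasoning
    move : ∀ u v w → u * (v * w) ≡ v * (u * w)
    move = solve-∀
    c = 1ℤ + q + q * q
    a = 1ℤ - q - q * q
    b′ = q * (1ℤ + q - q * q)
    pp : 1ℤ - (1ℤ - q) * B ≡ p * p
    pp = trans (cong (λ s → 1ℤ - s) (bracket-geometric t (suc j))) (lemma′ (p * p))
      where
      lemma′ : ∀ r → 1ℤ - (1ℤ - r) ≡ r
      lemma′ = solve-∀
    factored : ∀ B → (1ℤ - q) * ((c - B * b′) * (c - B * b′) - c * c * (1ℤ - (1ℤ - q) * B)) ≡
                     B * (a * a - (1ℤ - (1ℤ - q) * B) * (b′ * b′))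
    factored = lemma q
      where
      lemma : ∀ q B → (1ℤ - q) *
                ((1ℤ + q + q * q - B * (q * (1ℤ + q - q * q))) * (1ℤ + q + q * q - B * (q * (1ℤ + q - q * q)))
                 - (1ℤ + q + q * q) * (1ℤ + q + q * q) * (1ℤ - (1ℤ - q) * B)) ≡
              B * ((1ℤ - q - q * q) * (1ℤ - q - q * q)
                - (1ℤ - (1ℤ - q) * B) * (q * (1ℤ + q - q * q) * (q * (1ℤ + q - q * q))))
      lemma = solve-∀

-- Number of edges and degrees of a mate from the low coefficients.

-- The divisor |x| + 1 already suffices, as its only multiple of smaller absolute value is 0.
divisible-by-all : ∀ x → (∀ τ → (+ suc τ) divides x) → x ≡ 0ℤ
divisible-by-all x h = ℤP.∣i∣≡0⇒i≡0 (small ℤ.∣ x ∣ ℤ.∣ _divides_.quotient d ∣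
  (trans (cong ℤ.∣_∣ (_divides_.equality d)) (ℤP.abs-* (+ suc ℤ.∣ x ∣) (_divides_.quotient d))))
  where
  d = h ℤ.∣ x ∣
  small : ∀ m k → m ≡ suc m ℕ.* k → m ≡ 0
  small m zero    e = trans e (ℕP.*-zeroʳ (suc m))
  small m (suc k) e = ⊥-elim (ℕP.<-irrefl refl (ℕP.≤-trans (ℕP.m≤m*n (suc m) (suc k)) (ℕP.≤-reflexive (sym e))))

+suc≢0 : ∀ τ → + suc τ ≢ 0ℤ
+suc≢0 τ ()

-- The coefficients are peeled off from the lowest degree upwards, each being divisible by every
-- positive integer.
quadratic-zero : ∀ x y z → (∀ τ → let t = + suc τ in (t * t * t) divides (x + y * t + z * (t * t))) →
                 x ≡ 0ℤ × y ≡ 0ℤ × z ≡ 0ℤ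
quadratic-zero x y z h = x≡0 , y≡0 , z≡0
  where
  x≡0 : x ≡ 0ℤ
  x≡0 = divisible-by-all x λ τ → go (+ suc τ) (h τ)
    where
    lemma₁ : ∀ t x y z → x ≡ (x + y * t + z * (t * t)) - t * (y + z * t)
    lemma₁ = solve-∀
    lemma₂ : ∀ t e y z → t * t * t * e - t * (y + z * t) ≡ t * (t * t * e - (y + z * t))
    lemma₂ = solve-∀
    go : ∀ t → (t * t * t) divides (x + y * t + z * (t * t)) → t divides x
    go t (factor e eq) = factor (t * t * e - (y + z * t))
      (trans (lemma₁ t x y z) (trans (cong (_- t * (y + z * t)) eq) (lemma₂ t e y z)))
  y≡0 : y ≡ 0ℤ
  y≡0 = divisible-by-all y λ τ → go (+ suc τ) (+suc≢0 τ) (h τ)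
    where
    lemma₁ : ∀ t y z → t * y ≡ (0ℤ + y * t + z * (t * t)) - t * (z * t)
    lemma₁ = solve-∀
    lemma₂ : ∀ t e z → t * t * t * e - t * (z * t) ≡ t * (t * (t * e - z))
    lemma₂ = solve-∀
    go : ∀ t → t ≢ 0ℤ → (t * t * t) divides (x + y * t + z * (t * t)) → t divides y
    go t t≢0 (factor e eq) = factor (t * e - z) (*-cancelˡ t t≢0
      (trans (lemma₁ t y z) (trans (cong (_- t * (z * t)) (trans (cong (λ x → x + y * t + z * (t * t)) (sym x≡0)) eq)) (lemma₂ t e z))))
  z≡0 : z ≡ 0ℤ
  z≡0 = divisible-by-all z λ τ → go (+ suc τ) (+suc≢0 τ) (h τ)
    where
    lemma₁ : ∀ t z → t * (t * z) ≡ 0ℤ + 0ℤ * t + z * (t * t)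
    lemma₁ = solve-∀
    lemma₂ : ∀ t e → t * t * t * e ≡ t * (t * (t * e))
    lemma₂ = solve-∀
    go : ∀ t → t ≢ 0ℤ → (t * t * t) divides (x + y * t + z * (t * t)) → t divides z
    go t t≢0 (factor e eq) = factor e (*-cancelˡ t t≢0 (*-cancelˡ t t≢0
      (trans (lemma₁ t z) (trans (cong₂ (λ x y → x + y * t + z * (t * t)) (sym x≡0) (sym y≡0)) (trans eq (lemma₂ t e))))))

degree : ∀ {n} → Graph n → Fin n → ℤ
degree {n} G v = ∑ (allFin n) (A G v)

∑-const : {A : Set} (xs : List A) (c : ℤ) → ∑ xs (λ _ → c) ≡ c * + length xs
∑-const []       c = sym (ℤP.*-zeroʳ c)
∑-const (x ∷ xs) c = trans (cong (λ s → c + s) (∑-const xs c)) (lemma c (+ length xs))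
  where
  lemma : ∀ c l → c + c * l ≡ c * (1ℤ + l)
  lemma = solve-∀

-- What remains of cospectrality with H₍₁₀₊ⱼ₎ in all that follows.
record PathSpectrum {n} (G : Graph n) (j : ℕ) : Set where
  field
    spectrum : ∀ τ → weight (+ τ) (pathShapes j) * Φ G (+ τ) ≡ schurDet (+ τ) (pathShapes j)

module _ {n} {G : Graph n} {j : ℕ} (S : PathSpectrum G j) where
  open PathSpectrum S
  open LowOrder G

  Φ-reduced : ∀ τ → (1ℤ - + τ * + τ) * Φ G (+ τ) ≡ reduced (+ τ) ((+ τ) ^ suc j)
  Φ-reduced τ = *-cancelˡ (weight t (pathShapes j)) (weight-≢0 τ (pathShapes j)) (begin
    N * ((1ℤ - t * t) * Φ G t)          ≡⟨ swap₁ N (1ℤ - t * t) (Φ G t) ⟩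
    (1ℤ - t * t) * (N * Φ G t)          ≡⟨ cong ((1ℤ - t * t) *_) (trans (spectrum τ) (schurDet-path t j)) ⟩
    (1ℤ - t * t) * (x⁴ * rest)          ≡⟨ swap₁ (1ℤ - t * t) x⁴ rest ⟩
    x⁴ * ((1ℤ - t * t) * rest)          ≡⟨ cong (x⁴ *_) (path-reduced t j) ⟩
    x⁴ * (B * reduced t (t ^ suc j))    ≡⟨ sym (ℤP.*-assoc x⁴ B (reduced t (t ^ suc j))) ⟩
    x⁴ * B * reduced t (t ^ suc j)      ≡⟨ cong (_* reduced t (t ^ suc j)) (sym (weight-path t j)) ⟩
    N * reduced t (t ^ suc j)           ∎)
    where
    open ≡-Reasoning
    t = + τ
    N = weight t (pathShapes j)
    B = bracket t (suc j)
    x = bracket t 3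
    x⁴ = x * x * x * x
    V = x * (B * (1ℤ + t * t) - t * t * bracket t j) - (+ 2) * B * (t * t) * bracket t 2
    rest = x * x * (V * V - x * x * (t ^ suc j * t ^ suc j))
    swap₁ : ∀ a b c → a * (b * c) ≡ b * (a * c)
    swap₁ = solve-∀

  -- At t = 1 the bracket [L] is L, and vanishing means (3 - (j + 1))² = 9, that is (j - 5)(j + 1) =
  -- 0. The unreduced formula is used because 1 - t² vanishes here.
  Φ-at-1 : Φ G 1ℤ ≡ 0ℤ → j ≡ 5
  Φ-at-1 Φ≡0 = conclude (ℤP.i*j≡0⇒i≡0∨j≡0 (+ j - + 5) product)
    where
    open ≡-Reasoning
    bracket-1 : ∀ L → bracket 1ℤ L ≡ + L
    bracket-1 zero    = refl
    bracket-1 (suc L) = cong (λ b → 1ℤ + b) (trans (ℤP.*-identityˡ (bracket 1ℤ L)) (bracket-1 L))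
    square : (+ 3 - + suc j) * (+ 3 - + suc j) - + 9 ≡ 0ℤ
    square = trans (cong₂ (λ b p → (+ 3 - b) * (+ 3 - b) - + 9 * (p * p))
        (sym (trans (ℤP.*-identityʳ (bracket 1ℤ (suc j))) (bracket-1 (suc j)))) (sym (ℤP.^-zeroˡ (suc j))))
      (schurDet-path≡0 1ℤ j (bracket-≢0 1 2)
        (trans (sym (spectrum 1)) (trans (cong (weight 1ℤ (pathShapes j) *_) Φ≡0) (ℤP.*-zeroʳ (weight 1ℤ (pathShapes j))))))
    product : (+ j - + 5) * (1ℤ + + j) ≡ 0ℤ
    product = trans (lemma (+ j)) square
      where
      lemma : ∀ j → (j - + 5) * (1ℤ + j) ≡ (+ 3 - (1ℤ + j)) * (+ 3 - (1ℤ + j)) - + 9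
      lemma = solve-∀
    conclude : (+ j - + 5 ≡ 0ℤ) ⊎ (1ℤ + + j ≡ 0ℤ) → j ≡ 5
    conclude (inj₁ e) = ℤP.+-injective (ℤP.i-j≡0⇒i≡j (+ j) (+ 5) e)
    conclude (inj₂ ())

  private
    vs = allFin n
    α = coeff₂ vs
    γ = coeff₃ vs
    β = coeff₄ vs

    -- In `reduced` one has c²a² = 1 - 2t⁴ + O(t⁶), and c²p²b² is divisible by t⁶ for every j. So (1
    -- - t²) Φ agrees with 1 - 2t⁴ through degree 4; comparison with (1 - t²) times the truncation
    -- gives α = 1, γ = 0 and β = α - 2.
    coefficients : α - 1ℤ ≡ 0ℤ × γ ≡ 0ℤ × β - α + + 2 ≡ 0ℤ
    coefficients = quadratic-zero (α - 1ℤ) γ (β - α + + 2) λ τ →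
      go (+ suc τ) (+suc≢0 τ) (minor-truncation (+ suc τ) vs (UniqueP.allFin⁺ n)) (Φ-reduced (suc τ))
      where
      go : ∀ t → t ≢ 0ℤ → (t * t * (t * t) * t) divides (Φ G t - Truncation t vs) →
           (1ℤ - t * t) * Φ G t ≡ reduced t (t ^ suc j) →
           (t * t * t) divides (α - 1ℤ + γ * t + (β - α + + 2) * (t * t))
      go t t≢0 (factor d eq) red = factor e (*-cancelˡ t t≢0 (*-cancelˡ t t≢0 (begin
        t * (t * (α - 1ℤ + γ * t + (β - α + + 2) * (t * t)))
          ≡⟨ lemma₁ t α γ β ⟩
        (1ℤ - q) * Truncation t vs - (1ℤ - (+ 2) * (q * q)) + q * q * t * (γ + t * β)
          ≡⟨ cong (λ x → (1ℤ - q) * x - (1ℤ - (+ 2) * (q * q)) + q * q * t * (γ + t * β)) trunc ⟩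
        (1ℤ - q) * (Φ G t - q * q * t * d) - (1ℤ - (+ 2) * (q * q)) + q * q * t * (γ + t * β)
          ≡⟨ lemma₂ t (Φ G t) d γ β ⟩
        (1ℤ - q) * Φ G t - (1ℤ - (+ 2) * (q * q)) + q * q * t * (γ + t * β - (1ℤ - q) * d)
          ≡⟨ cong (λ x → x - (1ℤ - (+ 2) * (q * q)) + q * q * t * (γ + t * β - (1ℤ - q) * d)) red ⟩
        reduced t (t * s) - (1ℤ - (+ 2) * (q * q)) + q * q * t * (γ + t * β - (1ℤ - q) * d)
          ≡⟨ cong (λ x → x - (1ℤ - (+ 2) * (q * q)) + q * q * t * (γ + t * β - (1ℤ - q) * d))
               (trans (split (c * c) (a * a) (t * s * (t * s) * (q * f * (q * f))))
                 (cong (λ x → x - c * c * (t * s * (t * s) * (q * f * (q * f)))) (square q))) ⟩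
        1ℤ - (+ 2) * (q * q) + q * q * q * z - c * c * (t * s * (t * s) * (q * f * (q * f)))
          - (1ℤ - (+ 2) * (q * q)) + q * q * t * (γ + t * β - (1ℤ - q) * d)
          ≡⟨ lemma₃ t s z (c * c) f (γ + t * β - (1ℤ - q) * d) ⟩
        t * (t * (t * t * t * e)) ∎)))
        where
        open ≡-Reasoning
        q = t * t
        s = t ^ j
        f = 1ℤ + q - q * q
        c = 1ℤ + q + q * q
        a = 1ℤ - q - q * q
        -- `z` is what follows 1 - 2q² in the expansion of c²a², divided by q³.
        z = q * ((1ℤ + q) * (1ℤ + q) * ((1ℤ + q) * (1ℤ + q))) - + 4 - (+ 2) * q
        ρ = t * z - t * (s * s) * (f * f * (c * c))
        e = ρ + (γ + t * β - (1ℤ - q) * d)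
        trunc : Truncation t vs ≡ Φ G t - q * q * t * d
        trunc = trans (lemma (Φ G t) (Truncation t vs)) (cong (λ x → Φ G t - x) eq)
          where
          lemma : ∀ x y → y ≡ x - (x - y)
          lemma = solve-∀
        lemma₁ : ∀ t α γ β → t * (t * (α - 1ℤ + γ * t + (β - α + + 2) * (t * t))) ≡
          (1ℤ - t * t) * (1ℤ + α * (t * t) + γ * (t * t * t) + β * (t * t * (t * t)))
            - (1ℤ - (+ 2) * (t * t * (t * t))) + t * t * (t * t) * t * (γ + t * β)
        lemma₁ = solve-∀
        lemma₂ : ∀ t x d γ β →
          (1ℤ - t * t) * (x - t * t * (t * t) * t * d) - (1ℤ - (+ 2) * (t * t * (t * t))) + t * t * (t * t) * t * (γ + t * β) ≡
          (1ℤ - t * t) * x - (1ℤ - (+ 2) * (t * t * (t * t))) + t * t * (t * t) * t * (γ + t * β - (1ℤ - t * t) * d)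
        lemma₂ = solve-∀
        square : ∀ q → (1ℤ + q + q * q) * (1ℤ + q + q * q) * ((1ℤ - q - q * q) * (1ℤ - q - q * q)) ≡
          1ℤ - (+ 2) * (q * q) + q * q * q * (q * ((1ℤ + q) * (1ℤ + q) * ((1ℤ + q) * (1ℤ + q))) - + 4 - (+ 2) * q)
        square = solve-∀
        lemma₃ : ∀ t s z m f r → 1ℤ - (+ 2) * (t * t * (t * t)) + t * t * (t * t) * (t * t) * z
          - m * (t * s * (t * s) * (t * t * f * (t * t * f))) - (1ℤ - (+ 2) * (t * t * (t * t))) + t * t * (t * t) * t * r ≡
          t * (t * (t * t * t * (t * z - t * (s * s) * (f * f * m) + r)))
        lemma₃ = solve-∀
        split : ∀ x y z → x * (y - z) ≡ x * y - x * z
        split = solve-∀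

    α≡1 : α ≡ 1ℤ
    α≡1 = ℤP.i-j≡0⇒i≡j α 1ℤ (proj₁ coefficients)

    β≡-1 : β ≡ - 1ℤ
    β≡-1 = trans (lemma β) (cong (λ x → x - 1ℤ)
      (trans (cong (λ a → β - a + + 2) (sym α≡1)) (proj₂ (proj₂ coefficients))))
      where
      lemma : ∀ b → b ≡ b - 1ℤ + + 2 - 1ℤ
      lemma = solve-∀

    n′ = + length vs

  edge-count : + length (allFin n) - edges (allFin n) ≡ 1ℤ
  edge-count = trans (sym (coeff₂-edges vs)) α≡1

  -- With α = 1 and β = -1, `coeff₄-bound` says that the sum of d² is at most 3 - n + 5m. Since the
  -- degrees add up to 2m, the sum of (d - 1)(d - 2) is at most 3 + n - m, and n - m = 1.
  excess-bound : ∑ (allFin n) (λ v → (degree G v - 1ℤ) * (degree G v - + 2)) ℤ.≤ + 4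
  excess-bound = begin
    ∑ vs (λ v → (degree G v - 1ℤ) * (degree G v - + 2))
      ≡⟨ ∑-cong vs (λ {v} _ → expand (degree G v)) ⟩
    ∑ vs (λ v → degree G v * degree G v + (- + 3) * degree G v + (+ 2))
      ≡⟨ trans (∑-+ vs (λ v → degree G v * degree G v + (- + 3) * degree G v) (λ _ → + 2))
           (cong₂ _+_ (trans (∑-+ vs (λ v → degree G v * degree G v) (λ v → (- + 3) * degree G v))
             (cong₂ _+_ (sumSquares-degrees vs) (trans (∑-*ˡ vs (- + 3) (degree G)) (cong ((- + 3) *_) (edges-degrees vs)))))
             (∑-const vs (+ 2))) ⟩
    sq + (- + 3) * ((+ 2) * m) + (+ 2) * n′
      ≤⟨ ℤP.+-monoˡ-≤ ((+ 2) * n′) (ℤP.+-monoˡ-≤ ((- + 3) * ((+ 2) * m)) sq-bound) ⟩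
    α * α - n′ + (+ 5) * m - (+ 2) * β + (- + 3) * ((+ 2) * m) + (+ 2) * n′
      ≡⟨ cong₂ (λ a b → a * a - n′ + (+ 5) * m - (+ 2) * b + (- + 3) * ((+ 2) * m) + (+ 2) * n′) α≡1 β≡-1 ⟩
    1ℤ - n′ + (+ 5) * m + + 2 + (- + 3) * ((+ 2) * m) + (+ 2) * n′
      ≡⟨ collect n′ m ⟩
    + 3 + (n′ - m)
      ≡⟨ cong (λ x → + 3 + x) edge-count ⟩
    + 4 ∎
    where
    open ℤP.≤-Reasoning
    sq = sumSquares vs
    m = edges vs
    expand : ∀ d → (d - 1ℤ) * (d - + 2) ≡ d * d + (- + 3) * d + (+ 2)
    expand = solve-∀
    collect : ∀ n m → 1ℤ - n + (+ 5) * m + + 2 + (- + 3) * ((+ 2) * m) + (+ 2) * n ≡ + 3 + (n - m)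
    collect = solve-∀
    sq-bound : sq ℤ.≤ α * α - n′ + (+ 5) * m - (+ 2) * β
    sq-bound = subst₂ ℤ._≤_ (lemma₁ sq ((+ 2) * β)) (lemma₂ (α * α - n′ + (+ 5) * m) sq ((+ 2) * β))
      (ℤP.+-monoˡ-≤ (sq - (+ 2) * β) (coeff₄-bound vs))
      where
      lemma₁ : ∀ s b → b + (s - b) ≡ s
      lemma₁ = solve-∀
      lemma₂ : ∀ x s b → x - s + (s - b) ≡ x - b
      lemma₂ = solve-∀

-- Covering the vertices other than the hubs by chains.

AllPairs-↭ : ∀ {A : Set} {R : A → A → Set} → (∀ {x y} → R x y → R y x) →
             ∀ {xs ys} → xs ↭ ys → AllPairs R xs → AllPairs R ys
AllPairs-↭ {A} {R} R-sym p = SetoidPermP.AllPairs-resp-↭ (setoid A) R-sym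
  ((λ e → subst (R _) e) , (λ e → subst (λ x → R x _) e)) (Perm.↭⇒↭ₛ p)

Unique-↭ : ∀ {A : Set} {xs ys : List A} → xs ↭ ys → Unique xs → Unique ys
Unique-↭ p = AllPairs-↭ (λ x≢y y≡x → x≢y (sym y≡x)) p

Unique-++⁻ : ∀ {A : Set} (xs : List A) {ys} → Unique (xs ++ ys) →
             Unique xs × (∀ {u v} → u ∈ xs → v ∈ ys → u ≢ v)
Unique-++⁻ []       uq        = [] , λ ()
Unique-++⁻ (x ∷ xs) (x∉ ∷ uq) = AllP.++⁻ˡ xs x∉ ∷ proj₁ (Unique-++⁻ xs uq) , λ
  { (here refl) v∈ → All.lookup (AllP.++⁻ʳ xs x∉) v∈
  ; (there m)   v∈ → proj₂ (Unique-++⁻ xs uq) m v∈ }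

extract : ∀ {A : Set} {x : A} {xs} → x ∈ xs → ∃ λ ys → xs ↭ x ∷ ys
extract {x = x} m with ∈-∃++ m
... | ps , qs , refl = ps ++ qs , PermP.shift x ps qs

concat-↭ : ∀ {A : Set} {xss yss : List (List A)} → xss ↭ yss → concat xss ↭ concat yss
concat-↭ Perm.refl          = Perm.refl
concat-↭ (Perm.prep xs p)   = PermP.++⁺ˡ xs (concat-↭ p)
concat-↭ (Perm.swap xs ys p) = Perm.trans (PermP.shifts xs ys) (PermP.++⁺ˡ ys (PermP.++⁺ˡ xs (concat-↭ p)))
concat-↭ (Perm.trans p q)   = Perm.trans (concat-↭ p) (concat-↭ q)

linkVertices-↭ : ∀ {n} {G : Graph n} {hub} {cs ds : List (Link G hub)} → cs ↭ ds → linkVertices cs ↭ linkVertices ds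
linkVertices-↭ p = concat-↭ (PermP.map⁺ vertices p)

Separate-sym : ∀ {n} {G : Graph n} {hub} {c d : Link G hub} → Separate c d → Separate d c
Separate-sym {G = G} s u∈ v∈ = Apart-sym {G = G} (s v∈ u∈)

module Neighbours {n} (G : Graph n) where

  bit : Bool → ℕ
  bit true  = 1
  bit false = 0

  nbrs : List (Fin n) → Fin n → ℕ
  nbrs []       v = 0
  nbrs (u ∷ us) v = bit (adj G v u) ℕ.+ nbrs us v

  nbrs-++ : ∀ us ws v → nbrs (us ++ ws) v ≡ nbrs us v ℕ.+ nbrs ws v
  nbrs-++ []       ws v = refl
  nbrs-++ (u ∷ us) ws v = trans (cong (bit (adj G v u) ℕ.+_) (nbrs-++ us ws v))
    (sym (ℕP.+-assoc (bit (adj G v u)) (nbrs us v) (nbrs ws v)))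

  nbrs-↭ : ∀ {us ws} → us ↭ ws → ∀ v → nbrs us v ≡ nbrs ws v
  nbrs-↭ Perm.refl         v = refl
  nbrs-↭ (Perm.prep u p)   v = cong (bit (adj G v u) ℕ.+_) (nbrs-↭ p v)
  nbrs-↭ (Perm.swap {us} {ws} u w p) v = trans (cong (λ k → bit (adj G v u) ℕ.+ (bit (adj G v w) ℕ.+ k)) (nbrs-↭ p v))
    (trans (sym (ℕP.+-assoc (bit (adj G v u)) (bit (adj G v w)) (nbrs ws v)))
      (trans (cong (ℕ._+ nbrs ws v) (ℕP.+-comm (bit (adj G v u)) (bit (adj G v w))))
        (ℕP.+-assoc (bit (adj G v w)) (bit (adj G v u)) (nbrs ws v))))
  nbrs-↭ (Perm.trans p q)  v = trans (nbrs-↭ p v) (nbrs-↭ q v)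

  nbrs-adj : ∀ {v u} us → adj G v u ≡ true → nbrs (u ∷ us) v ≡ suc (nbrs us v)
  nbrs-adj {v} us e = cong (λ b → bit b ℕ.+ nbrs us v) e

  nbrs-self : ∀ us v → nbrs (v ∷ us) v ≡ nbrs us v
  nbrs-self us v = cong (λ b → bit b ℕ.+ nbrs us v) (irrefl G v)

  nbrs-none : ∀ us {v} → nbrs us v ≡ 0 → ∀ {u} → u ∈ us → adj G v u ≡ false
  nbrs-none (w ∷ us) {v} e (here refl) with adj G v w
  ... | false = refl
  nbrs-none (w ∷ us) {v} e (there m) = nbrs-none us (ℕP.m+n≡0⇒n≡0 (bit (adj G v w)) e) m

  nbrs-some : ∀ us {v} → nbrs us v ≢ 0 → ∃ λ u → u ∈ us × adj G v u ≡ true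
  nbrs-some []       ne = ⊥-elim (ne refl)
  nbrs-some (w ∷ us) {v} ne with adj G v w in e
  ... | true  = w , here refl , e
  ... | false with nbrs-some us ne
  ...   | u , m , a = u , there m , a

  +nbrs : ∀ us v → + nbrs us v ≡ ∑ us (A G v)
  +nbrs []       v = refl
  +nbrs (u ∷ us) v = trans (ℤP.pos-+ (bit (adj G v u)) (nbrs us v)) (cong₂ _+_ (bit-edge (adj G v u)) (+nbrs us v))
    where
    bit-edge : ∀ b → + bit b ≡ edge b
    bit-edge true  = refl
    bit-edge false = refl

  low-or-high : ∀ ws us → (∃ λ v → v ∈ us × nbrs ws v ≤ 1) ⊎ (∀ {v} → v ∈ us → 2 ≤ nbrs ws v)
  low-or-high ws []       = inj₂ λ ()
  low-or-high ws (v ∷ us) with nbrs ws v ℕP.≤? 1 | low-or-high ws us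
  ... | yes p | _                  = inj₁ (v , here refl , p)
  ... | no ¬p | inj₁ (u , m , q)   = inj₁ (u , there m , q)
  ... | no ¬p | inj₂ h             = inj₂ λ { (here refl) → ℕP.≰⇒> ¬p ; (there m) → h m }

  -- A union of cycle components: the all-ones vector is in the kernel of 2I − A restricted to it.
  cycles-singular : ∀ {v ws rest} → (v ∷ ws) ++ rest ↭ allFin n →
                    (∀ {w} → w ∈ v ∷ ws → nbrs (v ∷ ws) w ≡ 2) → (∀ {w} → w ∈ v ∷ ws → nbrs rest w ≡ 0) →
                    Φ G 1ℤ ≡ 0ℤ
  cycles-singular {v} {ws} {rest} p two none =
    minor-singular (K G 1ℤ) {us = ws} (Perm.↭-sym p) ∈-++⁺ˡ (λ _ → 1ℤ) (λ m → kill (∈-++⁻ (v ∷ ws) (∈-resp-↭ (Perm.↭-sym p) m)))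
    where
    open LowOrder G
    C = v ∷ ws
    uq = Unique-++⁻ C (Unique-↭ (Perm.↭-sym p) (UniqueP.allFin⁺ n))
    degreeIn : ∀ c → ∑ C (λ u → 1ℤ * A G u c) ≡ + nbrs C c
    degreeIn c = trans (∑-cong C (λ {u} _ → trans (ℤP.*-identityˡ (A G u c)) (A-sym G u c))) (sym (+nbrs C c))
    kill : ∀ {c} → c ∈ C ⊎ c ∈ rest → ∑ C (λ u → 1ℤ * K G 1ℤ u c) ≡ 0ℤ
    kill {c} (inj₁ m) = trans (∑-K-in 1ℤ (λ _ → 1ℤ) C (proj₁ uq) m)
      (cong (λ d → (1ℤ + 1ℤ * 1ℤ) * 1ℤ - 1ℤ * d) (trans (degreeIn c) (cong +_ (two m))))
    kill {c} (inj₂ m) = trans (∑-K-out 1ℤ (λ _ → 1ℤ) C (λ u∈ → proj₂ uq u∈ m))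
      (cong (λ d → - (1ℤ * d)) (∑-zero C (λ {u} u∈ → trans (ℤP.*-identityˡ (A G u c)) (cong edge (nbrs-none rest (none u∈) m)))))

module ChainCover {n} (G : Graph n) (hub : Hub → Fin n) (no-cycles : Φ G 1ℤ ≢ 0ℤ) where
  open Neighbours G

  hubs : List (Fin n)
  hubs = hub hubA ∷ hub hubB ∷ []

  private
    two-ends : ∀ b b′ → ∃ λ (e : End) → ∃ λ (f : End) → edge b ≡ ι e hubA + ι f hubA × edge b′ ≡ ι e hubB + ι f hubB
    two-ends true  true  = just hubA , just hubB , refl , refl
    two-ends true  false = just hubA , nothing , refl , refl
    two-ends false true  = nothing , just hubB , refl , refl
    two-ends false false = nothing , nothing , refl , refl

    label₂ : ∀ v → ∃ λ (e : End) → ∃ λ (f : End) → ∀ h → A G v (hub h) ≡ ι e h + ι f h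
    label₂ v with two-ends (adj G v (hub hubA)) (adj G v (hub hubB))
    ... | e , f , p , q = e , f , λ { hubA → p ; hubB → q }

    one-end : ∀ b b′ → bit b ℕ.+ (bit b′ ℕ.+ 0) ≤ 1 → ∃ λ (e : End) → edge b ≡ ι e hubA × edge b′ ≡ ι e hubB
    one-end false false _ = nothing , refl , refl
    one-end true  false _ = just hubA , refl , refl
    one-end false true  _ = just hubB , refl , refl
    one-end true  true  (s≤s ())

    label₁ : ∀ v → nbrs hubs v ≤ 1 → ∃ λ (e : End) → ∀ h → A G v (hub h) ≡ ι e h
    label₁ v b with one-end (adj G v (hub hubA)) (adj G v (hub hubB)) b
    ... | e , p , q = e , λ { hubA → p ; hubB → q }

    label₀ : ∀ v → nbrs hubs v ≡ 0 → ∀ h → A G v (hub h) ≡ 0ℤ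
    label₀ v p hubA = cong edge (nbrs-none hubs p (here refl))
    label₀ v p hubB = cong edge (nbrs-none hubs p (there (here refl)))

    -- An inner vertex sees both of its neighbours on the chain, so a vertex with at most one
    -- neighbour is first or last.
    position : ∀ {e vs f} → Chain G hub e vs f → ∀ {w} → w ∈ vs →
               (∃ λ ys → vs ≡ w ∷ ys) ⊎ (∃ λ ys → vs ≡ ys ∷ʳ w) ⊎ 2 ≤ nbrs vs w
    position (one _) (here refl) = inj₁ ([] , refl)
    position (cons _ _ _ _) (here refl) = inj₁ (_ , refl)
    position {vs = v ∷ u ∷ vs} (cons _ vu _ ch) {w} (there m) with position ch m
    position {vs = v ∷ u ∷ []}     (cons _ vu _ ch) (there m) | inj₁ (ys , refl) = inj₂ (inj₁ (v ∷ [] , refl))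
    position {vs = v ∷ u ∷ x ∷ vs} (cons _ vu _ (cons _ ux _ _)) (there m) | inj₁ (ys , refl) = inj₂ (inj₂ two)
      where
      two : 2 ≤ nbrs (v ∷ u ∷ x ∷ vs) u
      two rewrite trans (adj-sym G u v) vu | irrefl G u | ux = s≤s (s≤s z≤n)
    ... | inj₂ (inj₁ (ys , eq)) = inj₂ (inj₁ (v ∷ ys , cong (v ∷_) eq))
    ... | inj₂ (inj₂ two)       = inj₂ (inj₂ (ℕP.≤-trans two (ℕP.m≤n+m (nbrs (u ∷ vs) w) (bit (adj G w v)))))

    -- The old first vertex `u` becomes inner and must lose its left label. On a longer chain its
    -- next vertex already exhausts the bound, so it has no hub edge; on a one-vertex chain its only
    -- possible hub edge becomes the right label.
    extend : ∀ {e u ys f} v → Chain G hub e (u ∷ ys) f → nbrs (u ∷ ys) u ℕ.+ nbrs hubs u ≤ 1 → nbrs hubs v ≤ 1 →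
             adj G v u ≡ true → All (Apart G v) ys → ∃ λ e′ → ∃ λ f′ → Chain G hub e′ (v ∷ u ∷ ys) f′
    extend {u = u} v (one p) b bv vu ap with label₁ v bv | label₁ u (ℕP.≤-trans (ℕP.m≤n+m (nbrs hubs u) (nbrs (u ∷ []) u)) b)
    ... | e , le | f , lf = e , f , cons le vu ap (one (λ h → trans (lf h) (sym (ℤP.+-identityˡ (ι f h)))))
    extend {u = u} v (cons {w = w} {ws} {f} p uw q ch) b bv vu ap with label₁ v bv
    ... | e , le = e , f , cons le vu ap (cons (label₀ u (no-hubs b)) uw q ch)
      where
      no-hubs : nbrs (u ∷ w ∷ ws) u ℕ.+ nbrs hubs u ≤ 1 → nbrs hubs u ≡ 0
      no-hubs b rewrite irrefl G u | uw = ℕP.n≤0⇒n≡0 (ℕP.m+n≤o⇒n≤o (nbrs ws u) (ℕ.s≤s⁻¹ b))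

    Cover : List (Fin n) → Set
    Cover ws = ∃ λ (cs : List (Link G hub)) → linkVertices cs ↭ ws × AllPairs Separate cs

    record Oriented (cs : List (Link G hub)) (u : Fin n) : Set where
      field
        {l r}  : End
        ys     : List (Fin n)
        others : List (Link G hub)
        ch     : Chain G hub l (u ∷ ys) r
        perm   : (u ∷ ys) ++ linkVertices others ↭ linkVertices cs
        sep    : AllPairs Separate others
        apart  : ∀ {x z} → x ∈ u ∷ ys → z ∈ linkVertices others → Apart G x z

    -- The chain through u can be turned so as to start at u, since u has at most one neighbour on it.
    orient : ∀ cs → AllPairs Separate cs → ∀ {u} → u ∈ linkVertices cs → nbrs (linkVertices cs) u ≤ 1 → Oriented cs u
    orient cs sep {u} m b with ∈-concat⁻′ (map vertices cs) m
    ... | vs , u∈ , vs∈ with ∈-map⁻ vertices vs∈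
    ...   | c , c∈ , refl with extract c∈
    ...     | others , p = go (position (chain c) u∈)
      where
      split : vertices c ++ linkVertices others ↭ linkVertices cs
      split = Perm.↭-sym (linkVertices-↭ p)
      seps : AllPairs Separate (c ∷ others)
      seps = AllPairs-↭ (λ {x} {y} → Separate-sym {c = x} {d = y}) p sep
      build : ∀ {l r ys} → Chain G hub l (u ∷ ys) r → u ∷ ys ↭ vertices c → Oriented cs u
      build {ys = ys} ch q with seps
      ... | s ∷ ss = record
        { ys = ys ; others = others ; ch = ch
        ; perm = Perm.↭-trans (PermP.++⁺ʳ (linkVertices others) q) split
        ; sep = ss
        ; apart = λ x∈ z∈ → separate-∈ c s (∈-resp-↭ q x∈) z∈ }
      go : (∃ λ ys → vertices c ≡ u ∷ ys) ⊎ (∃ λ ys → vertices c ≡ ys ∷ʳ u) ⊎ 2 ≤ nbrs (vertices c) u → Oriented cs u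
      go (inj₁ (ys , e)) = build (subst (λ l → Chain G hub (left c) l (right c)) e (chain c)) (Perm.↭-reflexive (sym e))
      go (inj₂ (inj₁ (ys , e))) = build
        (subst (λ l → Chain G hub (right c) l (left c)) (trans (cong reverse e) (ListP.reverse-++ ys (u ∷ []))) (Chain-reverse (chain c)))
        (Perm.↭-trans (Perm.↭-reflexive (trans (sym (ListP.reverse-++ ys (u ∷ []))) (cong reverse (sym e)))) (PermP.↭-reverse (vertices c)))
      go (inj₂ (inj₂ two)) = ⊥-elim (ℕP.<⇒≱ two (ℕP.≤-trans
        (ℕP.≤-trans (ℕP.m≤m+n (nbrs (vertices c) u) (nbrs (linkVertices others) u))
          (ℕP.≤-reflexive (trans (sym (nbrs-++ (vertices c) (linkVertices others) u)) (nbrs-↭ split u)))) b))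

    -- The neighbour `u` of `v` has degree at most 2, hence at most one neighbour within `ws`, so it
    -- is an end of its chain. As `v` has no second neighbour in `ws`, it extends that chain and
    -- touches no other.
    attach : ∀ {v ws ds} → (v ∷ ws) ++ ds ++ hubs ↭ allFin n → (∀ {w} → w ∈ v ∷ ws → nbrs (allFin n) w ≤ 2) →
             nbrs ws v ≤ 1 → nbrs ws v ≢ 0 → Cover ws → Cover (v ∷ ws)
    attach {v} {ws} {ds} p deg≤2 low ne (cs , q , sep) with nbrs-some ws ne
    ... | u , u∈ , vu = glue (orient cs sep (∈-resp-↭ (Perm.↭-sym q) u∈)
        (subst (_≤ 1) (sym (nbrs-↭ q u)) (ℕ.s≤s⁻¹ (ℕP.≤-trans
          (ℕP.≤-trans (ℕP.≤-reflexive (sym (nbrs-adj ws (trans (adj-sym G u v) vu)))) (part u)) (deg≤2 (there u∈))))))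
      where
      uq : Unique (v ∷ ws)
      uq = proj₁ (Unique-++⁻ (v ∷ ws) (Unique-↭ (Perm.↭-sym p) (UniqueP.allFin⁺ n)))
      total : ∀ x → nbrs (allFin n) x ≡ nbrs (v ∷ ws) x ℕ.+ (nbrs ds x ℕ.+ nbrs hubs x)
      total x = trans (sym (nbrs-↭ p x)) (trans (nbrs-++ (v ∷ ws) (ds ++ hubs) x)
        (cong (nbrs (v ∷ ws) x ℕ.+_) (nbrs-++ ds hubs x)))
      part : ∀ x → nbrs (v ∷ ws) x ≤ nbrs (allFin n) x
      part x = subst (nbrs (v ∷ ws) x ≤_) (sym (total x)) (ℕP.m≤m+n (nbrs (v ∷ ws) x) (nbrs ds x ℕ.+ nbrs hubs x))
      with-hubs : ∀ x → nbrs (v ∷ ws) x ℕ.+ nbrs hubs x ≤ nbrs (allFin n) x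
      with-hubs x = subst (nbrs (v ∷ ws) x ℕ.+ nbrs hubs x ≤_) (sym (total x))
        (ℕP.+-monoʳ-≤ (nbrs (v ∷ ws) x) (ℕP.m≤n+m (nbrs hubs x) (nbrs ds x)))
      glue : Oriented cs u → Cover (v ∷ ws)
      glue o = record { chain = proj₂ (proj₂ new) } ∷ others ,
               Perm.prep v (Perm.↭-trans perm q) ,
               All.tabulate separated ∷ Oriented.sep o
        where
        open Oriented o hiding (sep)
        whole : u ∷ ys ++ linkVertices others ↭ ws
        whole = Perm.↭-trans perm q
        rest-none : nbrs (ys ++ linkVertices others) v ≡ 0
        rest-none = ℕP.n≤0⇒n≡0 (ℕ.s≤s⁻¹ (subst (_≤ 1)
          (trans (sym (nbrs-↭ whole v)) (nbrs-adj (ys ++ linkVertices others) vu)) low))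
        v-apart : ∀ {x} → x ∈ ys ++ linkVertices others → Apart G v x
        v-apart m with uq
        ... | v∉ ∷ _ = All.lookup v∉ (∈-resp-↭ whole (there m)) , nbrs-none (ys ++ linkVertices others) rest-none m
        u-bound : nbrs (u ∷ ys) u ℕ.+ nbrs hubs u ≤ 1
        u-bound = ℕ.s≤s⁻¹ (ℕP.≤-trans (ℕP.≤-trans
          (s≤s (ℕP.+-monoˡ-≤ (nbrs hubs u) (ℕP.≤-trans (ℕP.m≤m+n (nbrs (u ∷ ys) u) (nbrs (linkVertices others) u))
            (ℕP.≤-reflexive (trans (sym (nbrs-++ (u ∷ ys) (linkVertices others) u)) (nbrs-↭ whole u))))))
          (ℕP.≤-trans (ℕP.≤-reflexive (cong (ℕ._+ nbrs hubs u) (sym (nbrs-adj ws (trans (adj-sym G u v) vu))))) (with-hubs u)))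
          (deg≤2 (there u∈)))
        v-bound : nbrs hubs v ≤ 1
        v-bound = ℕ.s≤s⁻¹ (ℕP.≤-trans (ℕP.≤-trans (ℕP.+-monoˡ-≤ (nbrs hubs v)
          (ℕP.≤-trans (ℕP.n≢0⇒n>0 ne) (ℕP.≤-reflexive (sym (nbrs-self ws v))))) (with-hubs v)) (deg≤2 (here refl)))
        new = extend v ch u-bound v-bound vu (All.tabulate (λ m → v-apart (∈-++⁺ˡ m)))
        separated : ∀ {d} → d ∈ others → ∀ {x z} → x ∈ v ∷ u ∷ ys → z ∈ vertices d → Apart G x z
        separated d∈ (here refl) z∈ = v-apart (∈-++⁺ʳ ys (∈-concat⁺′ z∈ (∈-map⁺ vertices d∈)))
        separated d∈ (there x∈)  z∈ = apart x∈ (∈-concat⁺′ z∈ (∈-map⁺ vertices d∈))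

    -- With no neighbour in `ws`, the vertex is a chain by itself. Its two labels can record any
    -- adjacency to the two hubs.
    isolate : ∀ {v ws rest} → (v ∷ ws) ++ rest ↭ allFin n → nbrs ws v ≡ 0 → Cover ws → Cover (v ∷ ws)
    isolate {v} {ws} p none (cs , q , sep) with label₂ v
    ... | e , f , l = record { chain = one {e = e} {f = f} l } ∷ cs , Perm.prep v q , All.tabulate separated ∷ sep
      where
      uq : Unique (v ∷ ws)
      uq = proj₁ (Unique-++⁻ (v ∷ ws) (Unique-↭ (Perm.↭-sym p) (UniqueP.allFin⁺ n)))
      separated : ∀ {d} → d ∈ cs → ∀ {x z} → x ∈ v ∷ [] → z ∈ vertices d → Apart G x z
      separated d∈ (here refl) z∈ with uq
      ... | v∉ ∷ _ = All.lookup v∉ z∈ws , nbrs-none ws none z∈ws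
        where z∈ws = ∈-resp-↭ q (∈-concat⁺′ z∈ (∈-map⁺ vertices d∈))

  -- A vertex with at most one neighbour inside `ws` is removed, the rest is covered, and the vertex
  -- is put back. If there is none, every vertex of `ws` has exactly two neighbours inside and none
  -- outside, so `ws` is a union of cycles, against `no-cycles`. The list `ds` keeps the vertices
  -- already removed, so that degrees still refer to the whole graph.
  cover-by-chains : ∀ k ws ds → length ws ≡ k → ws ++ ds ++ hubs ↭ allFin n →
                    (∀ {w} → w ∈ ws → nbrs (allFin n) w ≤ 2) → Cover ws
  cover-by-chains zero    []       ds _ _ _ = [] , Perm.refl , []
  cover-by-chains (suc k) (x ∷ xs) ds len p deg≤2 with low-or-high (x ∷ xs) (x ∷ xs)
  ... | inj₂ high = ⊥-elim (no-cycles (cycles-singular p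
        (λ m → ℕP.≤-antisym (ℕP.≤-trans (part _) (deg≤2 m)) (high m))
        (λ {w} m → ℕP.n≤0⇒n≡0 (ℕP.+-cancelˡ-≤ 2 (nbrs (ds ++ hubs) w) 0
          (ℕP.≤-trans (ℕP.+-monoˡ-≤ (nbrs (ds ++ hubs) w) (high m)) (subst (_≤ 2) (total w) (deg≤2 m)))))))
    where
    total : ∀ w → nbrs (allFin n) w ≡ nbrs (x ∷ xs) w ℕ.+ nbrs (ds ++ hubs) w
    total w = trans (sym (nbrs-↭ p w)) (nbrs-++ (x ∷ xs) (ds ++ hubs) w)
    part : ∀ w → nbrs (x ∷ xs) w ≤ nbrs (allFin n) w
    part w = subst (nbrs (x ∷ xs) w ≤_) (sym (total w)) (ℕP.m≤m+n (nbrs (x ∷ xs) w) (nbrs (ds ++ hubs) w))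
  ... | inj₁ (v , v∈ , low) with extract v∈
  ...   | ws , q = reorder (step (nbrs ws v ℕP.≟ 0))
    where
    p′ : (v ∷ ws) ++ ds ++ hubs ↭ allFin n
    p′ = Perm.↭-trans (PermP.++⁺ʳ (ds ++ hubs) (Perm.↭-sym q)) p
    deg≤2′ : ∀ {w} → w ∈ v ∷ ws → nbrs (allFin n) w ≤ 2
    deg≤2′ m = deg≤2 (∈-resp-↭ (Perm.↭-sym q) m)
    ih : Cover ws
    ih = cover-by-chains k ws (v ∷ ds) (ℕP.suc-injective (trans (sym (PermP.↭-length q)) len))
      (Perm.↭-trans (PermP.shift v ws (ds ++ hubs)) p′) (λ m → deg≤2′ (there m))
    step : Dec (nbrs ws v ≡ 0) → Cover (v ∷ ws)
    step (yes none) = isolate p′ none ih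
    step (no some)  = attach {ds = ds} p′ deg≤2′ (subst (_≤ 1) (trans (nbrs-↭ q v) (nbrs-self ws v)) low) some ih
    reorder : Cover (v ∷ ws) → Cover (x ∷ xs)
    reorder (cs , r , s) = cs , Perm.↭-trans r (Perm.↭-sym q) , s

-- Counting ends, edges and links.

∑-↭ : ∀ {A : Set} {xs ys : List A} (f : A → ℤ) → xs ↭ ys → ∑ xs f ≡ ∑ ys f
∑-↭ f Perm.refl        = refl
∑-↭ f (Perm.prep x p)  = cong (λ s → f x + s) (∑-↭ f p)
∑-↭ f (Perm.swap {xs} {ys} x y p) = trans (cong (λ s → f x + (f y + s)) (∑-↭ f p)) (lemma (f x) (f y) (∑ ys f))
  where
  lemma : ∀ a b c → a + (b + c) ≡ b + (a + c)
  lemma = solve-∀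
∑-↭ f (Perm.trans p q) = trans (∑-↭ f p) (∑-↭ f q)

∑-++ : ∀ {A : Set} (xs ys : List A) (f : A → ℤ) → ∑ (xs ++ ys) f ≡ ∑ xs f + ∑ ys f
∑-++ []       ys f = sym (ℤP.+-identityˡ (∑ ys f))
∑-++ (x ∷ xs) ys f = trans (cong (λ s → f x + s) (∑-++ xs ys f)) (sym (ℤP.+-assoc (f x) (∑ xs f) (∑ ys f)))

-- Twice `edges` is the sum of the induced degrees, which does not depend on the order of the list.
edges-↭ : ∀ {n} (G : Graph n) {vs ws} → vs ↭ ws → LowOrder.edges G vs ≡ LowOrder.edges G ws
edges-↭ G {vs} {ws} p = *-cancelˡ (+ 2) (λ ()) (trans (sym (edges-degrees vs))
  (trans (∑-cong vs (λ {u} _ → ∑-↭ (A G u) p)) (trans (∑-↭ (λ u → ∑ ws (A G u)) p) (edges-degrees ws))))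
  where open LowOrder G

endCount : Hub → Shape → ℤ
endCount h (e , _ , f) = ι e h + ι f h

ends : Hub → List Shape → ℤ
ends h ss = ∑ ss (endCount h)

module _ {n} (G : Graph n) (hub : Hub → Fin n) where
  open LowOrder G using (edges)

  chain-ends : ∀ {e vs f} → Chain G hub e vs f → ∀ h → ∑ vs (λ v → A G v (hub h)) ≡ ι e h + ι f h
  chain-ends (one p)        h = trans (ℤP.+-identityʳ (A G _ (hub h))) (p h)
  chain-ends {f = f} (cons p _ _ ch) h = cong₂ _+_ (p h) (trans (chain-ends ch h) (ℤP.+-identityˡ (ι f h)))

  links-ends : ∀ cs h → ∑ (linkVertices cs) (A G (hub h)) ≡ ends h (map (shape {hub = hub}) cs)
  links-ends []       h = refl
  links-ends (c ∷ cs) h = trans (∑-++ (vertices c) (linkVertices cs) (A G (hub h)))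
    (cong₂ _+_ (trans (∑-cong (vertices c) (λ {v} _ → A-sym G (hub h) v)) (chain-ends (chain c) h)) (links-ends cs h))

  chain-edges : ∀ {e vs f} → Chain G hub e vs f → edges vs ≡ + length vs - 1ℤ
  chain-edges (one _) = refl
  chain-edges (cons {v = v} {w = w} {vs} _ vw ap ch) = trans
    (cong₂ _+_ (chain-edges ch) (cong₂ _+_ (cong edge vw) (∑-zero vs (λ m → cong edge (proj₂ (All.lookup ap m))))))
    (lemma (+ length vs))
    where
    lemma : ∀ l → (1ℤ + l - 1ℤ) + (1ℤ + 0ℤ) ≡ 1ℤ + (1ℤ + l) - 1ℤ
    lemma = solve-∀

  edges-++ : ∀ vs ws → (∀ {u w} → u ∈ vs → w ∈ ws → Apart G u w) → edges (vs ++ ws) ≡ edges vs + edges ws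
  edges-++ []       ws ap = sym (ℤP.+-identityˡ (edges ws))
  edges-++ (v ∷ vs) ws ap = trans
    (cong₂ _+_ (edges-++ vs ws (λ u∈ → ap (there u∈)))
      (trans (∑-++ vs ws (A G v)) (cong (λ s → ∑ vs (A G v) + s) (∑-zero ws (λ w∈ → cong edge (proj₂ (ap (here refl) w∈)))))))
    (lemma (edges vs) (edges ws) (∑ vs (A G v)))
    where
    lemma : ∀ a b c → a + b + (c + 0ℤ) ≡ a + c + b
    lemma = solve-∀

  links-edges : ∀ cs → AllPairs Separate cs →
                + length (linkVertices {G = G} {hub} cs) - edges (linkVertices cs) ≡ + length cs
  links-edges []       _        = refl
  links-edges (c ∷ cs) (s ∷ ss) = trans
    (cong₂ _-_ (trans (cong +_ (ListP.length-++ (vertices c))) (ℤP.pos-+ (length (vertices c)) (length (linkVertices cs))))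
               (trans (edges-++ (vertices c) (linkVertices cs) (separate-∈ c s)) (cong (λ x → x + edges (linkVertices cs)) (chain-edges (chain c)))))
    (trans (lemma (+ length (vertices c)) (+ length (linkVertices cs)) (edges (linkVertices cs)))
      (cong (λ x → 1ℤ + x) (links-edges cs ss)))
    where
    lemma : ∀ a b c → a + b - (a - 1ℤ + c) ≡ 1ℤ + (b - c)
    lemma = solve-∀

module _ {n} {G : Graph n} (D : Decomposition G) where
  open Decomposition D
  open LowOrder G using (edges)
  private
    a = hub hubA
    b = hub hubB
    C = linkVertices links
    ss = map shape links

  ends-degree : ∀ h → ends h (shapes D) ≡ degree G (hub h)
  ends-degree h = trans (∑-++ (phantom (adj G a b)) ss (endCount h)) (trans (at h) (∑-↭ (A G (hub h)) cover))
    where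
    phantom-ends : ∀ h b → ends h (phantom b) ≡ edge b
    phantom-ends hubA true  = refl
    phantom-ends hubB true  = refl
    phantom-ends hubA false = refl
    phantom-ends hubB false = refl
    lemma₁ : ∀ x y → x + y ≡ 0ℤ + (x + y)
    lemma₁ = solve-∀
    lemma₂ : ∀ x y → x + y ≡ x + (0ℤ + y)
    lemma₂ = solve-∀
    at : ∀ h → ends h (phantom (adj G a b)) + ends h ss ≡ A G (hub h) a + (A G (hub h) b + ∑ C (A G (hub h)))
    at hubA = trans (cong₂ _+_ (phantom-ends hubA (adj G a b)) (sym (links-ends G hub links hubA)))
      (trans (lemma₁ (A G a b) (∑ C (A G a))) (cong (λ z → z + (A G a b + ∑ C (A G a))) (sym (A-irrefl G a))))
    at hubB = trans (cong₂ _+_ (trans (phantom-ends hubB (adj G a b)) (A-sym G a b)) (sym (links-ends G hub links hubB)))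
      (trans (lemma₂ (A G b a) (∑ C (A G b))) (cong (λ z → A G b a + (z + ∑ C (A G b))) (sym (A-irrefl G b))))

  -- A shape with k vertices accounts for k - 1 edges plus one for each attached end; the edge
  -- between the hubs is the case k = 0. Hence n - m is 2 plus the number of shapes minus the number
  -- of ends.
  shapes-count : + length (allFin n) - edges (allFin n) ≡ 1ℤ →
                 1ℤ + + length (shapes D) ≡ ends hubA (shapes D) + ends hubB (shapes D)
  shapes-count e = begin
    1ℤ + + length (phantom (adj G a b) ++ ss)
      ≡⟨ cong (λ l → 1ℤ + l) (trans (cong +_ (ListP.length-++ (phantom (adj G a b)))) (trans
           (ℤP.pos-+ (length (phantom (adj G a b))) (length ss))
           (cong₂ _+_ (phantom-length (adj G a b)) (trans (cong +_ (ListP.length-map shape links)) (sym (links-edges G hub links separate)))))) ⟩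
    1ℤ + (x + (l - m))                              ≡⟨ lemma₁ x l m eB eA ⟩
    (1ℤ + (1ℤ + l)) - (m + eB + (x + eA)) + (x + eA + (x + eB) - 1ℤ)
      ≡⟨ cong (λ z → z + (x + eA + (x + eB) - 1ℤ)) (trans (cong₂ _-_ (cong +_ (PermP.↭-length cover)) edges-cover) e) ⟩
    1ℤ + (x + eA + (x + eB) - 1ℤ)                   ≡⟨ lemma₂ (x + eA) (x + eB) ⟩
    (x + eA) + (x + eB)
      ≡⟨ cong₂ _+_ (ends-link hubA) (ends-link hubB) ⟩
    ends hubA (shapes D) + ends hubB (shapes D)     ∎
    where
    open ≡-Reasoning
    x = A G a b
    l = + length C
    m = edges C
    eA = ends hubA ss
    eB = ends hubB ss
    phantom-length : ∀ b → + length (phantom b) ≡ edge b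
    phantom-length true  = refl
    phantom-length false = refl
    phantom-ends : ∀ h b → edge b ≡ ends h (phantom b)
    phantom-ends hubA true  = refl
    phantom-ends hubB true  = refl
    phantom-ends hubA false = refl
    phantom-ends hubB false = refl
    ends-link : ∀ h → x + ends h ss ≡ ends h (shapes D)
    ends-link h = trans (cong (λ z → z + ends h ss) (phantom-ends h (adj G a b)))
      (sym (∑-++ (phantom (adj G a b)) ss (endCount h)))
    edges-cover : m + eB + (x + eA) ≡ edges (allFin n)
    edges-cover = trans (cong₂ (λ p q → m + p + (x + q)) (sym (links-ends G hub links hubB)) (sym (links-ends G hub links hubA)))
      (edges-↭ G cover)
    lemma₁ : ∀ x l m b a → 1ℤ + (x + (l - m)) ≡ (1ℤ + (1ℤ + l)) - (m + b + (x + a)) + (x + a + (x + b) - 1ℤ)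
    lemma₁ = solve-∀
    lemma₂ : ∀ a b → 1ℤ + (a + b - 1ℤ) ≡ a + b
    lemma₂ = solve-∀

-- Links sorted by the hubs at their ends.

record TypedLink {n} (G : Graph n) (hub : Hub → Fin n) (e f : End) : Set where
  constructor typed
  field
    {verts} : List (Fin n)
    walk    : Chain G hub e verts f

untyped : ∀ {n} {G : Graph n} {hub e f} → TypedLink G hub e f → Link G hub
untyped l = record { chain = TypedLink.walk l }

order : ∀ {n} {G : Graph n} {hub e f} → TypedLink G hub e f → ℕ
order l = length (TypedLink.verts l)

-- Chains sorted by the hubs at their two ends.
record Bins (T : End → End → Set) : Set where
  constructor bins
  field
    ab : List (T (just hubA) (just hubB))
    a  : List (T (just hubA) nothing)
    b  : List (T (just hubB) nothing)
    aa : List (T (just hubA) (just hubA))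
    bb : List (T (just hubB) (just hubB))
    nn : List (T nothing nothing)

tag : End → End → ℕ → Shape
tag e f k = e , k , f

Lengths : Set
Lengths = Bins (λ _ _ → ℕ)

render : Lengths → List Shape
render (bins ab a b aa bb nn) =
  map (tag (just hubA) (just hubB)) ab ++ (map (tag (just hubA) nothing) a ++
  (map (tag (just hubB) nothing) b ++ (map (tag (just hubA) (just hubA)) aa ++
  (map (tag (just hubB) (just hubB)) bb ++ map (tag nothing nothing) nn))))

module _ {n} {G : Graph n} {hub : Hub → Fin n} where
  private
    TL = TypedLink G hub

    shift-in : ∀ {S : Set} {x : S} (xs : List S) {ys zs} → ys ↭ x ∷ zs → xs ++ ys ↭ x ∷ xs ++ zs
    shift-in {x = x} xs {zs = zs} p = Perm.↭-trans (PermP.++⁺ˡ xs p) (PermP.shift x xs zs)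

  binned : Bins TL → List (Link G hub)
  binned (bins ab a b aa bb nn) =
    map untyped ab ++ (map untyped a ++ (map untyped b ++ (map untyped aa ++ (map untyped bb ++ map untyped nn))))

  -- Chains are reversed where necessary so that the first hub precedes the second and a hub
  -- precedes a free end; hence `c′` has only the same vertices as `c` up to order.
  insert : (c : Link G hub) (B : Bins TL) →
           ∃ λ (c′ : Link G hub) → vertices c′ ↭ vertices c × ∃ λ B′ → binned B′ ↭ c′ ∷ binned B
  insert c@(record { left = just hubA ; right = just hubB ; chain = ch }) (bins ab a b aa bb nn) =
    c , Perm.refl , bins (typed ch ∷ ab) a b aa bb nn , Perm.refl
  insert c@(record { left = just hubB ; right = just hubA ; vertices = vs ; chain = ch }) (bins ab a b aa bb nn) =
    record { chain = Chain-reverse ch } , PermP.↭-reverse vs , bins (typed (Chain-reverse ch) ∷ ab) a b aa bb nn , Perm.refl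
  insert c@(record { left = just hubA ; right = nothing ; chain = ch }) (bins ab a b aa bb nn) =
    c , Perm.refl , bins ab (typed ch ∷ a) b aa bb nn , shift-in (map untyped ab) Perm.refl
  insert c@(record { left = nothing ; right = just hubA ; vertices = vs ; chain = ch }) (bins ab a b aa bb nn) =
    record { chain = Chain-reverse ch } , PermP.↭-reverse vs , bins ab (typed (Chain-reverse ch) ∷ a) b aa bb nn ,
    shift-in (map untyped ab) Perm.refl
  insert c@(record { left = just hubB ; right = nothing ; chain = ch }) (bins ab a b aa bb nn) =
    c , Perm.refl , bins ab a (typed ch ∷ b) aa bb nn , shift-in (map untyped ab) (shift-in (map untyped a) Perm.refl)
  insert c@(record { left = nothing ; right = just hubB ; vertices = vs ; chain = ch }) (bins ab a b aa bb nn) =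
    record { chain = Chain-reverse ch } , PermP.↭-reverse vs , bins ab a (typed (Chain-reverse ch) ∷ b) aa bb nn ,
    shift-in (map untyped ab) (shift-in (map untyped a) Perm.refl)
  insert c@(record { left = just hubA ; right = just hubA ; chain = ch }) (bins ab a b aa bb nn) =
    c , Perm.refl , bins ab a b (typed ch ∷ aa) bb nn ,
    shift-in (map untyped ab) (shift-in (map untyped a) (shift-in (map untyped b) Perm.refl))
  insert c@(record { left = just hubB ; right = just hubB ; chain = ch }) (bins ab a b aa bb nn) =
    c , Perm.refl , bins ab a b aa (typed ch ∷ bb) nn ,
    shift-in (map untyped ab) (shift-in (map untyped a) (shift-in (map untyped b) (shift-in (map untyped aa) Perm.refl)))
  insert c@(record { left = nothing ; right = nothing ; chain = ch }) (bins ab a b aa bb nn) =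
    c , Perm.refl , bins ab a b aa bb (typed ch ∷ nn) ,
    shift-in (map untyped ab) (shift-in (map untyped a) (shift-in (map untyped b) (shift-in (map untyped aa)
      (shift-in (map untyped bb) Perm.refl))))

  sort : (cs : List (Link G hub)) → AllPairs Separate cs →
         ∃ λ B → linkVertices (binned B) ↭ linkVertices cs × AllPairs Separate (binned B)
  sort []       _        = bins [] [] [] [] [] [] , Perm.refl , []
  sort (c ∷ cs) (s ∷ ss) with sort cs ss
  ... | B , p , sep with insert c B
  ...   | c′ , q , B′ , r = B′ ,
    Perm.↭-trans (linkVertices-↭ r) (PermP.++⁺ q p) ,
    AllPairs-↭ (λ {x} {y} → Separate-sym {c = x} {d = y}) (Perm.↭-sym r) (All.tabulate new ∷ sep)
    where
    new : ∀ {d} → d ∈ binned B → Separate c′ d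
    new d∈ u∈ v∈ = separate-∈ c s (∈-resp-↭ q u∈) (∈-resp-↭ p (∈-concat⁺′ v∈ (∈-map⁺ vertices d∈)))

  lengths : Bins TL → Lengths
  lengths (bins ab a b aa bb nn) = bins (map order ab) (map order a) (map order b) (map order aa) (map order bb) (map order nn)

  render-lengths : ∀ B → map shape (binned B) ≡ render (lengths B)
  render-lengths (bins ab a b aa bb nn) =
    step ab (map untyped a ++ (map untyped b ++ (map untyped aa ++ (map untyped bb ++ map untyped nn))))
    (step a (map untyped b ++ (map untyped aa ++ (map untyped bb ++ map untyped nn)))
    (step b (map untyped aa ++ (map untyped bb ++ map untyped nn))
    (step aa (map untyped bb ++ map untyped nn)
    (step bb (map untyped nn) (last nn)))))
    where
    last : ∀ {e f} (ls : List (TL e f)) → map shape (map untyped ls) ≡ map (tag e f) (map order ls)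
    last []       = refl
    last (l ∷ ls) = cong (shape (untyped l) ∷_) (last ls)
    step : ∀ {e f} (ls : List (TL e f)) (rest : List (Link G hub)) {ss} → map shape rest ≡ ss →
           map shape (map untyped ls ++ rest) ≡ map (tag e f) (map order ls) ++ ss
    step []       rest p = p
    step (l ∷ ls) rest p = cong (shape (untyped l) ∷_) (step ls rest p)

  order-positive : ∀ {e f} (l : TL e f) → 1 ≤ order l
  order-positive (typed (one _))        = s≤s z≤n
  order-positive (typed (cons _ _ _ _)) = s≤s z≤n

  orders-positive : ∀ {e f} (ls : List (TL e f)) → All (1 ≤_) (map order ls)
  orders-positive []       = []
  orders-positive (l ∷ ls) = order-positive l ∷ orders-positive ls

-- From the degree bound to two hubs and a normal form.

excess : ℕ → ℕ
excess 0                   = 2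
excess 1                   = 0
excess 2                   = 0
excess (suc (suc (suc d))) = suc (suc d) ℕ.* suc d

+excess : ∀ d → + excess d ≡ (+ d - 1ℤ) * (+ d - + 2)
+excess 0                   = refl
+excess 1                   = refl
+excess 2                   = refl
+excess (suc (suc (suc d))) = trans (ℤP.pos-* (suc (suc d)) (suc d)) (lemma (+ d))
  where
  lemma : ∀ d → (+ 2 + d) * (1ℤ + d) ≡ (+ 3 + d - 1ℤ) * (+ 3 + d - + 2)
  lemma = solve-∀

excess-pos : ∀ d → excess d ≢ 0 → 2 ≤ excess d
excess-pos 0                   _ = s≤s (s≤s z≤n)
excess-pos 1                   n = ⊥-elim (n refl)
excess-pos 2                   n = ⊥-elim (n refl)
excess-pos (suc (suc (suc d))) _ = ℕP.≤-trans (s≤s (s≤s z≤n)) (ℕP.m≤m*n (suc (suc d)) (suc d))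

excess-≤2 : ∀ d → excess d ≡ 0 → d ≤ 2
excess-≤2 1 _ = s≤s z≤n
excess-≤2 2 _ = s≤s (s≤s z≤n)

excess-≤3 : ∀ d → excess d ≤ 4 → d ≤ 3
excess-≤3 0 _ = z≤n
excess-≤3 1 _ = s≤s z≤n
excess-≤3 2 _ = s≤s (s≤s z≤n)
excess-≤3 3 _ = s≤s (s≤s (s≤s z≤n))
excess-≤3 (suc (suc (suc (suc d)))) p = ⊥-elim (ℕP.<⇒≱ (ℕP.≤-trans (ℕP.m≤m+n 5 1)
  (ℕP.*-mono-≤ {3} {suc (suc (suc d))} {2} {suc (suc d)} (s≤s (s≤s (s≤s z≤n))) (s≤s (s≤s z≤n)))) p)

total : {A : Set} → (A → ℕ) → List A → ℕ
total f []       = 0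
total f (x ∷ xs) = f x ℕ.+ total f xs

+total : {A : Set} (f : A → ℕ) (xs : List A) → + total f xs ≡ ∑ xs (λ x → + f x)
+total f []       = refl
+total f (x ∷ xs) = trans (ℤP.pos-+ (f x) (total f xs)) (cong (λ s → + f x + s) (+total f xs))

record Sorted {A : Set} (f : A → ℕ) (xs : List A) : Set where
  field
    special ordinary : List A
    sorted           : special ++ ordinary ↭ xs
    nonzero          : All (λ x → f x ≢ 0) special
    zeros            : All (λ x → f x ≡ 0) ordinary

sort-zeros : {A : Set} (f : A → ℕ) (xs : List A) → Sorted f xs
sort-zeros f []       = record { special = [] ; ordinary = [] ; sorted = Perm.refl ; nonzero = [] ; zeros = [] }
sort-zeros f (x ∷ xs) with f x ℕP.≟ 0 | sort-zeros f xs
... | no ne | s = record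
  { special = x ∷ special ; ordinary = ordinary ; sorted = Perm.prep x sorted ; nonzero = ne ∷ nonzero ; zeros = zeros }
  where open Sorted s
... | yes e | s = record
  { special = special ; ordinary = x ∷ ordinary
  ; sorted = Perm.↭-trans (PermP.shift x special ordinary) (Perm.prep x sorted)
  ; nonzero = nonzero ; zeros = e ∷ zeros }
  where open Sorted s

record TwoHubs {n} (G : Graph n) : Set where
  open Neighbours G
  field
    x y  : Fin n
    rest : List (Fin n)
    perm : x ∷ y ∷ rest ↭ allFin n
    x≤3  : nbrs (allFin n) x ≤ 3
    y≤3  : nbrs (allFin n) y ≤ 3
    low  : ∀ {w} → w ∈ rest → nbrs (allFin n) w ≤ 2

module _ {n} {G : Graph n} {j : ℕ} (S : PathSpectrum G j) where
  open Neighbours G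
  private
    deg : Fin n → ℕ
    deg = nbrs (allFin n)
    f : Fin n → ℕ
    f v = excess (deg v)

    total-≤4 : total f (allFin n) ≤ 4
    total-≤4 = ℤP.drop‿+≤+ (subst (ℤ._≤ + 4) (sym (trans (+total f (allFin n)) (∑-cong (allFin n) (λ {v} _ →
      trans (+excess (deg v)) (cong (λ d → (d - 1ℤ) * (d - + 2)) (+nbrs (allFin n) v)))))) (excess-bound S))

    total-↭ : ∀ {xs ys} → xs ↭ ys → total f xs ≡ total f ys
    total-↭ {xs} {ys} p = ℤP.+-injective (trans (+total f xs) (trans (∑-↭ (λ x → + f x) p) (sym (+total f ys))))

    z⇒≤2 : ∀ {v} → f v ≡ 0 → deg v ≤ 2
    z⇒≤2 {v} = excess-≤2 (deg v)
    ≤2⇒≤3 : ∀ {v} → deg v ≤ 2 → deg v ≤ 3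
    ≤2⇒≤3 p = ℕP.m≤n⇒m≤1+n p

  -- A nonzero excess is at least 2, so a total of 4 allows at most two exceptional vertices. These
  -- have degree 0 or 3, since degree 4 would already cost 6. If there are fewer than two, vertices
  -- of degree 1 or 2 fill the places.
  two-hubs : 2 ≤ n → TwoHubs G
  two-hubs 2≤n = choose special ordinary sorted nonzero zeros
    where
    open Sorted (sort-zeros f (allFin n))
    choose : ∀ sp or → sp ++ or ↭ allFin n → All (λ x → f x ≢ 0) sp → All (λ x → f x ≡ 0) or → TwoHubs G
    choose [] (x ∷ y ∷ rest) p _ (zx ∷ zy ∷ zs) = record
      { perm = p ; x≤3 = ≤2⇒≤3 (z⇒≤2 zx) ; y≤3 = ≤2⇒≤3 (z⇒≤2 zy) ; low = λ m → z⇒≤2 (All.lookup zs m) }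
    choose (x ∷ []) (y ∷ rest) p _ (zy ∷ zs) = record
      { perm = p ; x≤3 = excess-≤3 (deg x) (ℕP.≤-trans (ℕP.m≤m+n (f x) (total f (y ∷ rest))) (subst (_≤ 4) (sym (total-↭ p)) total-≤4))
      ; y≤3 = ≤2⇒≤3 (z⇒≤2 zy) ; low = λ m → z⇒≤2 (All.lookup zs m) }
    choose (x ∷ y ∷ []) rest p _ zs = record
      { perm = p
      ; x≤3 = excess-≤3 (deg x) (ℕP.≤-trans (ℕP.m≤m+n (f x) (total f (y ∷ rest))) bound)
      ; y≤3 = excess-≤3 (deg y) (ℕP.≤-trans (ℕP.≤-trans (ℕP.m≤m+n (f y) (total f rest)) (ℕP.m≤n+m (f y ℕ.+ total f rest) (f x))) bound)
      ; low = λ m → z⇒≤2 (All.lookup zs m) }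
      where
      bound : total f (x ∷ y ∷ rest) ≤ 4
      bound = subst (_≤ 4) (sym (total-↭ p)) total-≤4
    choose (x ∷ y ∷ z ∷ sp) or p (nx ∷ ny ∷ nz ∷ _) _ = ⊥-elim (ℕP.<⇒≱ (ℕP.≤-trans (ℕP.m≤m+n 5 1)
      (ℕP.+-mono-≤ (excess-pos (deg x) nx) (ℕP.+-mono-≤ (excess-pos (deg y) ny)
        (ℕP.≤-trans (excess-pos (deg z) nz) (ℕP.m≤m+n (f z) (total f (sp ++ or)))))))
      (subst (_≤ 4) (sym (total-↭ p)) total-≤4))
    choose [] [] p _ _ = ⊥-elim (ℕP.<⇒≱ 2≤n (ℕP.≤-trans (ℕP.≤-reflexive (trans (sym (ListP.length-tabulate {n = n} (λ i → i))) (sym (PermP.↭-length p)))) z≤n))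
    choose [] (x ∷ []) p _ _ = ⊥-elim (ℕP.<⇒≱ 2≤n (ℕP.≤-reflexive (trans (sym (ListP.length-tabulate {n = n} (λ i → i))) (sym (PermP.↭-length p)))))
    choose (x ∷ []) [] p _ _ = ⊥-elim (ℕP.<⇒≱ 2≤n (ℕP.≤-reflexive (trans (sym (ListP.length-tabulate {n = n} (λ i → i))) (sym (PermP.↭-length p)))))

ends-map : ∀ h e f ks ss → ends h (map (tag e f) ks ++ ss) ≡ (ι e h + ι f h) * + length ks + ends h ss
ends-map h e f []       ss = lemma (ι e h) (ι f h) (ends h ss)
  where
  lemma : ∀ a b s → s ≡ (a + b) * 0ℤ + s
  lemma = solve-∀
ends-map h e f (k ∷ ks) ss = trans (cong (λ s → ι e h + ι f h + s) (ends-map h e f ks ss))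
  (lemma (ι e h) (ι f h) (+ length ks) (ends h ss))
  where
  lemma : ∀ a b l s → a + b + ((a + b) * l + s) ≡ (a + b) * (1ℤ + l) + s
  lemma = solve-∀

length-render-map : ∀ e f ks ss → + length (map (tag e f) ks ++ ss) ≡ + length ks + + length ss
length-render-map e f ks ss = trans (cong +_ (trans (ListP.length-++ (map (tag e f) ks))
  (cong (ℕ._+ length ss) (ListP.length-map (tag e f) ks)))) (ℤP.pos-+ (length ks) (length ss))

module _ (ab a b aa bb nn : List ℕ) where
  private
    L = bins {T = λ _ _ → ℕ} ab a b aa bb nn
    s₅ = map (tag nothing nothing) nn
    s₄ = map (tag (just hubB) (just hubB)) bb ++ s₅
    s₃ = map (tag (just hubA) (just hubA)) aa ++ s₄
    s₂ = map (tag (just hubB) nothing) b ++ s₃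
    s₁ = map (tag (just hubA) nothing) a ++ s₂
    # : List ℕ → ℤ
    # ks = + length ks

  render-ends : ∀ h → ends h (render L) ≡ (ι (just hubA) h + ι (just hubB) h) * # ab + ((ι (just hubA) h + 0ℤ) * # a +
                ((ι (just hubB) h + 0ℤ) * # b + ((ι (just hubA) h + ι (just hubA) h) * # aa +
                ((ι (just hubB) h + ι (just hubB) h) * # bb + ((0ℤ + 0ℤ) * # nn + 0ℤ)))))
  render-ends h = begin
    ends h (render L)                  ≡⟨ ends-map h (just hubA) (just hubB) ab s₁ ⟩
    (A′ + B′) * # ab + ends h s₁       ≡⟨ cong (λ x → (A′ + B′) * # ab + x) (trans (ends-map h (just hubA) nothing a s₂)
      (cong (λ x → (A′ + 0ℤ) * # a + x) (trans (ends-map h (just hubB) nothing b s₃)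
      (cong (λ x → (B′ + 0ℤ) * # b + x) (trans (ends-map h (just hubA) (just hubA) aa s₄)
      (cong (λ x → (A′ + A′) * # aa + x) (trans (ends-map h (just hubB) (just hubB) bb s₅)
      (cong (λ x → (B′ + B′) * # bb + x) (trans (cong (ends h) (sym (ListP.++-identityʳ s₅))) (ends-map h nothing nothing nn []))))))))))  ⟩
    (A′ + B′) * # ab + ((A′ + 0ℤ) * # a + ((B′ + 0ℤ) * # b + ((A′ + A′) * # aa + ((B′ + B′) * # bb + ((0ℤ + 0ℤ) * # nn + 0ℤ))))) ∎
    where
    open ≡-Reasoning
    A′ = ι (just hubA) h
    B′ = ι (just hubB) h

  render-length : + length (render L) ≡ # ab + (# a + (# b + (# aa + (# bb + # nn))))
  render-length = trans (length-render-map (just hubA) (just hubB) ab s₁) (cong (λ x → # ab + x)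
    (trans (length-render-map (just hubA) nothing a s₂) (cong (λ x → # a + x)
    (trans (length-render-map (just hubB) nothing b s₃) (cong (λ x → # b + x)
    (trans (length-render-map (just hubA) (just hubA) aa s₄) (cong (λ x → # aa + x)
    (trans (length-render-map (just hubB) (just hubB) bb s₅) (cong (λ x → # bb + x)
      (cong +_ (ListP.length-map (tag nothing nothing) nn)))))))))))

  ends-A : ends hubA (render L) ≡ + (length ab ℕ.+ length a ℕ.+ (length aa ℕ.+ length aa))
  ends-A = trans (render-ends hubA) (trans (lemma (# ab) (# a) (# b) (# aa) (# bb) (# nn))
    (sym (trans (ℤP.pos-+ (length ab ℕ.+ length a) (length aa ℕ.+ length aa))
      (cong₂ _+_ (ℤP.pos-+ (length ab) (length a)) (ℤP.pos-+ (length aa) (length aa))))))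
    where
    lemma : ∀ ab a b aa bb nn → (1ℤ + 0ℤ) * ab + ((1ℤ + 0ℤ) * a + ((0ℤ + 0ℤ) * b + ((1ℤ + 1ℤ) * aa +
            ((0ℤ + 0ℤ) * bb + ((0ℤ + 0ℤ) * nn + 0ℤ))))) ≡ ab + a + (aa + aa)
    lemma = solve-∀

  ends-B : ends hubB (render L) ≡ + (length ab ℕ.+ length b ℕ.+ (length bb ℕ.+ length bb))
  ends-B = trans (render-ends hubB) (trans (lemma (# ab) (# a) (# b) (# aa) (# bb) (# nn))
    (sym (trans (ℤP.pos-+ (length ab ℕ.+ length b) (length bb ℕ.+ length bb))
      (cong₂ _+_ (ℤP.pos-+ (length ab) (length b)) (ℤP.pos-+ (length bb) (length bb))))))
    where
    lemma : ∀ ab a b aa bb nn → (0ℤ + 1ℤ) * ab + ((0ℤ + 0ℤ) * a + ((1ℤ + 0ℤ) * b + ((0ℤ + 0ℤ) * aa +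
            ((1ℤ + 1ℤ) * bb + ((0ℤ + 0ℤ) * nn + 0ℤ))))) ≡ ab + b + (bb + bb)
    lemma = solve-∀

  -- Links in `ab`, `aa`, `bb` have two attached ends, those in `a` and `b` one, free paths none;
  -- the links with one end cancel from the two sides.
  nn-count : 1ℤ + + length (render L) ≡ ends hubA (render L) + ends hubB (render L) →
             suc (length nn) ≡ length ab ℕ.+ length aa ℕ.+ length bb
  nn-count e = ℤP.+-injective (begin
    1ℤ + # nn                             ≡⟨ lemma₁ (# ab) (# a) (# b) (# aa) (# bb) (# nn) ⟩
    1ℤ + (# ab + (# a + (# b + (# aa + (# bb + # nn))))) - (# ab + # a + # b + # aa + # bb)
      ≡⟨ cong (λ x → x - (# ab + # a + # b + # aa + # bb)) (trans (cong (λ x → 1ℤ + x) (sym render-length)) (trans e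
           (cong₂ _+_ (trans ends-A (plus ab a aa)) (trans ends-B (plus ab b bb))))) ⟩
    # ab + # a + (# aa + # aa) + (# ab + # b + (# bb + # bb)) - (# ab + # a + # b + # aa + # bb)
      ≡⟨ lemma₂ (# ab) (# a) (# b) (# aa) (# bb) ⟩
    # ab + # aa + # bb                    ≡⟨ sym (trans (ℤP.pos-+ (length ab ℕ.+ length aa) (length bb))
                                               (cong (λ x → x + # bb) (ℤP.pos-+ (length ab) (length aa)))) ⟩
    + (length ab ℕ.+ length aa ℕ.+ length bb) ∎)
    where
    open ≡-Reasoning
    plus : ∀ x y z → + (length x ℕ.+ length y ℕ.+ (length z ℕ.+ length z)) ≡ # x + # y + (# z + # z)
    plus x y z = trans (ℤP.pos-+ (length x ℕ.+ length y) (length z ℕ.+ length z))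
      (cong₂ _+_ (ℤP.pos-+ (length x) (length y)) (ℤP.pos-+ (length z) (length z)))
    lemma₁ : ∀ ab a b aa bb nn → 1ℤ + nn ≡ 1ℤ + (ab + (a + (b + (aa + (bb + nn))))) - (ab + a + b + aa + bb)
    lemma₁ = solve-∀
    lemma₂ : ∀ ab a b aa bb → ab + a + (aa + aa) + (ab + b + (bb + bb)) - (ab + a + b + aa + bb) ≡ ab + aa + bb
    lemma₂ = solve-∀

-- `free` expresses n - m = 1. Lengths in `ab` may be 0, as the edge between the hubs is recorded
-- there.
record Admissible (L : Lengths) : Set where
  open Bins L
  field
    degA   : length ab ℕ.+ length a ℕ.+ (length aa ℕ.+ length aa) ≤ 3
    degB   : length ab ℕ.+ length b ℕ.+ (length bb ℕ.+ length bb) ≤ 3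
    free   : suc (length nn) ≡ length ab ℕ.+ length aa ℕ.+ length bb
    a-pos  : All (1 ≤_) a
    b-pos  : All (1 ≤_) b
    aa-pos : All (1 ≤_) aa
    bb-pos : All (1 ≤_) bb
    nn-pos : All (1 ≤_) nn

record NormalForm {n} (G : Graph n) : Set where
  field
    decomposition : Decomposition G
    lens          : Lengths
    shapes≡       : shapes decomposition ≡ render lens
    admissible    : Admissible lens

-- The condition j ≠ 5 enters through `Φ-at-1`, which rules out cycle components.
normal-form : ∀ {n} {G : Graph n} {j} → PathSpectrum G j → j ≢ 5 → 2 ≤ n → NormalForm G
normal-form {n} {G} {j} S j≢5 2≤n = assemble (cover-by-chains _ rest [] refl all′ low)
  where
  open TwoHubs (two-hubs S 2≤n)
  hub : Hub → Fin n
  hub hubA = x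
  hub hubB = y
  open ChainCover G hub (λ e → j≢5 (Φ-at-1 S e))
  open Neighbours G
  all′ : rest ++ hubs ↭ allFin n
  all′ = Perm.↭-trans (PermP.++-comm rest hubs) perm
  uq : Unique (x ∷ y ∷ rest)
  uq = Unique-↭ (Perm.↭-sym perm) (UniqueP.allFin⁺ n)
  x≢y : x ≢ y
  x≢y with uq
  ... | (p ∷ _) ∷ _ = p
  off : ∀ h {v} → v ∈ rest → v ≢ hub h
  off hubA m e with uq
  ... | (_ ∷ p) ∷ _ = All.lookup p m (sym e)
  off hubB m e with uq
  ... | _ ∷ (p ∷ _) = All.lookup p m (sym e)

  assemble : (∃ λ cs → linkVertices cs ↭ rest × AllPairs Separate cs) → NormalForm G
  assemble (cs , p , sep) with sort cs sep
  ... | B , q , sep′ = finish (adj G x y) refl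
    where
    D : Decomposition G
    D = record
      { hub = hub ; links = binned B ; hubA≢hubB = x≢y ; separate = sep′
      ; off-hub = λ h m → off h (∈-resp-↭ (Perm.↭-trans q p) m)
      ; cover = Perm.↭-trans (Perm.prep x (Perm.prep y (Perm.↭-trans q p))) perm }
    degree-≤3 : ∀ h {k} → ends h (shapes D) ≡ + k → k ≤ 3
    degree-≤3 hubA e = subst (_≤ 3) (ℤP.+-injective (trans (+nbrs (allFin n) x) (trans (sym (ends-degree D hubA)) e))) x≤3
    degree-≤3 hubB e = subst (_≤ 3) (ℤP.+-injective (trans (+nbrs (allFin n) y) (trans (sym (ends-degree D hubB)) e))) y≤3
    build : ∀ ab a b aa bb nn → shapes D ≡ render (bins ab a b aa bb nn) →
            All (1 ≤_) a → All (1 ≤_) b → All (1 ≤_) aa → All (1 ≤_) bb → All (1 ≤_) nn → NormalForm G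
    build ab a b aa bb nn e pa pb paa pbb pnn = record
      { decomposition = D ; lens = bins ab a b aa bb nn ; shapes≡ = e ; admissible = record
        { degA = degree-≤3 hubA (trans (cong (ends hubA) e) (ends-A ab a b aa bb nn))
        ; degB = degree-≤3 hubB (trans (cong (ends hubB) e) (ends-B ab a b aa bb nn))
        ; free = nn-count ab a b aa bb nn
            (trans (cong (λ ss → 1ℤ + + length ss) (sym e)) (trans (shapes-count D (edge-count S))
              (cong₂ _+_ (cong (ends hubA) e) (cong (ends hubB) e))))
        ; a-pos = pa ; b-pos = pb ; aa-pos = paa ; bb-pos = pbb ; nn-pos = pnn } }
    open Bins (lengths B) renaming (ab to ab′; a to a′; b to b′; aa to aa′; bb to bb′; nn to nn′)
    finish : ∀ β → adj G x y ≡ β → NormalForm G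
    finish true  e = build (0 ∷ ab′) a′ b′ aa′ bb′ nn′
      (trans (cong (λ β → phantom β ++ map shape (binned B)) e) (cong (λ ss → (just hubA , 0 , just hubB) ∷ ss) (render-lengths B)))
      (orders-positive (Bins.a B)) (orders-positive (Bins.b B)) (orders-positive (Bins.aa B)) (orders-positive (Bins.bb B)) (orders-positive (Bins.nn B))
    finish false e = build ab′ a′ b′ aa′ bb′ nn′
      (trans (cong (λ β → phantom β ++ map shape (binned B)) e) (render-lengths B))
      (orders-positive (Bins.a B)) (orders-positive (Bins.b B)) (orders-positive (Bins.aa B)) (orders-positive (Bins.bb B)) (orders-positive (Bins.nn B))

-- Congruences modulo powers of t.

record _≈_[_] (x y m : ℤ) : Set where
  constructor congruent
  field
    difference : m divides (x - y)

module Congruence {m : ℤ} where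

  ≈-reflexive : ∀ {x y} → x ≡ y → x ≈ y [ m ]
  ≈-reflexive {x} refl = congruent (factor 0ℤ (trans (ℤP.i≡j⇒i-j≡0 {x} refl) (sym (ℤP.*-zeroʳ m))))

  ≈-refl : ∀ {x} → x ≈ x [ m ]
  ≈-refl = ≈-reflexive refl

  ≈-+ : ∀ {x x′ y y′} → x ≈ x′ [ m ] → y ≈ y′ [ m ] → (x + y) ≈ (x′ + y′) [ m ]
  ≈-+ {x} {x′} {y} {y′} (congruent (factor d p)) (congruent (factor e q)) = congruent (factor (d + e)
    (trans (lemma x x′ y y′) (trans (cong₂ _+_ p q) (sym (ℤP.*-distribˡ-+ m d e)))))
    where
    lemma : ∀ x x′ y y′ → x + y - (x′ + y′) ≡ (x - x′) + (y - y′)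
    lemma = solve-∀

  ≈-- : ∀ {x x′ y y′} → x ≈ x′ [ m ] → y ≈ y′ [ m ] → (x - y) ≈ (x′ - y′) [ m ]
  ≈-- {x} {x′} {y} {y′} (congruent (factor d p)) (congruent (factor e q)) = congruent (factor (d - e)
    (trans (lemma x x′ y y′) (trans (cong₂ _-_ p q) (lemma′ m d e))))
    where
    lemma : ∀ x x′ y y′ → x - y - (x′ - y′) ≡ (x - x′) - (y - y′)
    lemma = solve-∀
    lemma′ : ∀ m d e → m * d - m * e ≡ m * (d - e)
    lemma′ = solve-∀

  ≈-* : ∀ {x x′ y y′} → x ≈ x′ [ m ] → y ≈ y′ [ m ] → (x * y) ≈ (x′ * y′) [ m ]
  ≈-* {x} {x′} {y} {y′} (congruent (factor d p)) (congruent (factor e q)) = congruent (factor (d * y + x′ * e)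
    (trans (lemma x x′ y y′) (trans (cong₂ (λ u v → u * y + x′ * v) p q) (lemma′ m d e x′ y))))
    where
    lemma : ∀ x x′ y y′ → x * y - x′ * y′ ≡ (x - x′) * y + x′ * (y - y′)
    lemma = solve-∀
    lemma′ : ∀ m d e x y → m * d * y + x * (m * e) ≡ m * (d * y + x * e)
    lemma′ = solve-∀

  ≈-both : ∀ {x y} → m divides x → m divides y → x ≈ y [ m ]
  ≈-both dx dy = congruent (divides-+ dx (divides-neg dy))

open Congruence

pow-divides : ∀ t {s r} → s ≤ r → (t ^ s) divides (t ^ r)
pow-divides t {s} {r} p = factor (t ^ (r ℕ.∸ s)) (trans (cong (t ^_) (sym (ℕP.m+[n∸m]≡n p))) (ℤP.^-distribˡ-+-* t s (r ℕ.∸ s)))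

pow-square : ∀ t k → t ^ k * t ^ k ≡ t ^ (k ℕ.+ k)
pow-square t k = sym (ℤP.^-distribˡ-+-* t k k)

bracket-+ : ∀ t k l → bracket t (k ℕ.+ l) ≡ bracket t k + t ^ k * t ^ k * bracket t l
bracket-+ t zero    l = lemma (bracket t l)
  where
  lemma : ∀ b → b ≡ 0ℤ + 1ℤ * 1ℤ * b
  lemma = solve-∀
bracket-+ t (suc k) l = trans (cong (λ b → 1ℤ + t * t * b) (bracket-+ t k l)) (lemma t (bracket t k) (t ^ k) (bracket t l))
  where
  lemma : ∀ t b p c → 1ℤ + t * t * (b + p * p * c) ≡ 1ℤ + t * t * b + t * p * (t * p) * c
  lemma = solve-∀

-- The two geometric sums agree until the shorter one stops, at the exponent 2 min(k, l).
bracket-≈ : ∀ t s {k l} → s ≤ k ℕ.+ k → s ≤ l ℕ.+ l → bracket t k ≈ bracket t l [ t ^ s ]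
bracket-≈ t s {k} {l} p q with ℕP.≤-total k l
... | inj₁ k≤l = congruent (subst ((t ^ s) divides_) (sym (trans
  (cong (λ x → bracket t k - x) (trans (cong (bracket t) (sym (ℕP.m+[n∸m]≡n k≤l))) (bracket-+ t k (l ℕ.∸ k))))
  (lemma (bracket t k) (t ^ k * t ^ k) (bracket t (l ℕ.∸ k)))))
  (divides-*ˡ (- bracket t (l ℕ.∸ k)) (subst ((t ^ s) divides_) (sym (pow-square t k)) (pow-divides t p))))
  where
  lemma : ∀ b p c → b - (b + p * c) ≡ (- c) * p
  lemma = solve-∀
... | inj₂ l≤k = congruent (subst ((t ^ s) divides_) (sym (trans
  (cong (λ x → x - bracket t l) (trans (cong (bracket t) (sym (ℕP.m+[n∸m]≡n l≤k))) (bracket-+ t l (k ℕ.∸ l))))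
  (lemma (bracket t l) (t ^ l * t ^ l) (bracket t (k ℕ.∸ l)))))
  (divides-*ˡ (bracket t (k ℕ.∸ l)) (subst ((t ^ s) divides_) (sym (pow-square t l)) (pow-divides t q))))
  where
  lemma : ∀ b p c → b + p * c - b ≡ c * p
  lemma = solve-∀

-- The finite search over chain lengths.

record LensEquation (τ : ℕ) (L : Lengths) (j : ℕ) : Set where
  field
    equation : (1ℤ - + τ * + τ) * schurDet (+ τ) (render L) ≡ weight (+ τ) (render L) * reduced (+ τ) ((+ τ) ^ suc j)

-- The equation is tested at one integer t modulo growing powers of t. A length too large to matter
-- modulo the current power is left unknown and evaluated as a fixed length, cap.

data Kind : Set where
  target AB-link A-leg B-leg A-loop B-loop free-path : Kind

-- The exponent of the first power of t through which a chain of k vertices is visible.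
visible : Kind → ℕ → ℕ
visible AB-link k = suc k
visible A-loop k = suc k
visible B-loop k = suc k
visible _  k = suc k ℕ.+ suc k

-- For a link of length k, `x`, `c` and `p` hold [k + 1], t² [k] and the power of t with exponent k
-- + 1, the last replaced by 0 unless both ends are attached. For the target, `x` holds the reduced
-- Φ. They are stored to be computed once per length.
record Slot : Set where
  constructor slot
  field
    known : Maybe ℕ
    x c p : ℤ

-- `N` is the weight of the links processed so far; `SA`, `SB`, `SC` are the entries of `hubSum` at
-- the pairs of hubs AA, BB and AB.
record Acc : Set where
  constructor acc
  field
    N SA SB SC : ℤ

-- Excluded lengths: the target is never H₁₀ or H₁₃, and only a chain joining the hubs may be empty.
allowed : Kind → ℕ → Bool
allowed target 0       = false
allowed target 3       = false
allowed target _       = true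
allowed AB-link     _       = true
allowed _      zero    = false
allowed _      (suc _) = true

module Search (τ cap : ℕ) {{nz : ℕ.NonZero τ}} where

  t : ℤ
  t = + τ

  valX : Kind → ℕ → ℤ
  valX target k = reduced t (t ^ suc k)
  valX _      k = bracket t (suc k)

  valC : Kind → ℕ → ℤ
  valC target k = 0ℤ
  valC _      k = t * t * bracket t k

  valP : Kind → ℕ → ℤ
  valP AB-link k = t ^ suc k
  valP A-loop k = t ^ suc k
  valP B-loop k = t ^ suc k
  valP _  k = 0ℤ

  exact : Kind → ℕ → Slot
  exact κ k = slot (just k) (valX κ k) (valC κ k) (valP κ k)

  unknown : Kind → Slot
  unknown κ = slot nothing (valX κ cap) (valC κ cap) (valP κ cap)

  add : Kind → Slot → Acc → Acc
  add target _              A                  = A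
  add AB-link     (slot _ x c p) (acc N SA SB SC) = acc (x * N) (x * SA + N * c) (x * SB + N * c) (x * SC + N * p)
  add A-leg      (slot _ x c p) (acc N SA SB SC) = acc (x * N) (x * SA + N * c) (x * SB) (x * SC)
  add B-leg      (slot _ x c p) (acc N SA SB SC) = acc (x * N) (x * SA) (x * SB + N * c) (x * SC)
  add A-loop     (slot _ x c p) (acc N SA SB SC) = acc (x * N) (x * SA + N * (c + c + (p + p))) (x * SB) (x * SC)
  add B-loop     (slot _ x c p) (acc N SA SB SC) = acc (x * N) (x * SA) (x * SB + N * (c + c + (p + p))) (x * SC)
  add free-path     (slot _ x c p) (acc N SA SB SC) = acc (x * N) (x * SA) (x * SB) (x * SC)

  accumulate : List Kind → List Slot → Acc
  accumulate (κ ∷ κs) (s ∷ ss) = add κ s (accumulate κs ss)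
  accumulate _        _        = acc 1ℤ 0ℤ 0ℤ 0ℤ

  -- The difference of the two sides of `LensEquation`, for accumulated links and a reduced Φ equal
  -- to `R`.
  finish : Acc → ℤ → ℤ
  finish (acc N SA SB SC) R =
    (1ℤ - t * t) * ((N * (1ℤ + t * t) - SA) * (N * (1ℤ + t * t) - SB) - SC * SC) - N * R

  residual : List Kind → List Slot → ℤ
  residual (target ∷ κs) (s ∷ ss) = finish (accumulate κs ss) (Slot.x s)
  residual _             _        = 0ℤ

  -- Stage m works modulo the power of τ with exponent m + 1, where a length whose visibility
  -- exceeds m has no influence.
  check : ℕ → List Kind → List Slot → Bool
  check m κs ss = (ℤ.∣ residual κs ss ∣ % (τ ℕ.^ suc m)) {{ℕP.m^n≢0 τ (suc m)}} ≡ᵇ 0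

  newLengths : ℕ → Kind → List ℕ
  newLengths m κ = filterᵇ (λ k → (visible κ k ≡ᵇ suc m) ∧ allowed κ k) (upTo cap)

  pick : Slot → List Slot → List Slot
  pick s@(slot (just _) _ _ _) os = s ∷ []
  pick s@(slot nothing  _ _ _) os = s ∷ os

  choices : List (List Slot) → List Slot → List (List Slot)
  choices (os ∷ oss) (s ∷ ss) = concatMap (λ s′ → map (s′ ∷_) (choices oss ss)) (pick s os)
  choices _          _        = [] ∷ []

  -- Branch and prune: each unknown slot takes one of the lengths that become visible at the new
  -- exponent or stays unknown, and combinations violating the congruence are dropped.
  states : ℕ → List Kind → List (List Slot)
  states zero    κs = map unknown κs ∷ []
  states (suc m) κs = filterᵇ (check (suc m) κs)
    (concatMap (choices (map (λ κ → map (exact κ) (newLengths m κ)) κs)) (states m κs))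

  is2 : Slot → Bool
  is2 (slot (just k) _ _ _) = k ≡ᵇ 2
  is2 (slot nothing  _ _ _) = false

  -- The two skipped slots are the target and the link between the hubs, whose lengths are compared
  -- later through the order of the graph. A pendant path still unknown counts as failure.
  legs2 : List Slot → Bool
  legs2 (_ ∷ _ ∷ s₁ ∷ s₂ ∷ s₃ ∷ s₄ ∷ []) = is2 s₁ ∧ is2 s₂ ∧ is2 s₃ ∧ is2 s₄
  legs2 _                                = false

kinds : (n₁ n₂ n₃ n₄ n₅ n₆ : ℕ) → List Kind
kinds n₁ n₂ n₃ n₄ n₅ n₆ = target ∷ replicate n₁ AB-link ++ (replicate n₂ A-leg ++ (replicate n₃ B-leg ++
  (replicate n₄ A-loop ++ (replicate n₅ B-loop ++ replicate n₆ free-path))))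

isTree : (ab a b aa bb : ℕ) → Bool
isTree 1 2 2 0 0 = true
isTree _ _ _ _ _ = false

every : ℕ → (ℕ → Bool) → Bool
every zero    f = true
every (suc n) f = f n ∧ every n f

module _ where
  -- With base 16 and depth 14 only the desired tree is left. Its pendant paths of two vertices are
  -- visible from exponent 6 on; longer distances between the hubs may remain unknown.
  open Search 16 14

  -- The number of free paths follows from the other counts by `free` of `Admissible`. The guard
  -- selects the admissible counts; the others pass vacuously.
  verdict : (ab a b aa bb : ℕ) → Bool
  verdict n₁ n₂ n₃ n₄ n₅ =
    if (n₁ ℕ.+ n₂ ℕ.+ (n₄ ℕ.+ n₄) ≤ᵇ 3) ∧ (n₁ ℕ.+ n₃ ℕ.+ (n₅ ℕ.+ n₅) ≤ᵇ 3) ∧ not (n₁ ℕ.+ n₄ ℕ.+ n₅ ≡ᵇ 0)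
    then all (λ s → isTree n₁ n₂ n₃ n₄ n₅ ∧ legs2 s) (states 14 (kinds n₁ n₂ n₃ n₄ n₅ (n₁ ℕ.+ n₄ ℕ.+ n₅ ℕ.∸ 1)))
    else true

  verdict₄ : (n₁ n₂ n₃ n₄ : ℕ) → Bool
  verdict₄ n₁ n₂ n₃ n₄ = every 2 (verdict n₁ n₂ n₃ n₄)

  verdict₃ : (n₁ n₂ n₃ : ℕ) → Bool
  verdict₃ n₁ n₂ n₃ = every 2 (verdict₄ n₁ n₂ n₃)

  verdict₂ : (n₁ n₂ : ℕ) → Bool
  verdict₂ n₁ n₂ = every 4 (verdict₃ n₁ n₂)

  verdict₁ : ℕ → Bool
  verdict₁ n₁ = every 4 (verdict₂ n₁)

  -- The search itself, done by evaluation. The bounds 4 and 2 on the counts reflect hub degrees at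
  -- most 3, of which a loop uses two.
  searched : every 4 verdict₁ ≡ true
  searched = refl

-- Soundness of the search.

≡true⇒T : ∀ {b} → b ≡ true → T b
≡true⇒T refl = tt

T⇒≡true : ∀ {b} → T b → b ≡ true
T⇒≡true {true} _ = refl

≤ᵇ-true : ∀ {u v} → u ≤ v → (u ≤ᵇ v) ≡ true
≤ᵇ-true p = T⇒≡true (ℕP.≤⇒≤ᵇ p)

≤ᵇ-false : ∀ {u v} → v < u → (u ≤ᵇ v) ≡ false
≤ᵇ-false {u} {v} v<u with u ≤ᵇ v in e
... | false = refl
... | true  = ⊥-elim (ℕP.<⇒≱ v<u (ℕP.≤ᵇ⇒≤ u v (≡true⇒T e)))

∧-true : ∀ {a b} → a ∧ b ≡ true → a ≡ true × b ≡ true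
∧-true {true} {true} _ = refl , refl

every-sound : ∀ n f → every n f ≡ true → ∀ {k} → k < n → f k ≡ true
every-sound (suc n) f e {k} (s≤s p) with ∧-true {f n} e | ℕP.m≤n⇒m<n∨m≡n p
... | _ , e′ | inj₁ k<n  = every-sound n f e′ k<n
... | e₁ , _ | inj₂ refl = e₁

all-sound : {A : Set} (p : A → Bool) (xs : List A) → all p xs ≡ true → ∀ {x} → x ∈ xs → p x ≡ true
all-sound p (x ∷ xs) e (here refl) = proj₁ (∧-true {p x} e)
all-sound p (x ∷ xs) e (there m)   = all-sound p xs (proj₂ (∧-true {p x} e)) m

∈-filterᵇ : {A : Set} (p : A → Bool) {xs : List A} {x : A} → x ∈ xs → p x ≡ true → x ∈ filterᵇ p xs
∈-filterᵇ p {y ∷ ys} (here refl) e rewrite e = here refl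
∈-filterᵇ p {y ∷ ys} (there m)   e with p y
... | true  = there (∈-filterᵇ p m e)
... | false = ∈-filterᵇ p m e

∈-concatMap : {A B : Set} (f : A → List B) {xs : List A} {x : A} {y : B} → x ∈ xs → y ∈ f x → y ∈ concatMap f xs
∈-concatMap f x∈ y∈ = ∈-concat⁺′ y∈ (∈-map⁺ f x∈)

suc≤visible : ∀ κ k → suc k ≤ visible κ k
suc≤visible target k = ℕP.m≤m+n (suc k) (suc k)
suc≤visible AB-link     k = ℕP.≤-refl
suc≤visible A-leg      k = ℕP.m≤m+n (suc k) (suc k)
suc≤visible B-leg      k = ℕP.m≤m+n (suc k) (suc k)
suc≤visible A-loop     k = ℕP.≤-refl
suc≤visible B-loop     k = ℕP.≤-refl
suc≤visible free-path     k = ℕP.m≤m+n (suc k) (suc k)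

visible≤ : ∀ κ k → visible κ k ≤ suc k ℕ.+ suc k
visible≤ target k = ℕP.≤-refl
visible≤ AB-link     k = ℕP.m≤m+n (suc k) (suc k)
visible≤ A-leg      k = ℕP.≤-refl
visible≤ B-leg      k = ℕP.≤-refl
visible≤ A-loop     k = ℕP.m≤m+n (suc k) (suc k)
visible≤ B-loop     k = ℕP.m≤m+n (suc k) (suc k)
visible≤ free-path     k = ℕP.≤-refl

module Soundness (τ cap : ℕ) {{nz : ℕ.NonZero τ}} where
  open Search τ cap

  Pairs : Set
  Pairs = List (Kind × ℕ)

  kindsOf : Pairs → List Kind
  kindsOf = map proj₁

  exacts : Pairs → List Slot
  exacts = map (λ κk → exact (proj₁ κk) (proj₂ κk))

  -- What stage m of the search knows about a link whose true length is k.
  truncate : ℕ → Kind → ℕ → Slot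
  truncate m κ k = if visible κ k ≤ᵇ m then exact κ k else unknown κ

  truncates : ℕ → Pairs → List Slot
  truncates m = map (λ κk → truncate m (proj₁ κk) (proj₂ κk))

  record Slot≈ (M : ℤ) (s s′ : Slot) : Set where
    field
      x≈ : Slot.x s ≈ Slot.x s′ [ M ]
      c≈ : Slot.c s ≈ Slot.c s′ [ M ]
      p≈ : Slot.p s ≈ Slot.p s′ [ M ]

  record Acc≈ (M : ℤ) (A A′ : Acc) : Set where
    field
      N≈  : Acc.N A ≈ Acc.N A′ [ M ]
      SA≈ : Acc.SA A ≈ Acc.SA A′ [ M ]
      SB≈ : Acc.SB A ≈ Acc.SB A′ [ M ]
      SC≈ : Acc.SC A ≈ Acc.SC A′ [ M ]

  module _ {m : ℕ} (m≤cap : m ≤ cap) where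
    private
      M = t ^ suc m

    private
      -- Since m ≤ cap, both k and the stand-in `cap` are invisible modulo `M`, so the values they
      -- give agree.
      valX-≈ : ∀ κ k → suc m ≤ visible κ k → valX κ k ≈ valX κ cap [ M ]
      valX-≈ target k p =
        ≈-* {x = c′ * c′} {c′ * c′} {a′ * a′ - s² k * (b′ * b′)} {a′ * a′ - s² cap * (b′ * b′)} ≈-refl
          (≈-- {x = a′ * a′} {a′ * a′} {s² k * (b′ * b′)} {s² cap * (b′ * b′)} ≈-refl
            (≈-* {x = s² k} {s² cap} {b′ * b′} {b′ * b′}
              (≈-both (sq {k} p) (sq {cap} (ℕP.≤-trans (s≤s m≤cap) (suc≤visible target cap)))) ≈-refl))
        where
        q = t * t
        c′ = 1ℤ + q + q * q
        a′ = 1ℤ - q - q * q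
        b′ = q * (1ℤ + q - q * q)
        s² : ℕ → ℤ
        s² l = t ^ suc l * t ^ suc l
        sq : ∀ {l} → suc m ≤ suc l ℕ.+ suc l → M divides (t ^ suc l * t ^ suc l)
        sq {l} q = subst (M divides_) (sym (pow-square t (suc l))) (pow-divides t q)
      valX-≈ AB-link k p = bracket-≈ t (suc m) (ℕP.≤-trans p (visible≤ AB-link k)) (ℕP.≤-trans (s≤s m≤cap) (ℕP.m≤m+n (suc cap) (suc cap)))
      valX-≈ A-leg  k p = bracket-≈ t (suc m) (ℕP.≤-trans p (visible≤ A-leg k)) (ℕP.≤-trans (s≤s m≤cap) (ℕP.m≤m+n (suc cap) (suc cap)))
      valX-≈ B-leg  k p = bracket-≈ t (suc m) (ℕP.≤-trans p (visible≤ B-leg k)) (ℕP.≤-trans (s≤s m≤cap) (ℕP.m≤m+n (suc cap) (suc cap)))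
      valX-≈ A-loop k p = bracket-≈ t (suc m) (ℕP.≤-trans p (visible≤ A-loop k)) (ℕP.≤-trans (s≤s m≤cap) (ℕP.m≤m+n (suc cap) (suc cap)))
      valX-≈ B-loop k p = bracket-≈ t (suc m) (ℕP.≤-trans p (visible≤ B-loop k)) (ℕP.≤-trans (s≤s m≤cap) (ℕP.m≤m+n (suc cap) (suc cap)))
      valX-≈ free-path k p = bracket-≈ t (suc m) (ℕP.≤-trans p (visible≤ free-path k)) (ℕP.≤-trans (s≤s m≤cap) (ℕP.m≤m+n (suc cap) (suc cap)))

      valP-≈ : ∀ κ k → suc m ≤ visible κ k → valP κ k ≈ valP κ cap [ M ]
      valP-≈ AB-link k p = ≈-both (pow-divides t p) (pow-divides t (s≤s m≤cap))
      valP-≈ A-loop k p = ≈-both (pow-divides t p) (pow-divides t (s≤s m≤cap))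
      valP-≈ B-loop k p = ≈-both (pow-divides t p) (pow-divides t (s≤s m≤cap))
      valP-≈ target k p = ≈-refl
      valP-≈ A-leg k p = ≈-refl
      valP-≈ B-leg k p = ≈-refl
      valP-≈ free-path k p = ≈-refl

      -- As t² [k] = [k + 1] - 1, it inherits the congruence.
      shifted : ∀ {k l} → bracket t (suc k) ≈ bracket t (suc l) [ M ] → (t * t * bracket t k) ≈ (t * t * bracket t l) [ M ]
      shifted {k} {l} (congruent d) = congruent (subst (M divides_) (lemma (t * t * bracket t k) (t * t * bracket t l)) d)
        where
        lemma : ∀ u v → 1ℤ + u - (1ℤ + v) ≡ u - v
        lemma = solve-∀

      valC-≈ : ∀ κ k → suc m ≤ visible κ k → valC κ k ≈ valC κ cap [ M ]
      valC-≈ target k p = ≈-refl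
      valC-≈ AB-link k p = shifted {k} {cap} (valX-≈ AB-link k p)
      valC-≈ A-leg  k p = shifted {k} {cap} (valX-≈ A-leg k p)
      valC-≈ B-leg  k p = shifted {k} {cap} (valX-≈ B-leg k p)
      valC-≈ A-loop k p = shifted {k} {cap} (valX-≈ A-loop k p)
      valC-≈ B-loop k p = shifted {k} {cap} (valX-≈ B-loop k p)
      valC-≈ free-path k p = shifted {k} {cap} (valX-≈ free-path k p)

    truncate-≈ : ∀ κ k → Slot≈ M (exact κ k) (truncate m κ k)
    truncate-≈ κ k with visible κ k ≤ᵇ m | ℕP.≤⇒≤ᵇ {visible κ k} {m}
    ... | true  | _ = record { x≈ = ≈-refl ; c≈ = ≈-refl ; p≈ = ≈-refl }
    ... | false | f = record { x≈ = valX-≈ κ k far ; c≈ = valC-≈ κ k far ; p≈ = valP-≈ κ k far }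
      where
      far : suc m ≤ visible κ k
      far = ℕP.≰⇒> f

    add-≈ : ∀ κ {s s′ A A′} → Slot≈ M s s′ → Acc≈ M A A′ → Acc≈ M (add κ s A) (add κ s′ A′)
    add-≈ target _ A = A
    add-≈ AB-link S A = record { N≈ = ≈-* x≈ N≈ ; SA≈ = ≈-+ (≈-* x≈ SA≈) (≈-* N≈ c≈) ; SB≈ = ≈-+ (≈-* x≈ SB≈) (≈-* N≈ c≈) ; SC≈ = ≈-+ (≈-* x≈ SC≈) (≈-* N≈ p≈) }
      where
      open Slot≈ S
      open Acc≈ A
    add-≈ A-leg S A = record { N≈ = ≈-* x≈ N≈ ; SA≈ = ≈-+ (≈-* x≈ SA≈) (≈-* N≈ c≈) ; SB≈ = ≈-* x≈ SB≈ ; SC≈ = ≈-* x≈ SC≈ }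
      where
      open Slot≈ S
      open Acc≈ A
    add-≈ B-leg S A = record { N≈ = ≈-* x≈ N≈ ; SA≈ = ≈-* x≈ SA≈ ; SB≈ = ≈-+ (≈-* x≈ SB≈) (≈-* N≈ c≈) ; SC≈ = ≈-* x≈ SC≈ }
      where
      open Slot≈ S
      open Acc≈ A
    add-≈ A-loop S A = record { N≈ = ≈-* x≈ N≈ ; SA≈ = ≈-+ (≈-* x≈ SA≈) (≈-* N≈ (≈-+ (≈-+ c≈ c≈) (≈-+ p≈ p≈))) ; SB≈ = ≈-* x≈ SB≈ ; SC≈ = ≈-* x≈ SC≈ }
      where
      open Slot≈ S
      open Acc≈ A
    add-≈ B-loop S A = record { N≈ = ≈-* x≈ N≈ ; SA≈ = ≈-* x≈ SA≈ ; SB≈ = ≈-+ (≈-* x≈ SB≈) (≈-* N≈ (≈-+ (≈-+ c≈ c≈) (≈-+ p≈ p≈))) ; SC≈ = ≈-* x≈ SC≈ }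
      where
      open Slot≈ S
      open Acc≈ A
    add-≈ free-path S A = record { N≈ = ≈-* x≈ N≈ ; SA≈ = ≈-* x≈ SA≈ ; SB≈ = ≈-* x≈ SB≈ ; SC≈ = ≈-* x≈ SC≈ }
      where
      open Slot≈ S
      open Acc≈ A

    accumulate-≈ : ∀ ps → Acc≈ M (accumulate (kindsOf ps) (exacts ps)) (accumulate (kindsOf ps) (truncates m ps))
    accumulate-≈ []             = record { N≈ = ≈-refl ; SA≈ = ≈-refl ; SB≈ = ≈-refl ; SC≈ = ≈-refl }
    accumulate-≈ ((κ , k) ∷ ps) = add-≈ κ (truncate-≈ κ k) (accumulate-≈ ps)

    finish-≈ : ∀ {A A′ R R′} → Acc≈ M A A′ → R ≈ R′ [ M ] → finish A R ≈ finish A′ R′ [ M ]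
    finish-≈ {acc N SA SB SC} {acc N′ SA′ SB′ SC′} {R} {R′} A r =
      ≈-- {x = v * (e N SA * e N SB - SC * SC)} {v * (e N′ SA′ * e N′ SB′ - SC′ * SC′)} {N * R} {N′ * R′}
        (≈-* {x = v} {v} {e N SA * e N SB - SC * SC} {e N′ SA′ * e N′ SB′ - SC′ * SC′} ≈-refl
          (≈-- {x = e N SA * e N SB} {e N′ SA′ * e N′ SB′} {SC * SC} {SC′ * SC′}
            (≈-* {x = e N SA} {e N′ SA′} {e N SB} {e N′ SB′} (entry N≈ SA≈) (entry N≈ SB≈))
            (≈-* {x = SC} {SC′} {SC} {SC′} SC≈ SC≈)))
        (≈-* {x = N} {N′} {R} {R′} N≈ r)
      where
      open Acc≈ A
      u = 1ℤ + t * t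
      v = 1ℤ - t * t
      e : ℤ → ℤ → ℤ
      e N S = N * u - S
      entry : ∀ {N N′ S S′} → N ≈ N′ [ M ] → S ≈ S′ [ M ] → e N S ≈ e N′ S′ [ M ]
      entry {N} {N′} {S} {S′} n s = ≈-- {x = N * u} {N′ * u} {S} {S′} (≈-* {x = N} {N′} {u} {u} n ≈-refl) s

    residual-≈ : ∀ j ps → residual (target ∷ kindsOf ps) (exacts ((target , j) ∷ ps)) ≈
                          residual (target ∷ kindsOf ps) (truncates m ((target , j) ∷ ps)) [ M ]
    residual-≈ j ps = finish-≈ (accumulate-≈ ps) (Slot≈.x≈ (truncate-≈ target j))

    -- An exact solution has residual 0, and truncating it changes the residual only by a multiple
    -- of the modulus.
    check-passes : ∀ j ps → residual (target ∷ kindsOf ps) (exacts ((target , j) ∷ ps)) ≡ 0ℤ →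
                   check m (target ∷ kindsOf ps) (truncates m ((target , j) ∷ ps)) ≡ true
    check-passes j ps z = divisible (residual (target ∷ kindsOf ps) (truncates m ((target , j) ∷ ps)))
      (neg (subst (λ x → x ≈ residual (target ∷ kindsOf ps) (truncates m ((target , j) ∷ ps)) [ M ]) z (residual-≈ j ps)))
      where
      neg : ∀ {x} → 0ℤ ≈ x [ M ] → M divides x
      neg {x} (congruent d) = subst (M divides_) (lemma x) (divides-neg d)
        where
        lemma : ∀ x → - (0ℤ - x) ≡ x
        lemma = solve-∀
      abs-pow : ∀ k → ℤ.∣ t ^ k ∣ ≡ τ ℕ.^ k
      abs-pow zero    = refl
      abs-pow (suc k) = trans (ℤP.abs-* t (t ^ k)) (cong (τ ℕ.*_) (abs-pow k))
      divisible : ∀ x → M divides x → (((ℤ.∣ x ∣ % (τ ℕ.^ suc m)) {{ℕP.m^n≢0 τ (suc m)}}) ≡ᵇ 0) ≡ true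
      divisible x (factor d e) = T⇒≡true (ℕP.≡⇒≡ᵇ _ 0 (trans
        (cong (λ y → (y % (τ ℕ.^ suc m)) {{ℕP.m^n≢0 τ (suc m)}}) (trans (cong ℤ.∣_∣ e) (trans (ℤP.abs-* M d)
          (trans (cong (ℕ._* ℤ.∣ d ∣) (abs-pow (suc m))) (ℕP.*-comm (τ ℕ.^ suc m) ℤ.∣ d ∣)))))
        (m*n%n≡0 ℤ.∣ d ∣ (τ ℕ.^ suc m) {{ℕP.m^n≢0 τ (suc m)}})))

  private
    -- The length was visible before, becomes visible now, or stays invisible; `pick` provides for
    -- each case.
    pick-step : ∀ {m} → m < cap → ∀ κ k → allowed κ k ≡ true →
                truncate (suc m) κ k ∈ pick (truncate m κ k) (map (exact κ) (newLengths m κ))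
    pick-step {m} m<cap κ k ok with ℕP.<-cmp (visible κ k) (suc m)
    ... | tri< v<sm _ _ rewrite ≤ᵇ-true (ℕ.s≤s⁻¹ v<sm) | ≤ᵇ-true (ℕP.<⇒≤ v<sm) = here refl
    ... | tri≈ _ v≡sm _ rewrite ≤ᵇ-true (ℕP.≤-reflexive v≡sm) | ≤ᵇ-false (ℕP.≤-reflexive (sym v≡sm)) =
      there (∈-map⁺ (exact κ) (∈-filterᵇ _ (∈-upTo⁺ k<cap)
        (trans (cong (_∧ allowed κ k) (T⇒≡true (ℕP.≡⇒≡ᵇ (visible κ k) (suc m) v≡sm))) ok)))
      where
      k<cap : k < cap
      k<cap = ℕP.≤-trans (ℕP.≤-trans (suc≤visible κ k) (ℕP.≤-reflexive v≡sm)) m<cap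
    ... | tri> _ _ sm<v rewrite ≤ᵇ-false sm<v | ≤ᵇ-false (ℕP.<-trans (ℕP.n<1+n m) sm<v) = here refl

    choices-step : ∀ {m} → m < cap → ∀ ps → All (λ κk → allowed (proj₁ κk) (proj₂ κk) ≡ true) ps →
                   truncates (suc m) ps ∈ choices (map (λ κ → map (exact κ) (newLengths m κ)) (kindsOf ps)) (truncates m ps)
    choices-step m<cap []             _          = here refl
    choices-step m<cap ((κ , k) ∷ ps) (ok ∷ oks) =
      ∈-concatMap _ (pick-step m<cap κ k ok) (∈-map⁺ _ (choices-step m<cap ps oks))

    truncate-0 : ∀ ps → truncates 0 ps ≡ map unknown (kindsOf ps)
    truncate-0 []             = refl
    truncate-0 ((κ , k) ∷ ps) = cong₂ _∷_ (at κ) (truncate-0 ps)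
      where
      at : ∀ κ → truncate 0 κ k ≡ unknown κ
      at target = refl
      at AB-link     = refl
      at A-leg      = refl
      at B-leg      = refl
      at A-loop     = refl
      at B-loop     = refl
      at free-path     = refl

  -- The truncations of a true solution form a branch of the search tree that no check prunes.
  states-complete : ∀ m → m ≤ cap → ∀ j ps →
                    residual (target ∷ kindsOf ps) (exacts ((target , j) ∷ ps)) ≡ 0ℤ →
                    All (λ κk → allowed (proj₁ κk) (proj₂ κk) ≡ true) ((target , j) ∷ ps) →
                    truncates m ((target , j) ∷ ps) ∈ states m (target ∷ kindsOf ps)
  states-complete zero    _ j ps z ok = here (truncate-0 ((target , j) ∷ ps))
  states-complete (suc m) p j ps z ok = ∈-filterᵇ _
    (∈-concatMap _ (states-complete m (ℕP.<⇒≤ p) j ps z ok) (choices-step p ((target , j) ∷ ps) ok))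
    (check-passes p j ps z)

  shapeOf : Kind → ℕ → Shape
  shapeOf target k = tag nothing nothing k
  shapeOf AB-link     k = tag (just hubA) (just hubB) k
  shapeOf A-leg      k = tag (just hubA) nothing k
  shapeOf B-leg      k = tag (just hubB) nothing k
  shapeOf A-loop     k = tag (just hubA) (just hubA) k
  shapeOf B-loop     k = tag (just hubB) (just hubB) k
  shapeOf free-path     k = tag nothing nothing k

  shapesOf : Pairs → List Shape
  shapesOf = map (λ κk → shapeOf (proj₁ κk) (proj₂ κk))

  hubSum-sym : ∀ ss → hubSum t ss hubB hubA ≡ hubSum t ss hubA hubB
  hubSum-sym []                 = refl
  hubSum-sym ((e , k , f) ∷ ss) = cong₂ (λ x y → bracket t (suc k) * x + weight t ss * y) (hubSum-sym ss)
    (lemma (t * t * bracket t k) (t ^ suc k) (ι e hubA) (ι e hubB) (ι f hubA) (ι f hubB))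
    where
    lemma : ∀ u p e e′ f f′ → u * (e′ * e + f′ * f) + p * (e′ * f + f′ * e) ≡ u * (e * e′ + f * f′) + p * (e * f′ + f * e′)
    lemma = solve-∀

  private
    cong-acc : ∀ {N N′ A A′ B B′ C C′} → N ≡ N′ → A ≡ A′ → B ≡ B′ → C ≡ C′ → acc N A B C ≡ acc N′ A′ B′ C′
    cong-acc refl refl refl refl = refl

    two : ∀ w c p x → x + w * (c + c + (p + p)) ≡ x + w * (c * (1ℤ * 1ℤ + 1ℤ * 1ℤ) + p * (1ℤ * 1ℤ + 1ℤ * 1ℤ))
    two = solve-∀
    first : ∀ w c p x → x + w * c ≡ x + w * (c * (1ℤ * 1ℤ + 0ℤ * 0ℤ) + p * (1ℤ * 0ℤ + 0ℤ * 1ℤ))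
    first = solve-∀
    second : ∀ w c p x → x + w * c ≡ x + w * (c * (0ℤ * 0ℤ + 1ℤ * 1ℤ) + p * (0ℤ * 1ℤ + 1ℤ * 0ℤ))
    second = solve-∀
    cross : ∀ w c p x → x + w * p ≡ x + w * (c * (1ℤ * 0ℤ + 0ℤ * 1ℤ) + p * (1ℤ * 1ℤ + 0ℤ * 0ℤ))
    cross = solve-∀
    none : ∀ w c p x → x ≡ x + w * (c * (0ℤ * 0ℤ + 0ℤ * 0ℤ) + p * (0ℤ * 0ℤ + 0ℤ * 0ℤ))
    none = solve-∀
    none₁ : ∀ w c p x → x ≡ x + w * (c * (1ℤ * 0ℤ + 0ℤ * 0ℤ) + p * (1ℤ * 0ℤ + 0ℤ * 0ℤ))
    none₁ = solve-∀
    none₂ : ∀ w c p x → x ≡ x + w * (c * (0ℤ * 1ℤ + 0ℤ * 0ℤ) + p * (0ℤ * 0ℤ + 0ℤ * 1ℤ))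
    none₂ = solve-∀
    none₃ : ∀ w c p x → x ≡ x + w * (c * (1ℤ * 0ℤ + 1ℤ * 0ℤ) + p * (1ℤ * 0ℤ + 1ℤ * 0ℤ))
    none₃ = solve-∀
    none₄ : ∀ w c p x → x ≡ x + w * (c * (0ℤ * 1ℤ + 0ℤ * 1ℤ) + p * (0ℤ * 1ℤ + 0ℤ * 1ℤ))
    none₄ = solve-∀
    single : ∀ w c p x → x + w * c ≡ x + w * (c * (1ℤ * 1ℤ + 0ℤ * 0ℤ) + p * (1ℤ * 0ℤ + 0ℤ * 1ℤ))
    single = solve-∀

  NotTarget : Kind → Set
  NotTarget target = ⊥
  NotTarget _      = ⊤

  accumulate-spec : ∀ ps → All (λ κk → NotTarget (proj₁ κk)) ps → let ss = shapesOf ps in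
    accumulate (kindsOf ps) (exacts ps) ≡ acc (weight t ss) (hubSum t ss hubA hubA) (hubSum t ss hubB hubB) (hubSum t ss hubA hubB)
  accumulate-spec []             _          = refl
  accumulate-spec ((κ , k) ∷ ps) (κ≢ ∷ κs≢) = trans (cong (add κ (exact κ k)) (accumulate-spec ps κs≢)) (at κ κ≢)
    where
    ss = shapesOf ps
    w = weight t ss
    x = bracket t (suc k)
    c = t * t * bracket t k
    p = t ^ suc k
    A′ = x * hubSum t ss hubA hubA
    B′ = x * hubSum t ss hubB hubB
    C′ = x * hubSum t ss hubA hubB
    at : ∀ κ → NotTarget κ → let ss′ = shapeOf κ k ∷ ss in
      add κ (exact κ k) (acc w (hubSum t ss hubA hubA) (hubSum t ss hubB hubB) (hubSum t ss hubA hubB)) ≡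
      acc (weight t ss′) (hubSum t ss′ hubA hubA) (hubSum t ss′ hubB hubB) (hubSum t ss′ hubA hubB)
    at AB-link _ = cong-acc refl (first w c p A′) (second w c p B′) (cross w c p C′)
    at A-leg  _ = cong-acc refl (none-a A′) (none w c p B′) (none₁ w c p C′)
      where
      none-a : ∀ y → y + w * c ≡ y + w * (c * (1ℤ * 1ℤ + 0ℤ * 0ℤ) + p * (1ℤ * 0ℤ + 0ℤ * 1ℤ))
      none-a y = single w c p y
    at B-leg  _ = cong-acc refl (none w c p A′) (single w c p B′) (none₂ w c p C′)
    at A-loop _ = cong-acc refl (two w c p A′) (none w c p B′) (none₃ w c p C′)
    at B-loop _ = cong-acc refl (none w c p A′) (two w c p B′) (none₄ w c p C′)
    at free-path _ = cong-acc refl (none w c p A′) (none w c p B′) (none w c p C′)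

  residual-spec : ∀ j ps → All (λ κk → NotTarget (proj₁ κk)) ps →
    (1ℤ - t * t) * schurDet t (shapesOf ps) ≡ weight t (shapesOf ps) * reduced t (t ^ suc j) →
    residual (target ∷ kindsOf ps) (exacts ((target , j) ∷ ps)) ≡ 0ℤ
  residual-spec j ps nt e = trans (cong (λ A → finish A (reduced t (t ^ suc j))) (accumulate-spec ps nt))
    (trans (cong (λ y → y - W * reduced t (t ^ suc j)) (trans (cong ((1ℤ - t * t) *_) expand) e))
      (ℤP.i≡j⇒i-j≡0 {W * reduced t (t ^ suc j)} refl))
    where
    ss = shapesOf ps
    W = weight t ss
    SA = hubSum t ss hubA hubA
    SB = hubSum t ss hubB hubB
    SC = hubSum t ss hubA hubB
    expand : (W * (1ℤ + t * t) - SA) * (W * (1ℤ + t * t) - SB) - SC * SC ≡ schurDet t ss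
    expand = trans (lemma W (1ℤ + t * t) SA SB SC)
      (cong (λ s → (W * (1ℤ * (1ℤ + t * t)) - SA) * (W * (1ℤ * (1ℤ + t * t)) - SB)
        - (W * (0ℤ * (1ℤ + t * t)) - SC) * (W * (0ℤ * (1ℤ + t * t)) - s)) (sym (hubSum-sym ss)))
      where
      lemma : ∀ w u a b c → (w * u - a) * (w * u - b) - c * c ≡
              (w * (1ℤ * u) - a) * (w * (1ℤ * u) - b) - (w * (0ℤ * u) - c) * (w * (0ℤ * u) - c)
      lemma = solve-∀

map-pair : {A B : Set} (x : A) (ys : List B) → map proj₁ (map (x ,_) ys) ≡ replicate (length ys) x
map-pair x []       = refl
map-pair x (y ∷ ys) = cong (x ∷_) (map-pair x ys)

module Reach (τ cap : ℕ) {{nz : ℕ.NonZero τ}} (ab a b aa bb nn : List ℕ) where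
  open Soundness τ cap
  open Search τ cap
  private
    p₂ p₃ p₄ p₅ p₆ : List (Kind × ℕ)
    p₆ = map (free-path ,_) nn
    p₅ = map (B-loop ,_) bb ++ p₆
    p₄ = map (A-loop ,_) aa ++ p₅
    p₃ = map (B-leg ,_) b ++ p₄
    p₂ = map (A-leg ,_) a ++ p₃

  pairs : List (Kind × ℕ)
  pairs = map (AB-link ,_) ab ++ p₂

  private
    first : ∀ κ (ks : List ℕ) (ps : List (Kind × ℕ)) {κs} → map proj₁ ps ≡ κs → map proj₁ (map (κ ,_) ks ++ ps) ≡ replicate (length ks) κ ++ κs
    first κ ks ps e = trans (ListP.map-++ proj₁ (map (κ ,_) ks) ps) (cong₂ _++_ (map-pair κ ks) e)

    kinds≡ : target ∷ map proj₁ pairs ≡ kinds (length ab) (length a) (length b) (length aa) (length bb) (length nn)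
    kinds≡ = cong (target ∷_) (first AB-link ab p₂ (first A-leg a p₃ (first B-leg b p₄
      (first A-loop aa p₅ (first B-loop bb p₆ (map-pair free-path nn))))))

    shape-map : ∀ κ (e f : End) (ks : List ℕ) ps {ss} → (∀ k → shapeOf κ k ≡ tag e f k) → shapesOf ps ≡ ss →
                shapesOf (map (κ ,_) ks ++ ps) ≡ map (tag e f) ks ++ ss
    shape-map κ e f []       ps h q = q
    shape-map κ e f (k ∷ ks) ps h q = cong₂ _∷_ (h k) (shape-map κ e f ks ps h q)

    shape-last : ∀ ks → shapesOf (map (free-path ,_) ks) ≡ map (tag nothing nothing) ks
    shape-last []       = refl
    shape-last (k ∷ ks) = cong (tag nothing nothing k ∷_) (shape-last ks)

    shapes≡ : shapesOf pairs ≡ render (bins ab a b aa bb nn)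
    shapes≡ = shape-map AB-link (just hubA) (just hubB) ab p₂ (λ _ → refl)
      (shape-map A-leg (just hubA) nothing a p₃ (λ _ → refl)
      (shape-map B-leg (just hubB) nothing b p₄ (λ _ → refl)
      (shape-map A-loop (just hubA) (just hubA) aa p₅ (λ _ → refl)
      (shape-map B-loop (just hubB) (just hubB) bb p₆ (λ _ → refl) (shape-last nn)))))

    all-pairs : {Q : Kind → ℕ → Set} (κ : Kind) (ks : List ℕ) {ps : List (Kind × ℕ)} →
                All (Q κ) ks → All (λ κk → Q (proj₁ κk) (proj₂ κk)) ps →
                All (λ κk → Q (proj₁ κk) (proj₂ κk)) (map (κ ,_) ks ++ ps)
    all-pairs κ []       []       q = q
    all-pairs {Q} κ (k ∷ ks) (x ∷ xs) q = x ∷ all-pairs {Q} κ ks xs q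

    all-last : {Q : Kind → ℕ → Set} (κ : Kind) (ks : List ℕ) → All (Q κ) ks →
               All (λ κk → Q (proj₁ κk) (proj₂ κk)) (map (κ ,_) ks)
    all-last κ []       []       = []
    all-last {Q} κ (k ∷ ks) (x ∷ xs) = x ∷ all-last {Q} κ ks xs

    trivially : {Q : ℕ → Set} → (∀ k → Q k) → ∀ ks → All Q ks
    trivially h []       = []
    trivially h (k ∷ ks) = h k ∷ trivially h ks

    Ok : Kind → ℕ → Set
    Ok κ k = allowed κ k ≡ true

    positive : ∀ κ → (∀ k → allowed κ (suc k) ≡ true) → ∀ {ks} → All (1 ≤_) ks → All (Ok κ) ks
    positive κ h []              = []
    positive κ h (_∷_ {suc k} p ps) = h k ∷ positive κ h ps

    target-ok : ∀ j → j ≢ 0 → j ≢ 3 → allowed target j ≡ true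
    target-ok 0 n _ = ⊥-elim (n refl)
    target-ok 1 _ _ = refl
    target-ok 2 _ _ = refl
    target-ok 3 _ n = ⊥-elim (n refl)
    target-ok (suc (suc (suc (suc j)))) _ _ = refl

  module _ (adm : Admissible (bins ab a b aa bb nn)) where
    open Admissible adm

    private
      not-targets : All (λ κk → NotTarget (proj₁ κk)) pairs
      not-targets = all-pairs {λ κ _ → NotTarget κ} AB-link ab (trivially (λ _ → tt) ab)
        (all-pairs {λ κ _ → NotTarget κ} A-leg a (trivially (λ _ → tt) a)
        (all-pairs {λ κ _ → NotTarget κ} B-leg b (trivially (λ _ → tt) b)
        (all-pairs {λ κ _ → NotTarget κ} A-loop aa (trivially (λ _ → tt) aa)
        (all-pairs {λ κ _ → NotTarget κ} B-loop bb (trivially (λ _ → tt) bb)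
        (all-last {λ κ _ → NotTarget κ} free-path nn (trivially (λ _ → tt) nn))))))

      all-ok : All (λ κk → Ok (proj₁ κk) (proj₂ κk)) pairs
      all-ok = all-pairs {Ok} AB-link ab (trivially (λ _ → refl) ab)
        (all-pairs {Ok} A-leg a (positive A-leg (λ _ → refl) a-pos)
        (all-pairs {Ok} B-leg b (positive B-leg (λ _ → refl) b-pos)
        (all-pairs {Ok} A-loop aa (positive A-loop (λ _ → refl) aa-pos)
        (all-pairs {Ok} B-loop bb (positive B-loop (λ _ → refl) bb-pos)
        (all-last {Ok} free-path nn (positive free-path (λ _ → refl) nn-pos))))))

    reached : ∀ j → j ≢ 0 → j ≢ 3 → LensEquation τ (bins ab a b aa bb nn) j →
      truncates cap ((target , j) ∷ pairs) ∈
        states cap (kinds (length ab) (length a) (length b) (length aa) (length bb) (length nn))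
    reached j j≢0 j≢3 e = subst (λ κs → truncates cap ((target , j) ∷ pairs) ∈ states cap κs) kinds≡
      (states-complete cap ℕP.≤-refl j pairs
        (residual-spec j pairs not-targets
          (subst (λ ss → (1ℤ - t * t) * schurDet t ss ≡ weight t ss * reduced t (t ^ suc j)) (sym shapes≡) (LensEquation.equation e)))
        (target-ok j j≢0 j≢3 ∷ all-ok))

if-true : ∀ {c x : Bool} → c ≡ true → (if c then x else true) ≡ true → x ≡ true
if-true refl e = e

∧₃ : ∀ {x y z} → x ≡ true → y ≡ true → z ≡ true → x ∧ y ∧ z ≡ true
∧₃ refl refl refl = refl

private
  half : ∀ n → n ℕ.+ n ≤ 3 → n < 2
  half 0 _ = s≤s z≤n
  half 1 _ = s≤s (s≤s z≤n)
  half (suc (suc n)) (s≤s (s≤s p)) = ⊥-elim (ℕP.<⇒≱ (s≤s (s≤s z≤n)) (ℕP.≤-trans (ℕP.m≤n+m (suc (suc n)) n) p))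
  bound₁ : ∀ x y z → x ℕ.+ y ℕ.+ z ≤ 3 → x < 4
  bound₁ x y z p = s≤s (ℕP.≤-trans (ℕP.m≤m+n x y) (ℕP.≤-trans (ℕP.m≤m+n (x ℕ.+ y) z) p))
  bound₂ : ∀ x y z → x ℕ.+ y ℕ.+ z ≤ 3 → y < 4
  bound₂ x y z p = s≤s (ℕP.≤-trans (ℕP.m≤n+m y x) (ℕP.≤-trans (ℕP.m≤m+n (x ℕ.+ y) z) p))
  bound₃ : ∀ x y z → x ℕ.+ y ℕ.+ z ≤ 3 → z ≤ 3
  bound₃ x y z p = ℕP.≤-trans (ℕP.m≤n+m z (x ℕ.+ y)) p

verdict-true : ∀ n₁ n₂ n₃ n₄ n₅ → n₁ ℕ.+ n₂ ℕ.+ (n₄ ℕ.+ n₄) ≤ 3 → n₁ ℕ.+ n₃ ℕ.+ (n₅ ℕ.+ n₅) ≤ 3 → verdict n₁ n₂ n₃ n₄ n₅ ≡ true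
verdict-true n₁ n₂ n₃ n₄ n₅ p q =
  every-sound 2 (verdict n₁ n₂ n₃ n₄) (every-sound 2 (verdict₄ n₁ n₂ n₃) (every-sound 4 (verdict₃ n₁ n₂)
    (every-sound 4 (verdict₂ n₁) (every-sound 4 verdict₁ searched
    (bound₁ n₁ n₂ (n₄ ℕ.+ n₄) p)) (bound₂ n₁ n₂ (n₄ ℕ.+ n₄) p)) (bound₂ n₁ n₃ (n₅ ℕ.+ n₅) q))
    (half n₄ (bound₃ n₁ n₂ (n₄ ℕ.+ n₄) p))) (half n₅ (bound₃ n₁ n₃ (n₅ ℕ.+ n₅) q))

module _ where
  open Search 16 14
  open Soundness 16 14

  survivors-good : ∀ n₁ n₂ n₃ n₄ n₅ n₆ → n₁ ℕ.+ n₂ ℕ.+ (n₄ ℕ.+ n₄) ≤ 3 → n₁ ℕ.+ n₃ ℕ.+ (n₅ ℕ.+ n₅) ≤ 3 →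
    suc n₆ ≡ n₁ ℕ.+ n₄ ℕ.+ n₅ → ∀ {s} → s ∈ states 14 (kinds n₁ n₂ n₃ n₄ n₅ n₆) →
    isTree n₁ n₂ n₃ n₄ n₅ ∧ legs2 s ≡ true
  survivors-good n₁ n₂ n₃ n₄ n₅ n₆ p q r {s} m = all-sound (λ s → isTree n₁ n₂ n₃ n₄ n₅ ∧ legs2 s)
    (states 14 (kinds n₁ n₂ n₃ n₄ n₅ (n₁ ℕ.+ n₄ ℕ.+ n₅ ℕ.∸ 1)))
    (if-true (∧₃ (≤ᵇ-true p) (≤ᵇ-true q) (cong (λ k → not (k ≡ᵇ 0)) (sym r))) (verdict-true n₁ n₂ n₃ n₄ n₅ p q))
    (subst (λ n → s ∈ states 14 (kinds n₁ n₂ n₃ n₄ n₅ n)) (cong (ℕ._∸ 1) r) m)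

  is2-truncate : ∀ κ k → is2 (truncate 14 κ k) ≡ true → k ≡ 2
  is2-truncate κ k e with visible κ k ≤ᵇ 14
  ... | true = ℕP.≡ᵇ⇒≡ k 2 (≡true⇒T e)

  ∧₄-true : ∀ {w x y z} → w ∧ x ∧ y ∧ z ≡ true → w ≡ true × x ≡ true × y ≡ true × z ≡ true
  ∧₄-true {true} {true} {true} {true} _ = refl , refl , refl , refl

  -- The length k between the hubs is left open, since it may exceed all lengths the search
  -- resolves. One such link and no loops leave no free path, by `free`.
  tree-lengths : ∀ {L} → Admissible L → ∀ {j} → j ≢ 0 → j ≢ 3 →
    LensEquation 16 L j → ∃ λ k → L ≡ bins (k ∷ []) (2 ∷ 2 ∷ []) (2 ∷ 2 ∷ []) [] [] []
  tree-lengths {bins ab a b aa bb nn} adm {j} j≢0 j≢3 e = conclude ab a b aa bb nn free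
    (∧-true {isTree (length ab) (length a) (length b) (length aa) (length bb)} {legs2 state}
      (survivors-good (length ab) (length a) (length b) (length aa) (length bb) (length nn) degA degB free
        (Reach.reached 16 14 ab a b aa bb nn adm j j≢0 j≢3 e)))
    where
    open Admissible adm
    state = truncates 14 ((target , j) ∷ Reach.pairs 16 14 ab a b aa bb nn)
    conclude : ∀ ab a b aa bb nn → suc (length nn) ≡ length ab ℕ.+ length aa ℕ.+ length bb →
      isTree (length ab) (length a) (length b) (length aa) (length bb) ≡ true ×
      legs2 (truncates 14 ((target , j) ∷ Reach.pairs 16 14 ab a b aa bb nn)) ≡ true →
      ∃ λ k → bins ab a b aa bb nn ≡ bins (k ∷ []) (2 ∷ 2 ∷ []) (2 ∷ 2 ∷ []) [] [] []
    conclude (k ∷ []) (x₁ ∷ x₂ ∷ []) (y₁ ∷ y₂ ∷ []) [] [] [] _ (_ , l) = k ,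
      all-2 (∧₄-true {s A-leg x₁} {s A-leg x₂} {s B-leg y₁} {s B-leg y₂} l)
      where
      s : Kind → ℕ → Bool
      s κ x = is2 (truncate 14 κ x)
      equal : ∀ {x₁ x₂ y₁ y₂} → x₁ ≡ 2 → x₂ ≡ 2 → y₁ ≡ 2 → y₂ ≡ 2 →
        bins {T = λ _ _ → ℕ} (k ∷ []) (x₁ ∷ x₂ ∷ []) (y₁ ∷ y₂ ∷ []) [] [] [] ≡ bins (k ∷ []) (2 ∷ 2 ∷ []) (2 ∷ 2 ∷ []) [] [] []
      equal refl refl refl refl = refl
      all-2 : s A-leg x₁ ≡ true × s A-leg x₂ ≡ true × s B-leg y₁ ≡ true × s B-leg y₂ ≡ true →
        bins {T = λ _ _ → ℕ} (k ∷ []) (x₁ ∷ x₂ ∷ []) (y₁ ∷ y₂ ∷ []) [] [] [] ≡ bins (k ∷ []) (2 ∷ 2 ∷ []) (2 ∷ 2 ∷ []) [] [] []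
      all-2 (e₁ , e₂ , e₃ , e₄) =
        equal (is2-truncate A-leg x₁ e₁) (is2-truncate A-leg x₂ e₂) (is2-truncate B-leg y₁ e₃) (is2-truncate B-leg y₂ e₄)
    conclude (k ∷ []) (x₁ ∷ x₂ ∷ []) (y₁ ∷ y₂ ∷ []) [] [] (_ ∷ _) () _

-- Isomorphism of graphs whose decompositions have equal shapes.

edge-injective : ∀ {b b′} → edge b ≡ edge b′ → b ≡ b′
edge-injective {true}  {true}  _ = refl
edge-injective {false} {false} _ = refl

pairUp : {A B : Set} → List A → List B → List (A × B)
pairUp (x ∷ xs) (y ∷ ys) = (x , y) ∷ pairUp xs ys
pairUp _        _        = []

pairUp-proj₁ : {A B : Set} (xs : List A) (ys : List B) → length xs ≡ length ys → map proj₁ (pairUp xs ys) ≡ xs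
pairUp-proj₁ []       []       _ = refl
pairUp-proj₁ (x ∷ xs) (y ∷ ys) e = cong (x ∷_) (pairUp-proj₁ xs ys (ℕP.suc-injective e))

pairUp-proj₂ : {A B : Set} (xs : List A) (ys : List B) → length xs ≡ length ys → map proj₂ (pairUp xs ys) ≡ ys
pairUp-proj₂ []       []       _ = refl
pairUp-proj₂ (x ∷ xs) (y ∷ ys) e = cong (y ∷_) (pairUp-proj₂ xs ys (ℕP.suc-injective e))

pairUp-∈ : {A B : Set} (xs : List A) (ys : List B) {x : A} {y : B} → (x , y) ∈ pairUp xs ys → x ∈ xs × y ∈ ys
pairUp-∈ (x ∷ xs) (y ∷ ys) (here refl) = here refl , here refl
pairUp-∈ (x ∷ xs) (y ∷ ys) (there m)   = there (proj₁ (pairUp-∈ xs ys m)) , there (proj₂ (pairUp-∈ xs ys m))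

module Matching {n m} (G : Graph n) (G′ : Graph m) (zs : List (Fin n × Fin m))
  (all₁ : map proj₁ zs ↭ allFin n) (all₂ : map proj₂ zs ↭ allFin m)
  (preserve : ∀ {u u′ v v′} → (u , u′) ∈ zs → (v , v′) ∈ zs → adj G u v ≡ adj G′ u′ v′) where

  private
    partner : ∀ u → ∃ λ u′ → (u , u′) ∈ zs
    partner u with ∈-map⁻ proj₁ (∈-resp-↭ (Perm.↭-sym all₁) (∈-allFin u))
    ... | (_ , u′) , z∈ , refl = u′ , z∈

    copartner : ∀ u′ → ∃ λ u → (u , u′) ∈ zs
    copartner u′ with ∈-map⁻ proj₂ (∈-resp-↭ (Perm.↭-sym all₂) (∈-allFin u′))
    ... | (u , _) , z∈ , refl = u , z∈

    functional : ∀ {A B : Set} (zs : List (A × B)) → Unique (map proj₁ zs) → ∀ {x y y′} → (x , y) ∈ zs → (x , y′) ∈ zs → y ≡ y′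
    functional (z ∷ zs) (p ∷ u) (here refl) (here refl) = refl
    functional (z ∷ zs) (p ∷ u) (here refl) (there m)   = ⊥-elim (All.lookup p (∈-map⁺ proj₁ m) refl)
    functional (z ∷ zs) (p ∷ u) (there m)   (here refl) = ⊥-elim (All.lookup p (∈-map⁺ proj₁ m) refl)
    functional (z ∷ zs) (p ∷ u) (there m)   (there m′)  = functional zs u m m′

    cofunctional : ∀ {A B : Set} (zs : List (A × B)) → Unique (map proj₂ zs) → ∀ {x x′ y} → (x , y) ∈ zs → (x′ , y) ∈ zs → x ≡ x′
    cofunctional (z ∷ zs) (p ∷ u) (here refl) (here refl) = refl
    cofunctional (z ∷ zs) (p ∷ u) (here refl) (there m)   = ⊥-elim (All.lookup p (∈-map⁺ proj₂ m) refl)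
    cofunctional (z ∷ zs) (p ∷ u) (there m)   (here refl) = ⊥-elim (All.lookup p (∈-map⁺ proj₂ m) refl)
    cofunctional (z ∷ zs) (p ∷ u) (there m)   (there m′)  = cofunctional zs u m m′

    to : Fin n → Fin m
    to u = proj₁ (partner u)
    from′ : Fin m → Fin n
    from′ u′ = proj₁ (copartner u′)

  isomorphic : Isomorphic G G′
  isomorphic = mk↔ₛ′ to from′
    (λ u′ → functional zs (Unique-↭ (Perm.↭-sym all₁) (UniqueP.allFin⁺ n)) (proj₂ (partner (from′ u′))) (proj₂ (copartner u′)))
    (λ u → cofunctional zs (Unique-↭ (Perm.↭-sym all₂) (UniqueP.allFin⁺ m)) (proj₂ (copartner (to u))) (proj₂ (partner u))) ,
    (λ u v → preserve (proj₂ (partner u)) (proj₂ (partner v)))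

module _ {n m} {G : Graph n} {G′ : Graph m} {hub : Hub → Fin n} {hub′ : Hub → Fin m} where

  chains-hub : ∀ {e f vs vs′} → Chain G hub e vs f → Chain G′ hub′ e vs′ f → length vs ≡ length vs′ →
               ∀ {u u′} → (u , u′) ∈ pairUp vs vs′ → ∀ h → adj G u (hub h) ≡ adj G′ u′ (hub′ h)
  chains-hub (one p)        (one p′)          _ (here refl) h = edge-injective (trans (p h) (sym (p′ h)))
  chains-hub (cons p _ _ _) (cons p′ _ _ _)   _ (here refl) h = edge-injective (trans (p h) (sym (p′ h)))
  chains-hub (cons _ _ _ c) (cons _ _ _ c′)   l (there m)   h = chains-hub c c′ (ℕP.suc-injective l) m h
  chains-hub (one _)        (cons _ _ _ _)    () _ _
  chains-hub (cons _ _ _ _) (one _)           () _ _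

  chains-adj : ∀ {e f vs vs′} → Chain G hub e vs f → Chain G′ hub′ e vs′ f → length vs ≡ length vs′ →
               ∀ {u u′ v v′} → (u , u′) ∈ pairUp vs vs′ → (v , v′) ∈ pairUp vs vs′ → adj G u v ≡ adj G′ u′ v′
  chains-adj (one {v = v} _)        (one {v = v′} _)        _ (here refl) (here refl) = trans (irrefl G v) (sym (irrefl G′ v′))
  chains-adj {vs = v ∷ _} {v′ ∷ _} (cons _ _ _ _) (cons _ _ _ _) _ (here refl) (here refl) = trans (irrefl G v) (sym (irrefl G′ v′))
  chains-adj {vs = v ∷ w ∷ vs} {v′ ∷ w′ ∷ vs′} (cons _ a b _) (cons _ a′ b′ _) l (here refl) (there m) = first m
    where
    first : ∀ {x x′} → (x , x′) ∈ (w , w′) ∷ pairUp vs vs′ → adj G v x ≡ adj G′ v′ x′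
    first (here refl) = trans a (sym a′)
    first (there m) = trans (proj₂ (All.lookup b (proj₁ (pairUp-∈ vs vs′ m)))) (sym (proj₂ (All.lookup b′ (proj₂ (pairUp-∈ vs vs′ m)))))
  chains-adj {vs = v ∷ w ∷ vs} {v′ ∷ w′ ∷ vs′} (cons _ a b _) (cons _ a′ b′ _) l (there m) (here refl) =
    trans (adj-sym G _ v) (trans (first m) (adj-sym G′ v′ _))
    where
    first : ∀ {x x′} → (x , x′) ∈ (w , w′) ∷ pairUp vs vs′ → adj G v x ≡ adj G′ v′ x′
    first (here refl) = trans a (sym a′)
    first (there m) = trans (proj₂ (All.lookup b (proj₁ (pairUp-∈ vs vs′ m)))) (sym (proj₂ (All.lookup b′ (proj₂ (pairUp-∈ vs vs′ m)))))
  chains-adj (cons _ _ _ c) (cons _ _ _ c′) l (there m) (there m′) = chains-adj c c′ (ℕP.suc-injective l) m m′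
  chains-adj (one _)        (cons _ _ _ _)  () _ _
  chains-adj (cons _ _ _ _) (one _)         () _ _

  matchLinks : List (Link G hub) → List (Link G′ hub′) → List (Fin n × Fin m)
  matchLinks (c ∷ cs) (c′ ∷ cs′) = pairUp (vertices c) (vertices c′) ++ matchLinks cs cs′
  matchLinks _        _          = []

  private
    split : ∀ {c : Link G hub} {c′ : Link G′ hub′} {ss ss′} → shape c ∷ ss ≡ shape c′ ∷ ss′ →
            left c ≡ left c′ × right c ≡ right c′ × length (vertices c) ≡ length (vertices c′) × ss ≡ ss′
    split e = cong proj₁ (ListP.∷-injectiveˡ e) , cong (λ s → proj₂ (proj₂ s)) (ListP.∷-injectiveˡ e) ,
              cong (λ s → proj₁ (proj₂ s)) (ListP.∷-injectiveˡ e) , ListP.∷-injectiveʳ e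

    head-length : ∀ {c : Link G hub} {c′ : Link G′ hub′} {ss ss′} → shape c ∷ ss ≡ shape c′ ∷ ss′ →
                  length (vertices c) ≡ length (vertices c′)
    head-length {c} {c′} e = proj₁ (proj₂ (proj₂ (split {c} {c′} e)))

  matchLinks-proj₁ : ∀ cs cs′ → map shape cs ≡ map shape cs′ → map proj₁ (matchLinks cs cs′) ≡ linkVertices cs
  matchLinks-proj₁ []       []         _ = refl
  matchLinks-proj₁ (c ∷ cs) (c′ ∷ cs′) e = trans (ListP.map-++ proj₁ (pairUp (vertices c) (vertices c′)) (matchLinks cs cs′))
    (cong₂ _++_ (pairUp-proj₁ (vertices c) (vertices c′) (head-length {c} {c′} e)) (matchLinks-proj₁ cs cs′ (ListP.∷-injectiveʳ e)))

  matchLinks-proj₂ : ∀ cs cs′ → map shape cs ≡ map shape cs′ → map proj₂ (matchLinks cs cs′) ≡ linkVertices cs′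
  matchLinks-proj₂ []       []         _ = refl
  matchLinks-proj₂ (c ∷ cs) (c′ ∷ cs′) e = trans (ListP.map-++ proj₂ (pairUp (vertices c) (vertices c′)) (matchLinks cs cs′))
    (cong₂ _++_ (pairUp-proj₂ (vertices c) (vertices c′) (head-length {c} {c′} e)) (matchLinks-proj₂ cs cs′ (ListP.∷-injectiveʳ e)))

  matchLinks-∈ : ∀ cs cs′ {u u′} → (u , u′) ∈ matchLinks cs cs′ → u ∈ linkVertices cs × u′ ∈ linkVertices cs′
  matchLinks-∈ (c ∷ cs) (c′ ∷ cs′) m with ∈-++⁻ (pairUp (vertices c) (vertices c′)) m
  ... | inj₁ m′ = ∈-++⁺ˡ (proj₁ (pairUp-∈ _ _ m′)) , ∈-++⁺ˡ (proj₂ (pairUp-∈ _ _ m′))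
  ... | inj₂ m′ = ∈-++⁺ʳ (vertices c) (proj₁ (matchLinks-∈ cs cs′ m′)) , ∈-++⁺ʳ (vertices c′) (proj₂ (matchLinks-∈ cs cs′ m′))

  private
    aligned : ∀ (c : Link G hub) (c′ : Link G′ hub′) → left c ≡ left c′ → right c ≡ right c′ →
              Chain G′ hub′ (left c) (vertices c′) (right c)
    aligned c c′ e f = subst₂ (λ l r → Chain G′ hub′ l (vertices c′) r) (sym e) (sym f) (chain c′)

  matchLinks-hub : ∀ cs cs′ → map shape cs ≡ map shape cs′ → ∀ {u u′} → (u , u′) ∈ matchLinks cs cs′ →
                   ∀ h → adj G u (hub h) ≡ adj G′ u′ (hub′ h)
  matchLinks-hub (c ∷ cs) (c′ ∷ cs′) e m h with split {c} {c′} e | ∈-++⁻ (pairUp (vertices c) (vertices c′)) m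
  ... | l , r , k , _ | inj₁ m′ = chains-hub (chain c) (aligned c c′ l r) k m′ h
  ... | _ , _ , _ , q | inj₂ m′ = matchLinks-hub cs cs′ q m′ h

  matchLinks-adj : ∀ cs cs′ → map shape cs ≡ map shape cs′ → AllPairs Separate cs → AllPairs Separate cs′ →
                   ∀ {u u′ v v′} → (u , u′) ∈ matchLinks cs cs′ → (v , v′) ∈ matchLinks cs cs′ → adj G u v ≡ adj G′ u′ v′
  matchLinks-adj (c ∷ cs) (c′ ∷ cs′) e (s ∷ ss) (s′ ∷ ss′) {u} {u′} {v} {v′} m₁ m₂
    with split {c} {c′} e | ∈-++⁻ (pairUp (vertices c) (vertices c′)) m₁ | ∈-++⁻ (pairUp (vertices c) (vertices c′)) m₂
  ... | l , r , k , _ | inj₁ p | inj₁ q = chains-adj (chain c) (aligned c c′ l r) k p q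
  ... | _ , _ , _ , x | inj₂ p | inj₂ q = matchLinks-adj cs cs′ x ss ss′ p q
  ... | _ | inj₁ p | inj₂ q = trans
    (proj₂ (separate-∈ c s (proj₁ (pairUp-∈ _ _ p)) (proj₁ (matchLinks-∈ cs cs′ q))))
    (sym (proj₂ (separate-∈ c′ s′ (proj₂ (pairUp-∈ _ _ p)) (proj₂ (matchLinks-∈ cs cs′ q)))))
  ... | _ | inj₂ p | inj₁ q = trans (adj-sym G u v) (trans (trans
    (proj₂ (separate-∈ c s (proj₁ (pairUp-∈ _ _ q)) (proj₁ (matchLinks-∈ cs cs′ p))))
    (sym (proj₂ (separate-∈ c′ s′ (proj₂ (pairUp-∈ _ _ q)) (proj₂ (matchLinks-∈ cs cs′ p)))))) (adj-sym G′ v′ u′))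

link-nonempty : ∀ {n} {G : Graph n} {hub} (c : Link G hub) → length (vertices c) ≢ 0
link-nonempty record { chain = one _ }        ()
link-nonempty record { chain = cons _ _ _ _ } ()

-- A chain has at least one vertex, so the entry of length 0 from `phantom` cannot be mistaken for a
-- link.
phantom-injective : ∀ {n m} {G : Graph n} {G′ : Graph m} {hub hub′} b b′ (cs : List (Link G hub)) (cs′ : List (Link G′ hub′)) →
                    phantom b ++ map shape cs ≡ phantom b′ ++ map shape cs′ → b ≡ b′ × map shape cs ≡ map shape cs′
phantom-injective true  true  cs       cs′        e = refl , ListP.∷-injectiveʳ e
phantom-injective false false cs       cs′        e = refl , e
phantom-injective true  false cs       (c ∷ cs′)  e = ⊥-elim (link-nonempty c (sym (cong (λ s → proj₁ (proj₂ s)) (ListP.∷-injectiveˡ e))))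
phantom-injective false true  (c ∷ cs) cs′        e = ⊥-elim (link-nonempty c (cong (λ s → proj₁ (proj₂ s)) (ListP.∷-injectiveˡ e)))

-- Links are matched position by position. Within a link the labels and the path structure fix all
-- adjacencies, and vertices of different links are non-adjacent on both sides.
same-shapes : ∀ {n m} {G : Graph n} {G′ : Graph m} (D : Decomposition G) (D′ : Decomposition G′) →
              shapes D ≡ shapes D′ → Isomorphic G G′
same-shapes {n} {m} {G} {G′} D D′ e = Matching.isomorphic G G′ zs all₁ all₂ preserve
  where
  module D = Decomposition D
  module D′ = Decomposition D′
  a = D.hub hubA
  b = D.hub hubB
  a′ = D′.hub hubA
  b′ = D′.hub hubB
  same : adj G a b ≡ adj G′ a′ b′ × map shape D.links ≡ map shape D′.links
  same = phantom-injective (adj G a b) (adj G′ a′ b′) D.links D′.links e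
  ls = matchLinks D.links D′.links
  zs : List (Fin n × Fin m)
  zs = (a , a′) ∷ (b , b′) ∷ ls
  all₁ : map proj₁ zs ↭ allFin n
  all₁ = subst (λ l → a ∷ b ∷ l ↭ allFin n) (sym (matchLinks-proj₁ D.links D′.links (proj₂ same))) D.cover
  all₂ : map proj₂ zs ↭ allFin m
  all₂ = subst (λ l → a′ ∷ b′ ∷ l ↭ allFin m) (sym (matchLinks-proj₂ D.links D′.links (proj₂ same))) D′.cover
  hubs : ∀ {u u′} → (u , u′) ∈ ls → ∀ h → adj G u (D.hub h) ≡ adj G′ u′ (D′.hub h)
  hubs = matchLinks-hub D.links D′.links (proj₂ same)
  preserve : ∀ {u u′ v v′} → (u , u′) ∈ zs → (v , v′) ∈ zs → adj G u v ≡ adj G′ u′ v′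
  preserve (here refl) (here refl) = trans (irrefl G a) (sym (irrefl G′ a′))
  preserve (here refl) (there (here refl)) = proj₁ same
  preserve (there (here refl)) (here refl) = trans (adj-sym G b a) (trans (proj₁ same) (adj-sym G′ a′ b′))
  preserve (there (here refl)) (there (here refl)) = trans (irrefl G b) (sym (irrefl G′ b′))
  preserve {v = v} {v′} (here refl) (there (there p)) = trans (adj-sym G a v) (trans (hubs p hubA) (adj-sym G′ v′ a′))
  preserve {v = v} {v′} (there (here refl)) (there (there p)) = trans (adj-sym G b v) (trans (hubs p hubB) (adj-sym G′ v′ b′))
  preserve (there (there p)) (here refl) = hubs p hubA
  preserve (there (there p)) (there (here refl)) = hubs p hubB
  preserve (there (there p)) (there (there q)) = matchLinks-adj D.links D′.links (proj₂ same) D.separate D′.separate p q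

orderSum : List Shape → ℕ
orderSum = total (λ s → proj₁ (proj₂ s))

shapes-order : ∀ {n} {G : Graph n} (D : Decomposition G) → 2 ℕ.+ orderSum (shapes D) ≡ n
shapes-order {n} {G} D = trans (cong (2 ℕ.+_) (trans (drop (adj G (hub hubA) (hub hubB))) (sum links)))
  (trans (PermP.↭-length cover) (ListP.length-tabulate {n = n} (λ i → i)))
  where
  open Decomposition D
  drop : ∀ b → orderSum (phantom b ++ map shape links) ≡ orderSum (map shape links)
  drop true  = refl
  drop false = refl
  sum : ∀ cs → orderSum (map shape cs) ≡ length (linkVertices {G = G} {hub} cs)
  sum []       = refl
  sum (c ∷ cs) = trans (cong (length (vertices c) ℕ.+_) (sum cs)) (sym (ListP.length-++ (vertices c)))

-- Explicit cospectral mates for the three exceptions.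

-- A leaf whose neighbour has two further neighbours. H₍ₙ₎ has none, its cospectral mates below do.
LeafAtBranch : ∀ {n} → Graph n → Set
LeafAtBranch {n} G = ∃ λ (i : Fin n) → ∃ λ (j : Fin n) →
  (adj G i j ≡ true × (∀ k → adj G i k ≡ true → k ≡ j)) ×
  ∃ λ (a : Fin n) → ∃ λ (b : Fin n) → adj G j a ≡ true × adj G j b ≡ true × i ≢ a × i ≢ b × a ≢ b

leafAtBranch? : ∀ {n} (G : Graph n) → Dec (LeafAtBranch G)
leafAtBranch? G = FinP.any? λ i → FinP.any? λ j →
  (adj G i j BoolP.≟ true ×-dec FinP.all? (λ k → (adj G i k BoolP.≟ true) →-dec (k FinP.≟ j))) ×-dec
  FinP.any? λ a → FinP.any? λ b → (adj G j a BoolP.≟ true) ×-dec (adj G j b BoolP.≟ true) ×-dec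
    ¬? (i FinP.≟ a) ×-dec ¬? (i FinP.≟ b) ×-dec ¬? (a FinP.≟ b)

leafAtBranch-iso : ∀ {n m} {G : Graph n} {G′ : Graph m} → Isomorphic G G′ → LeafAtBranch G′ → LeafAtBranch G
leafAtBranch-iso {G = G} {G′} (σ , pres) (i , j , (ij , leaf) , a , b , ja , jb , i≢a , i≢b , a≢b) =
  from i , from j , (back ij , λ k ik → trans (sym (inverseʳ k)) (cong from (leaf (to k)
    (trans (cong (λ z → adj G′ z (to k)) (sym (inverseˡ i))) (trans (sym (pres (from i) k)) ik))))) ,
  from a , from b , back ja , back jb , distinct i≢a , distinct i≢b , distinct a≢b
  where
  open Inverse σ using (to; from)
  inverseˡ : ∀ x → to (from x) ≡ x
  inverseˡ x = Inverse.strictlyInverseˡ σ x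
  inverseʳ : ∀ x → from (to x) ≡ x
  inverseʳ x = Inverse.strictlyInverseʳ σ x
  back : ∀ {u v} → adj G′ u v ≡ true → adj G (from u) (from v) ≡ true
  back {u} {v} e = trans (pres (from u) (from v)) (trans (cong₂ (adj G′) (inverseˡ u) (inverseˡ v)) e)
  distinct : ∀ {u v} → u ≢ v → from u ≢ from v
  distinct {u} {v} ne e = ne (trans (sym (inverseˡ u)) (trans (cong to e) (inverseˡ v)))

-- A Boolean test, since comparing the polynomials themselves by refl recomputes the determinant
-- for every coefficient.
sameℤ : ℤ → ℤ → Bool
sameℤ (+ a)         (+ b)         = a ≡ᵇ b
sameℤ ℤ.-[1+ a ] ℤ.-[1+ b ] = a ≡ᵇ b
sameℤ _             _             = false

samePoly : Poly → Poly → Bool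
samePoly []      []      = true
samePoly (a ∷ p) (b ∷ q) = sameℤ a b ∧ samePoly p q
samePoly _       _       = false

sameℤ-sound : ∀ a b → sameℤ a b ≡ true → a ≡ b
sameℤ-sound (+ a)      (+ b)      e = cong +_ (ℕP.≡ᵇ⇒≡ a b (≡true⇒T e))
sameℤ-sound ℤ.-[1+ a ] ℤ.-[1+ b ] e = cong ℤ.-[1+_] (ℕP.≡ᵇ⇒≡ a b (≡true⇒T e))

samePoly-sound : ∀ p q → samePoly p q ≡ true → p ≡ q
samePoly-sound []      []      e = refl
samePoly-sound (a ∷ p) (b ∷ q) e with ∧-true {sameℤ a b} e
... | e₁ , e₂ = cong₂ _∷_ (sameℤ-sound a b e₁) (samePoly-sound p q e₂)

-- Cospectrality goes through the explicit common polynomial `p`; non-isomorphism through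
-- `LeafAtBranch`, decided separately for the two graphs.
refute : ∀ {n m} (G : Graph n) (G′ : Graph m) (p : Poly) →
         samePoly (charPoly G) p ≡ true → samePoly (charPoly G′) p ≡ true →
         False (leafAtBranch? G) → True (leafAtBranch? G′) → ¬ DS G
refute {m = m} G G′ p e e′ absent present ds = toWitnessFalse absent
  (leafAtBranch-iso {G = G} {G′} (ds m G′ (λ k → cong (λ p → coeff p k) (trans (samePoly-sound (charPoly G) p e) (sym (samePoly-sound (charPoly G′) p e′))))) (toWitness present))

-- A hexagon with pendant vertices at two antipodal vertices, and an isolated edge.
mate₁₀ : Graph 10
mate₁₀ = fromEdges 10 ((0 , 1) ∷ (1 , 2) ∷ (2 , 3) ∷ (3 , 4) ∷ (4 , 5) ∷ (5 , 0) ∷ (6 , 0) ∷ (7 , 3) ∷ (8 , 9) ∷ [])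

-- A hexagon with one pendant vertex, and the Dynkin diagram E₆.
mate₁₃ : Graph 13
mate₁₃ = fromEdges 13 ((0 , 1) ∷ (1 , 2) ∷ (2 , 3) ∷ (3 , 4) ∷ (4 , 5) ∷ (5 , 0) ∷ (6 , 0) ∷
                       (7 , 8) ∷ (8 , 9) ∷ (9 , 10) ∷ (10 , 11) ∷ (9 , 12) ∷ [])

-- A hexagon, and a path on seven vertices with pendant vertices at its second and third vertex.
mate₁₅ : Graph 15
mate₁₅ = fromEdges 15 ((0 , 1) ∷ (1 , 2) ∷ (2 , 3) ∷ (3 , 4) ∷ (4 , 5) ∷ (5 , 0) ∷
                       (6 , 7) ∷ (7 , 8) ∷ (8 , 9) ∷ (9 , 10) ∷ (10 , 11) ∷ (11 , 12) ∷ (7 , 13) ∷ (8 , 14) ∷ [])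

poly₁₀ : Poly
poly₁₀ = - + 1 ∷ + 0 ∷ + 13 ∷ + 0 ∷ - + 30 ∷ + 0 ∷ + 26 ∷ + 0 ∷ - + 9 ∷ + 0 ∷ + 1 ∷ []

not-DS₁₀ : ¬ DSΣ (H 10)
not-DS₁₀ = refute (proj₂ (H 10)) mate₁₀ poly₁₀ refl refl tt tt

poly₁₃ : Poly
poly₁₃ = + 0 ∷ + 7 ∷ + 0 ∷ - + 48 ∷ + 0 ∷ + 107 ∷ + 0 ∷ - + 108 ∷ + 0 ∷ + 53 ∷ + 0 ∷ - + 12 ∷ + 0 ∷ + 1 ∷ []

not-DS₁₃ : ¬ DSΣ (H 13)
not-DS₁₃ = refute (proj₂ (H 13)) mate₁₃ poly₁₃ refl refl tt tt

poly₁₅ : Poly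
poly₁₅ = + 0 ∷ - + 8 ∷ + 0 ∷ + 74 ∷ + 0 ∷ - + 214 ∷ + 0 ∷ + 289 ∷ + 0 ∷ - + 204 ∷ + 0 ∷ + 76 ∷ + 0 ∷ - + 14 ∷ + 0 ∷ + 1 ∷ []

not-DS₁₅ : ¬ DSΣ (H 15)
not-DS₁₅ = refute (proj₂ (H 15)) mate₁₅ poly₁₅ refl refl tt tt

-- Both directions of the equivalence.

module _ {j N : ℕ} {G : Graph N} (D : Decomposition G) (D-shapes : shapes D ≡ pathShapes j) where
  private
    pathSpectrum : ∀ {G′ : Graph N} → (∀ t → Φ G t ≡ Φ G′ t) → PathSpectrum G′ j
    pathSpectrum {G′} same = record { spectrum = λ τ → trans (cong (weight (+ τ) (pathShapes j) *_) (sym (same (+ τ))))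
      (subst (λ ss → weight (+ τ) ss * Φ G (+ τ) ≡ schurDet (+ τ) ss) D-shapes (shapes-formula D τ)) }

    lens-equation : ∀ {G′ : Graph N} → PathSpectrum G′ j → (D′ : Decomposition G′) → ∀ {L} → shapes D′ ≡ render L → ∀ τ →
      LensEquation τ L j
    lens-equation {G′} S D′ {L} e τ = record { equation = begin
      (1ℤ - t * t) * schurDet t (render L)
        ≡⟨ cong ((1ℤ - t * t) *_) (sym (subst (λ ss → weight t ss * Φ G′ t ≡ schurDet t ss) e (shapes-formula D′ τ))) ⟩
      (1ℤ - t * t) * (weight t (render L) * Φ G′ t)  ≡⟨ lemma (1ℤ - t * t) (weight t (render L)) (Φ G′ t) ⟩
      weight t (render L) * ((1ℤ - t * t) * Φ G′ t)  ≡⟨ cong (weight t (render L) *_) (Φ-reduced S τ) ⟩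
      weight t (render L) * reduced t (t ^ suc j)    ∎ }
      where
      open ≡-Reasoning
      t = + τ
      lemma : ∀ a b c → a * (b * c) ≡ b * (a * c)
      lemma = solve-∀

    conclude : ∀ {G′ : Graph N} (nf : NormalForm G′) →
               (∃ λ k → NormalForm.lens nf ≡ bins (k ∷ []) (2 ∷ 2 ∷ []) (2 ∷ 2 ∷ []) [] [] []) → Isomorphic G G′
    conclude {G′} nf (k , e) = same-shapes D decomposition
      (trans D-shapes (trans (cong pathShapes j≡k) (sym path-shapes)))
      where
      open NormalForm nf
      path-shapes : shapes decomposition ≡ pathShapes k
      path-shapes = trans shapes≡ (cong render e)
      j≡k : j ≡ k
      -- The pendant paths contribute 8 vertices and the hubs 2 in both graphs, so equal order
      -- forces the two middle lengths to agree.
      j≡k = ℕP.+-cancelʳ-≡ 8 j k (ℕP.+-cancelˡ-≡ 2 (j ℕ.+ 8) (k ℕ.+ 8) (trans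
        (trans (cong (λ ss → 2 ℕ.+ orderSum ss) (sym D-shapes)) (shapes-order D))
        (sym (trans (cong (λ ss → 2 ℕ.+ orderSum ss) (sym path-shapes)) (shapes-order decomposition)))))

    finish : ∀ {G′ : Graph N} → j ≢ 0 → j ≢ 3 → PathSpectrum G′ j → NormalForm G′ → Isomorphic G G′
    finish j≢0 j≢3 S nf = conclude nf (tree-lengths (NormalForm.admissible nf) j≢0 j≢3
      (lens-equation S (NormalForm.decomposition nf) {NormalForm.lens nf} (NormalForm.shapes≡ nf) 16))

    isomorphic : j ≢ 0 → j ≢ 3 → j ≢ 5 → ∀ {m} (G′ : Graph m) → N ≡ m → Cospectral G G′ → Isomorphic G G′
    isomorphic j≢0 j≢3 j≢5 G′ refl co =
      finish j≢0 j≢3 S (normal-form S j≢5 (subst (2 ≤_) (shapes-order D) (s≤s (s≤s z≤n))))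
      where
      S : PathSpectrum G′ j
      S = pathSpectrum (cospectral⇒Φ G G′ co)

  shapes-DS : j ≢ 0 → j ≢ 3 → j ≢ 5 → DS G
  shapes-DS j≢0 j≢3 j≢5 m G′ co = isomorphic j≢0 j≢3 j≢5 G′ (cospectral⇒≡ G G′ co) co

numbered-DS :
  ∀ j {N : ℕ} (size : N ≡ 10 ℕ.+ j) (G : Graph N) (vtx : ℕ → Fin N) →
  (∀ {k} → k < 10 ℕ.+ j → toℕ (vtx k) ≡ k) → (∀ v → vtx (toℕ v) ≡ v) →
  (∀ {u v} → u < 10 ℕ.+ j → v < 10 ℕ.+ j → Numbering.Edge j u v → adj G (vtx u) (vtx v) ≡ true) →
  (∀ {u v} → u < 10 ℕ.+ j → v < 10 ℕ.+ j → ¬ Numbering.Edge j u v → ¬ Numbering.Edge j v u → adj G (vtx u) (vtx v) ≡ false) →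
  j ≢ 0 → j ≢ 3 → j ≢ 5 → DS G
numbered-DS j size G vtx toℕ-vtx vtx-toℕ adj-Edge nonadj-Edge = shapes-DS decomposition shapes-path
  where open PathDecomposition j size G vtx toℕ-vtx vtx-toℕ adj-Edge nonadj-Edge

path-DS : ∀ j → j ≢ 0 → j ≢ 3 → j ≢ 5 → DS (PathWithTwoPendants.G j)
path-DS j = numbered-DS j {PathWithTwoPendants.N j} size G vtx toℕ-vtx vtx-toℕ
  (λ {u} {v} → adj-Edge {u} {v}) (λ {u} {v} → nonadj-Edge {u} {v})
  where open PathWithTwoPendants j hiding (N)

-- Converting DS along this equation by computation alone would unfold both characteristic polynomials.
path-≡ : ∀ j → (PathWithTwoPendants.N j , PathWithTwoPendants.G j) ≡ H (10 ℕ.+ j)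
path-≡ j = refl

path-DSΣ : ∀ j → j ≢ 0 → j ≢ 3 → j ≢ 5 → DSΣ (H (10 ℕ.+ j))
path-DSΣ j p q r =
  subst DSΣ {PathWithTwoPendants.N j , PathWithTwoPendants.G j} {H (10 ℕ.+ j)} (path-≡ j) (path-DS j p q r)

DS⇒≢ : ∀ (n : ℕ) → DSΣ (H n) → (n ≢ 10 × n ≢ 13 × n ≢ 15)
DS⇒≢ n ds = (λ e → not-DS₁₀ (subst (λ k → DSΣ (H k)) e ds)) ,
          (λ e → not-DS₁₃ (subst (λ k → DSΣ (H k)) e ds)) ,
          (λ e → not-DS₁₅ (subst (λ k → DSΣ (H k)) e ds))

≢⇒DS : ∀ n → 10 ≤ n → (n ≢ 10 × n ≢ 13 × n ≢ 15) → DSΣ (H n)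
≢⇒DS n 10≤n (n≢10 , n≢13 , n≢15) = subst (λ k → DSΣ (H k)) 10+j≡n
  (path-DSΣ j (λ e → n≢10 (from-j e)) (λ e → n≢13 (from-j e)) (λ e → n≢15 (from-j e)))
  where
  j = n ℕ.∸ 10
  10+j≡n : 10 ℕ.+ j ≡ n
  10+j≡n = ℕP.m+[n∸m]≡n 10≤n
  from-j : ∀ {i} → j ≡ i → n ≡ 10 ℕ.+ i
  from-j e = trans (sym 10+j≡n) (cong (10 ℕ.+_) e)

theorem1p1 : ∀ (n : ℕ) → 10 ≤ n →
    (DSΣ (H n) ⇔ (n ≢ 10 × n ≢ 13 × n ≢ 15))
theorem1p1 n 10≤n = mk⇔ {A = DSΣ (H n)} (DS⇒≢ n) (≢⇒DS n 10≤n)
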